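{- Let $r\ge1$ be an integer. The number of subgroup classes of abelian groups of rank less than or equal to $r$ and order at most $x$ is asymptotic, as $x\to\infty$, to $C_r\,x\log x$, where $C_r$ is a constant depending on $r$. That is, there is a constant $C_r$ with $$\sum_{n\le x}A_r(n)\sim C_r\,x\log x\qquad (x\to\infty).$$
   Context: For a finite abelian group $G$, the number of subgroup classes of $G$ is the number of isomorphism classes of groups $H$ that are isomorphic to a subgroup of $G$ (isomorphic subgroups are counted once). $A_r(n)$ is the sum, over isomorphism classes of abelian groups $G$ of order $n$ and rank at most $r$ (rank = minimal number of generators), of the number of subgroup classes of $G$. -}

module Defs where

open import Algebra.Bundles using (Group; RawGroup)
open import Algebra.Core using (Op₁; Op₂)
import Algebra.Definitions as Definitions
open import Algebra.Morphism.Structures using (module GroupMorphisms)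
open import Algebra.Structures using (IsGroup)
open import Data.Fin.Base as Fin using (Fin; finToFun; funToFin)
import Data.Fin.Properties as Fin
open import Data.Fin.Subset using (Subset; _∈_; _⊆_) renaming (∣_∣ to card)
import Data.Fin.Subset.Properties as Subset
open import Data.Integer.Base as ℤ using (+_)
import Data.Integer.Properties as ℤ
open import Data.List.Base as List using (List; length; filter; deduplicate; upTo)
open import Data.List.Membership.Propositional using (lose)
open import Data.List.Membership.Propositional.Properties using (∈-allFin)
open import Data.List.Relation.Unary.Any using (Any; here)
import Data.List.Relation.Unary.Any.Properties as Any
open import Data.Maybe.Base as Maybe using (Maybe)
open import Data.Nat.Base as ℕ using (ℕ; zero; suc)
open import Data.Nat.ListAction using (sum)
import Data.Nat.Properties as ℕ
open import Data.Product.Base using (∃; ∃₂; _×_; _,_; proj₁; proj₂)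
open import Data.Rational.Base as ℚ using (ℚ; 0ℚ; 1ℚ)
import Data.Rational.Properties as ℚₚ
open import Data.Rational.Solver using (module +-*-Solver)
import Data.Rational.Unnormalised.Base as ℚᵘ
open import Data.Sum.Base using (inj₁; inj₂)
open import Data.Vec.Base using (tabulate)
open import Data.Vec.Properties using (lookup∘tabulate; lookup⇒[]=; []=⇒lookup)
open import Function.Base using (_∘_; id)
open import Level using (0ℓ)
open import Relation.Binary.Core using (Rel)
open import Relation.Binary.Definitions using (Decidable; _Respects_)
open import Relation.Binary.PropositionalEquality
  using (_≡_; _≗_; refl; sym; trans; cong; cong₂; subst; isEquivalence)
open import Relation.Nullary using (Dec; yes; no; does; contradiction; decidable-stable)
open import Relation.Nullary.Decidable using (map′; dec-true; dec⇒maybe; _×-dec_; _→-dec_; ¬?)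
import Relation.Unary as U

⌜_⌝ : ℕ → ℚ
⌜ n ⌝ = + n ℚ./ 1

⌜⌝-suc : ∀ n → ⌜ suc n ⌝ ≡ ⌜ n ⌝ ℚ.+ 1ℚ
⌜⌝-suc n = ℚₚ.toℚᵘ-injective (begin-equality
  ℚ.toℚᵘ ⌜ suc n ⌝               ≃⟨ ℚₚ.toℚᵘ-fromℚᵘ (ℚᵘ.mkℚᵘ (+ suc n) 0) ⟩
  ℚᵘ.mkℚᵘ (+ suc n) 0            ≃⟨ ℚᵘ.*≡* (cong (ℤ._* + 1) (trans (cong +_ (ℕ.+-comm 1 n))
                                      (cong₂ ℤ._+_ (sym (ℤ.*-identityʳ (+ n))) refl))) ⟩
  ℚᵘ.mkℚᵘ (+ n) 0 ℚᵘ.+ ℚᵘ.1ℚᵘ    ≃⟨ +-congˡ ℚᵘ.1ℚᵘ (≃-sym (ℚₚ.toℚᵘ-fromℚᵘ (ℚᵘ.mkℚᵘ (+ n) 0))) ⟩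
  ℚ.toℚᵘ ⌜ n ⌝ ℚᵘ.+ ℚ.toℚᵘ 1ℚ    ≃⟨ ≃-sym (ℚₚ.toℚᵘ-homo-+ ⌜ n ⌝ 1ℚ) ⟩
  ℚ.toℚᵘ (⌜ n ⌝ ℚ.+ 1ℚ) ∎)
  where
  open import Data.Rational.Unnormalised.Properties using (+-congˡ; ≃-sym; module ≤-Reasoning)
  open ≤-Reasoning

module Rational where
  open import Data.Rational.Base hiding (ℚ; 0ℚ; 1ℚ)
  open ℚₚ.≤-Reasoning
  open +-*-Solver

  ⌜⌝-+ : ∀ m n → ⌜ m ℕ.+ n ⌝ ≡ ⌜ m ⌝ + ⌜ n ⌝
  ⌜⌝-+ zero    n = sym (ℚₚ.+-identityˡ ⌜ n ⌝)
  ⌜⌝-+ (suc m) n = begin-equality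
    ⌜ suc (m ℕ.+ n) ⌝        ≡⟨ ⌜⌝-suc (m ℕ.+ n) ⟩
    ⌜ m ℕ.+ n ⌝ + 1ℚ         ≡⟨ cong (_+ 1ℚ) (⌜⌝-+ m n) ⟩
    ⌜ m ⌝ + ⌜ n ⌝ + 1ℚ       ≡⟨ solve 3 (λ a b c → a :+ b :+ c := a :+ c :+ b) refl ⌜ m ⌝ ⌜ n ⌝ 1ℚ ⟩
    ⌜ m ⌝ + 1ℚ + ⌜ n ⌝       ≡⟨ cong (_+ ⌜ n ⌝) (⌜⌝-suc m) ⟨
    ⌜ suc m ⌝ + ⌜ n ⌝        ∎

  ⌜⌝-* : ∀ m n → ⌜ m ℕ.* n ⌝ ≡ ⌜ m ⌝ * ⌜ n ⌝
  ⌜⌝-* zero    n = sym (ℚₚ.*-zeroˡ ⌜ n ⌝)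
  ⌜⌝-* (suc m) n = begin-equality
    ⌜ n ℕ.+ m ℕ.* n ⌝        ≡⟨ ⌜⌝-+ n (m ℕ.* n) ⟩
    ⌜ n ⌝ + ⌜ m ℕ.* n ⌝      ≡⟨ cong (_+_ ⌜ n ⌝) (⌜⌝-* m n) ⟩
    ⌜ n ⌝ + ⌜ m ⌝ * ⌜ n ⌝    ≡⟨ solve 2 (λ a b → b :+ a :* b := (a :+ con 1ℚ) :* b) refl ⌜ m ⌝ ⌜ n ⌝ ⟩
    (⌜ m ⌝ + 1ℚ) * ⌜ n ⌝     ≡⟨ cong (_* ⌜ n ⌝) (⌜⌝-suc m) ⟨
    ⌜ suc m ⌝ * ⌜ n ⌝        ∎

  0≤⌜_⌝ : ∀ n → 0ℚ ≤ ⌜ n ⌝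
  0≤⌜ n ⌝ = ℚₚ.nonNegative⁻¹ ⌜ n ⌝ {{ℚₚ.normalize-nonNeg n 1}}

  ⌜⌝-mono : ∀ {m n} → m ℕ.≤ n → ⌜ m ⌝ ≤ ⌜ n ⌝
  ⌜⌝-mono {m} {n} m≤n = begin
    ⌜ m ⌝                    ≡⟨ ℚₚ.+-identityʳ ⌜ m ⌝ ⟨
    ⌜ m ⌝ + 0ℚ               ≤⟨ ℚₚ.+-monoʳ-≤ ⌜ m ⌝ 0≤⌜ n ℕ.∸ m ⌝ ⟩
    ⌜ m ⌝ + ⌜ n ℕ.∸ m ⌝      ≡⟨ ⌜⌝-+ m (n ℕ.∸ m) ⟨
    ⌜ m ℕ.+ (n ℕ.∸ m) ⌝      ≡⟨ cong ⌜_⌝ (ℕ.m+[n∸m]≡n m≤n) ⟩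
    ⌜ n ⌝                    ∎

  archimedean : ∀ p → ∃ λ n → p ≤ ⌜ n ⌝
  archimedean p@(mkℚ (ℤ.-[1+ _ ]) _ _) = 0 , ℚₚ.≤-trans (ℚₚ.nonPositive⁻¹ p) 0≤⌜ 0 ⌝
  archimedean p@(mkℚ (+ n) d _) = n , ℚₚ.toℚᵘ-cancel-≤ (≤-respʳ-≃ (≃-sym (ℚₚ.toℚᵘ-fromℚᵘ (ℚᵘ.mkℚᵘ (+ n) 0)))
    (ℚᵘ.*≤* (ℤ.*-monoˡ-≤-nonNeg (+ n) {+ 1} {+ suc d} (ℤ.+≤+ (ℕ.s≤s ℕ.z≤n)))))
    where open import Data.Rational.Unnormalised.Properties using (≤-respʳ-≃; ≃-sym)

  p≤∣p∣ : ∀ p → p ≤ ∣ p ∣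
  p≤∣p∣ p with ℚₚ.≤-total 0ℚ p
  ... | inj₁ 0≤p = ℚₚ.≤-reflexive (sym (ℚₚ.0≤p⇒∣p∣≡p 0≤p))
  ... | inj₂ p≤0 = ℚₚ.≤-trans p≤0 (ℚₚ.0≤∣p∣ p)

  ∣p∣≤ : ∀ {p e} → p ≤ e → - p ≤ e → ∣ p ∣ ≤ e
  ∣p∣≤ {p} p≤e -p≤e with ℚₚ.∣p∣≡p∨∣p∣≡-p p
  ... | inj₁ eq = ℚₚ.≤-trans (ℚₚ.≤-reflexive eq) p≤e
  ... | inj₂ eq = ℚₚ.≤-trans (ℚₚ.≤-reflexive eq) -p≤e

  ∣p-q∣≡∣q-p∣ : ∀ p q → ∣ p - q ∣ ≡ ∣ q - p ∣
  ∣p-q∣≡∣q-p∣ p q = trans (sym (ℚₚ.∣-p∣≡∣p∣ (p - q)))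
    (cong ∣_∣ (solve 2 (λ a b → :- (a :- b) := b :- a) refl p q))

  p≤q+r⇒p-q≤r : ∀ {p} q {r} → p ≤ q + r → p - q ≤ r
  p≤q+r⇒p-q≤r {p} q {r} le = begin
    p - q          ≤⟨ ℚₚ.+-monoˡ-≤ (- q) le ⟩
    q + r - q      ≡⟨ solve 2 (λ a b → a :+ b :- a := b) refl q r ⟩
    r              ∎

  p-q≤r⇒p≤q+r : ∀ {p} q {r} → p - q ≤ r → p ≤ q + r
  p-q≤r⇒p≤q+r {p} q {r} le = begin
    p              ≡⟨ solve 2 (λ a b → a := b :+ (a :- b)) refl p q ⟩
    q + (p - q)    ≤⟨ ℚₚ.+-monoʳ-≤ q le ⟩
    q + r          ∎

  p≤q+∣p-q∣ : ∀ p q → p ≤ q + ∣ p - q ∣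
  p≤q+∣p-q∣ p q = p-q≤r⇒p≤q+r q (p≤∣p∣ (p - q))

  ∣p-q∣≤ : ∀ {p q r} → p ≤ q + r → q ≤ p + r → ∣ p - q ∣ ≤ r
  ∣p-q∣≤ {p} {q} {r} le₁ le₂ = ∣p∣≤ (p≤q+r⇒p-q≤r q le₁) (begin
    - (p - q)      ≡⟨ solve 2 (λ a b → :- (a :- b) := b :- a) refl p q ⟩
    q - p          ≤⟨ p≤q+r⇒p-q≤r p le₂ ⟩
    r              ∎)

  0≤p*q : ∀ {p q} → 0ℚ ≤ p → 0ℚ ≤ q → 0ℚ ≤ p * q
  0≤p*q {p} {q} 0≤p 0≤q = ℚₚ.nonNegative⁻¹ (p * q)
    {{ℚₚ.nonNeg*nonNeg⇒nonNeg p {{nonNegative 0≤p}} q {{nonNegative 0≤q}}}}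

  0<p*q : ∀ {p q} → 0ℚ < p → 0ℚ < q → 0ℚ < p * q
  0<p*q {p} {q} 0<p 0<q = ℚₚ.positive⁻¹ (p * q)
    {{ℚₚ.pos*pos⇒pos p {{positive 0<p}} q {{positive 0<q}}}}

  *-monoʳ : ∀ {p q r} → 0ℚ ≤ r → p ≤ q → r * p ≤ r * q
  *-monoʳ {r = r} 0≤r = ℚₚ.*-monoˡ-≤-nonNeg r {{nonNegative 0≤r}}

  *-monoˡ : ∀ {p q r} → 0ℚ ≤ r → p ≤ q → p * r ≤ q * r
  *-monoˡ {r = r} 0≤r = ℚₚ.*-monoʳ-≤-nonNeg r {{nonNegative 0≤r}}

  *-mono : ∀ {p q r s} → 0ℚ ≤ p → 0ℚ ≤ s → p ≤ q → r ≤ s → p * r ≤ q * s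
  *-mono 0≤p 0≤s p≤q r≤s = ℚₚ.≤-trans (*-monoʳ 0≤p r≤s) (*-monoˡ 0≤s p≤q)

  shrink : ∀ {k e} → 0ℚ < k → 0ℚ < e → ∃ λ d → 0ℚ < d × k * d ≡ e
  shrink {k} {e} 0<k 0<e = d , 0<p*q (ℚₚ.positive⁻¹ (1/ k) {{ℚₚ.1/pos⇒pos k}}) 0<e , (begin-equality
    k * (1/ k * e)   ≡⟨ ℚₚ.*-assoc k (1/ k) e ⟨
    k * 1/ k * e     ≡⟨ cong (_* e) (ℚₚ.*-inverseʳ k) ⟩
    1ℚ * e           ≡⟨ ℚₚ.*-identityˡ e ⟩
    e                ∎)
    where
    instance _ = positive 0<k
             _ = ℚₚ.pos⇒nonZero k
    d = 1/ k * e

  half : ∀ {e} → 0ℚ < e → 0ℚ < ½ * e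
  half = 0<p*q (ℚₚ.positive⁻¹ ½)

  ½+½ : ∀ e → ½ * e + ½ * e ≡ e
  ½+½ = solve 1 (λ e → con ½ :* e :+ con ½ :* e := e) refl

  ∣+∣-lip : ∀ a b c d → ∣ (a + b) - (c + d) ∣ ≤ ∣ a - c ∣ + ∣ b - d ∣
  ∣+∣-lip a b c d = begin
    ∣ (a + b) - (c + d) ∣      ≡⟨ cong ∣_∣ (solve 4 (λ a b c d → (a :+ b) :- (c :+ d) := (a :- c) :+ (b :- d)) refl a b c d) ⟩
    ∣ (a - c) + (b - d) ∣      ≤⟨ ℚₚ.∣p+q∣≤∣p∣+∣q∣ (a - c) (b - d) ⟩
    ∣ a - c ∣ + ∣ b - d ∣      ∎

  ∣*∣-lip : ∀ a b c d → ∣ a * b - c * d ∣ ≤ ∣ a ∣ * ∣ b - d ∣ + ∣ d ∣ * ∣ a - c ∣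
  ∣*∣-lip a b c d = begin
    ∣ a * b - c * d ∣                      ≡⟨ cong ∣_∣ (solve 4 (λ a b c d → a :* b :- c :* d := a :* (b :- d) :+ d :* (a :- c)) refl a b c d) ⟩
    ∣ a * (b - d) + d * (a - c) ∣          ≤⟨ ℚₚ.∣p+q∣≤∣p∣+∣q∣ (a * (b - d)) (d * (a - c)) ⟩
    ∣ a * (b - d) ∣ + ∣ d * (a - c) ∣      ≡⟨ cong₂ _+_ (ℚₚ.∣p*q∣≡∣p∣*∣q∣ a (b - d)) (ℚₚ.∣p*q∣≡∣p∣*∣q∣ d (a - c)) ⟩
    ∣ a ∣ * ∣ b - d ∣ + ∣ d ∣ * ∣ a - c ∣  ∎

  ∣p∣≤∣q∣+∣p-q∣ : ∀ p q → ∣ p ∣ ≤ ∣ q ∣ + ∣ p - q ∣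
  ∣p∣≤∣q∣+∣p-q∣ p q = begin
    ∣ p ∣                 ≡⟨ cong ∣_∣ (solve 2 (λ a b → a := b :+ (a :- b)) refl p q) ⟩
    ∣ q + (p - q) ∣       ≤⟨ ℚₚ.∣p+q∣≤∣p∣+∣q∣ q (p - q) ⟩
    ∣ q ∣ + ∣ p - q ∣     ∎

  ∣∣-lip : ∀ p q → ∣ ∣ p ∣ - ∣ q ∣ ∣ ≤ ∣ p - q ∣
  ∣∣-lip p q = ∣p-q∣≤ (∣p∣≤∣q∣+∣p-q∣ p q)
    (subst (λ z → ∣ q ∣ ≤ ∣ p ∣ + z) (∣p-q∣≡∣q-p∣ q p) (∣p∣≤∣q∣+∣p-q∣ q p))

  ∣-∣-lip : ∀ p q → ∣ - p - - q ∣ ≡ ∣ p - q ∣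
  ∣-∣-lip p q = trans (cong ∣_∣ (solve 2 (λ a b → :- a :- :- b := :- (a :- b)) refl p q)) (ℚₚ.∣-p∣≡∣p∣ (p - q))

  ⊔-lip : ∀ c p q → ∣ (c ⊔ p) - (c ⊔ q) ∣ ≤ ∣ p - q ∣
  ⊔-lip c p q = ∣p-q∣≤ (le p q) (subst (λ z → c ⊔ q ≤ (c ⊔ p) + z) (∣p-q∣≡∣q-p∣ q p) (le q p))
    where
    le : ∀ p q → c ⊔ p ≤ (c ⊔ q) + ∣ p - q ∣
    le p q = ℚₚ.⊔-lub
      (begin
        c                     ≤⟨ ℚₚ.p≤p⊔q c q ⟩
        c ⊔ q                 ≡⟨ ℚₚ.+-identityʳ (c ⊔ q) ⟨
        (c ⊔ q) + 0ℚ          ≤⟨ ℚₚ.+-monoʳ-≤ (c ⊔ q) (ℚₚ.0≤∣p∣ (p - q)) ⟩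
        (c ⊔ q) + ∣ p - q ∣   ∎)
      (begin
        p                     ≤⟨ p≤q+∣p-q∣ p q ⟩
        q + ∣ p - q ∣         ≤⟨ ℚₚ.+-monoˡ-≤ ∣ p - q ∣ (ℚₚ.p≤q⊔p c q) ⟩
        (c ⊔ q) + ∣ p - q ∣   ∎)

IsCauchy : (ℕ → ℚ) → Set
IsCauchy s = ∀ {ε} → 0ℚ ℚ.< ε → ∃ λ N → ∀ {m n} → N ℕ.≤ m → N ℕ.≤ n →
  ℚ.∣ s m ℚ.- s n ∣ ℚ.≤ ε

module Cauchy where
  open import Data.Rational.Base hiding (ℚ; 0ℚ; 1ℚ)
  open ℚₚ.≤-Reasoning
  open Rational

  ⊔-≤ˡ : ∀ {m n k} → m ℕ.⊔ n ℕ.≤ k → m ℕ.≤ k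
  ⊔-≤ˡ {m} {n} = ℕ.≤-trans (ℕ.m≤m⊔n m n)

  ⊔-≤ʳ : ∀ {m n k} → m ℕ.⊔ n ℕ.≤ k → n ℕ.≤ k
  ⊔-≤ʳ {m} {n} = ℕ.≤-trans (ℕ.m≤n⊔m m n)

  bounded : ∀ {s} → IsCauchy s → ∃₂ λ B N → 0ℚ < B × (∀ {n} → N ℕ.≤ n → ∣ s n ∣ ≤ B)
  bounded {s} cs = let N , close = cs (ℚₚ.positive⁻¹ 1ℚ) in
    ∣ s N ∣ + 1ℚ , N
    , ℚₚ.+-mono-≤-< (ℚₚ.0≤∣p∣ (s N)) (ℚₚ.positive⁻¹ 1ℚ)
    , λ {n} N≤n → ℚₚ.≤-trans (∣p∣≤∣q∣+∣p-q∣ (s n) (s N))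
                    (ℚₚ.+-monoʳ-≤ ∣ s N ∣ (close N≤n ℕ.≤-refl))

  const : ∀ q → IsCauchy (λ _ → q)
  const q 0<ε = 0 , λ _ _ → ℚₚ.≤-trans (ℚₚ.≤-reflexive (cong ∣_∣ (ℚₚ.+-inverseʳ q))) (ℚₚ.<⇒≤ 0<ε)

  plus : ∀ {s t} → IsCauchy s → IsCauchy t → IsCauchy (λ n → s n + t n)
  plus {s} {t} cs ct {ε} 0<ε =
    let M , closeₛ = cs (half 0<ε)
        N , closeₜ = ct (half 0<ε)
    in M ℕ.⊔ N , λ {m} {n} ≤m ≤n → begin
      ∣ (s m + t m) - (s n + t n) ∣      ≤⟨ ∣+∣-lip (s m) (t m) (s n) (t n) ⟩
      ∣ s m - s n ∣ + ∣ t m - t n ∣      ≤⟨ ℚₚ.+-mono-≤ (closeₛ (⊔-≤ˡ ≤m) (⊔-≤ˡ ≤n)) (closeₜ (⊔-≤ʳ {M} ≤m) (⊔-≤ʳ {M} ≤n)) ⟩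
      ½ * ε + ½ * ε                      ≡⟨ ½+½ ε ⟩
      ε                                  ∎

  negation : ∀ {s} → IsCauchy s → IsCauchy (λ n → - s n)
  negation {s} cs 0<ε = let N , close = cs 0<ε in
    N , λ {m} {n} ≤m ≤n → ℚₚ.≤-trans (ℚₚ.≤-reflexive (∣-∣-lip (s m) (s n))) (close ≤m ≤n)

  abs : ∀ {s} → IsCauchy s → IsCauchy (λ n → ∣ s n ∣)
  abs {s} cs 0<ε = let N , close = cs 0<ε in
    N , λ {m} {n} ≤m ≤n → ℚₚ.≤-trans (∣∣-lip (s m) (s n)) (close ≤m ≤n)

  product : ∀ {s t} → IsCauchy s → IsCauchy t → IsCauchy (λ n → s n * t n)
  product {s} {t} cs ct {ε} 0<ε =
    let A , K , 0<A , ∣s∣≤A = bounded cs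
        B , L , 0<B , ∣t∣≤B = bounded ct
        α , 0<α , Bα≡ = shrink 0<B (half 0<ε)
        β , 0<β , Aβ≡ = shrink 0<A (half 0<ε)
        M , closeₛ = cs 0<α
        N , closeₜ = ct 0<β
    in (K ℕ.⊔ L) ℕ.⊔ (M ℕ.⊔ N) , λ {m} {n} ≤m ≤n → begin
      ∣ s m * t m - s n * t n ∣
        ≤⟨ ∣*∣-lip (s m) (t m) (s n) (t n) ⟩
      ∣ s m ∣ * ∣ t m - t n ∣ + ∣ t n ∣ * ∣ s m - s n ∣
        ≤⟨ ℚₚ.+-mono-≤
             (*-mono (ℚₚ.0≤∣p∣ (s m)) (ℚₚ.<⇒≤ 0<β) (∣s∣≤A (⊔-≤ˡ (⊔-≤ˡ {K ℕ.⊔ L} ≤m)))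
                (closeₜ (⊔-≤ʳ {M} (⊔-≤ʳ {K ℕ.⊔ L} ≤m)) (⊔-≤ʳ {M} (⊔-≤ʳ {K ℕ.⊔ L} ≤n))))
             (*-mono (ℚₚ.0≤∣p∣ (t n)) (ℚₚ.<⇒≤ 0<α) (∣t∣≤B (⊔-≤ʳ {K} (⊔-≤ˡ {K ℕ.⊔ L} ≤n)))
                (closeₛ (⊔-≤ˡ (⊔-≤ʳ {K ℕ.⊔ L} ≤m)) (⊔-≤ˡ (⊔-≤ʳ {K ℕ.⊔ L} ≤n)))) ⟩
      A * β + B * α
        ≡⟨ cong₂ _+_ Aβ≡ Bα≡ ⟩
      ½ * ε + ½ * ε
        ≡⟨ ½+½ ε ⟩
      ε ∎

∑ : ℕ → (ℕ → ℚ) → ℚ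
∑ zero    f = 0ℚ
∑ (suc n) f = ∑ n f ℚ.+ f n

1⊔-pos : ∀ t → ℚ.Positive (1ℚ ℚ.⊔ t)
1⊔-pos t = ℚ.positive (ℚₚ.<-≤-trans (ℚₚ.positive⁻¹ 1ℚ) (ℚₚ.p≤p⊔q 1ℚ t))

-- 1/t for t ≥ 1.
recip : ℚ → ℚ
recip t = ℚ.1/_ (1ℚ ℚ.⊔ t) {{ℚₚ.pos⇒nonZero (1ℚ ℚ.⊔ t) {{1⊔-pos t}}}}

riemann : ℚ → ℕ → ℚ
riemann v n = ∑ n λ i → v ℚ.* recip (1ℚ ℚ.+ ⌜ suc i ⌝ ℚ.* v)

step : ℚ → ℕ → ℚ
step h k = h ℚ.* (+ 1 ℚ./ suc k)

-- The right-endpoint Riemann sum of ∫₁^q dt/t over k + 1 equal subintervals.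
logApprox : ℚ → ℕ → ℚ
logApprox q k = riemann (step (0ℚ ℚ.⊔ (q ℚ.- 1ℚ)) k) (suc k)

module Log where
  open import Data.Rational.Base hiding (ℚ; 0ℚ; 1ℚ)
  open ℚₚ.≤-Reasoning
  open +-*-Solver
  open Rational

  0≤1 : 0ℚ ≤ 1ℚ
  0≤1 = ℚₚ.nonNegative⁻¹ 1ℚ

  recip-inv : ∀ t → recip t * (1ℚ ⊔ t) ≡ 1ℚ
  recip-inv t = ℚₚ.*-inverseˡ (1ℚ ⊔ t) {{ℚₚ.pos⇒nonZero (1ℚ ⊔ t) {{1⊔-pos t}}}}

  0≤recip : ∀ t → 0ℚ ≤ recip t
  0≤recip t = ℚₚ.<⇒≤ (ℚₚ.positive⁻¹ (recip t) {{ℚₚ.1/pos⇒pos (1ℚ ⊔ t) {{1⊔-pos t}}}})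

  recip≤1 : ∀ t → recip t ≤ 1ℚ
  recip≤1 t = begin
    recip t              ≡⟨ ℚₚ.*-identityʳ (recip t) ⟨
    recip t * 1ℚ         ≤⟨ *-monoʳ (0≤recip t) (ℚₚ.p≤p⊔q 1ℚ t) ⟩
    recip t * (1ℚ ⊔ t)   ≡⟨ recip-inv t ⟩
    1ℚ                   ∎

  recip-diff : ∀ t u → recip t - recip u ≡ recip t * recip u * ((1ℚ ⊔ u) - (1ℚ ⊔ t))
  recip-diff t u = begin-equality
    recip t - recip u
      ≡⟨ cong₂ _-_ (ℚₚ.*-identityʳ (recip t)) (ℚₚ.*-identityʳ (recip u)) ⟨
    recip t * 1ℚ - recip u * 1ℚ
      ≡⟨ cong₂ (λ a b → recip t * a - recip u * b) (recip-inv u) (recip-inv t) ⟨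
    recip t * (recip u * (1ℚ ⊔ u)) - recip u * (recip t * (1ℚ ⊔ t))
      ≡⟨ solve 4 (λ a b c d → a :* (b :* c) :- b :* (a :* d) := a :* b :* (c :- d)) refl
           (recip t) (recip u) (1ℚ ⊔ u) (1ℚ ⊔ t) ⟩
    recip t * recip u * ((1ℚ ⊔ u) - (1ℚ ⊔ t)) ∎

  recip-antitone : ∀ {t u} → t ≤ u → recip u ≤ recip t
  recip-antitone {t} {u} t≤u = begin
    recip u                           ≡⟨ ℚₚ.+-identityʳ (recip u) ⟨
    recip u + 0ℚ                      ≤⟨ ℚₚ.+-monoʳ-≤ (recip u) 0≤diff ⟩
    recip u + (recip t - recip u)     ≡⟨ solve 2 (λ a b → a :+ (b :- a) := b) refl (recip u) (recip t) ⟩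
    recip t                           ∎
    where
    0≤diff : 0ℚ ≤ recip t - recip u
    0≤diff = begin
      0ℚ                                          ≤⟨ 0≤p*q (0≤p*q (0≤recip t) (0≤recip u))
                                                       (subst (_≤ (1ℚ ⊔ u) - (1ℚ ⊔ t)) (ℚₚ.+-inverseʳ (1ℚ ⊔ t))
                                                         (ℚₚ.+-monoˡ-≤ (- (1ℚ ⊔ t)) (ℚₚ.⊔-monoʳ-≤ 1ℚ t≤u))) ⟩
      recip t * recip u * ((1ℚ ⊔ u) - (1ℚ ⊔ t))   ≡⟨ recip-diff t u ⟨
      recip t - recip u                           ∎

  recip-lip : ∀ t u → ∣ recip t - recip u ∣ ≤ ∣ t - u ∣
  recip-lip t u = begin
    ∣ recip t - recip u ∣                              ≡⟨ cong ∣_∣ (recip-diff t u) ⟩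
    ∣ recip t * recip u * ((1ℚ ⊔ u) - (1ℚ ⊔ t)) ∣      ≡⟨ ℚₚ.∣p*q∣≡∣p∣*∣q∣ (recip t * recip u) ((1ℚ ⊔ u) - (1ℚ ⊔ t)) ⟩
    ∣ recip t * recip u ∣ * ∣ (1ℚ ⊔ u) - (1ℚ ⊔ t) ∣    ≡⟨ cong (_* ∣ (1ℚ ⊔ u) - (1ℚ ⊔ t) ∣) (ℚₚ.0≤p⇒∣p∣≡p (0≤p*q (0≤recip t) (0≤recip u))) ⟩
    recip t * recip u * ∣ (1ℚ ⊔ u) - (1ℚ ⊔ t) ∣        ≤⟨ *-mono (0≤p*q (0≤recip t) (0≤recip u)) (ℚₚ.0≤∣p∣ (u - t))
                                                            (*-mono (0≤recip t) 0≤1 (recip≤1 t) (recip≤1 u)) (⊔-lip 1ℚ u t) ⟩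
    1ℚ * 1ℚ * ∣ u - t ∣                                ≡⟨ ℚₚ.*-identityˡ ∣ u - t ∣ ⟩
    ∣ u - t ∣                                          ≡⟨ ∣p-q∣≡∣q-p∣ u t ⟩
    ∣ t - u ∣                                          ∎

  ∑-mono : ∀ n {f g} → (∀ i → i ℕ.< n → f i ≤ g i) → ∑ n f ≤ ∑ n g
  ∑-mono zero    f≤g = ℚₚ.≤-refl
  ∑-mono (suc n) f≤g = ℚₚ.+-mono-≤ (∑-mono n (λ i i<n → f≤g i (ℕ.m<n⇒m<1+n i<n))) (f≤g n (ℕ.n<1+n n))

  ∑-cong : ∀ n {f g : ℕ → ℚ} → (∀ i → f i ≡ g i) → ∑ n f ≡ ∑ n g
  ∑-cong zero    f≡g = refl
  ∑-cong (suc n) f≡g = cong₂ _+_ (∑-cong n f≡g) (f≡g n)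

  ∑-const : ∀ n c → ∑ n (λ _ → c) ≡ ⌜ n ⌝ * c
  ∑-const zero    c = sym (ℚₚ.*-zeroˡ c)
  ∑-const (suc n) c = begin-equality
    ∑ n (λ _ → c) + c    ≡⟨ cong (_+ c) (∑-const n c) ⟩
    ⌜ n ⌝ * c + c        ≡⟨ solve 2 (λ a b → a :* b :+ b := (a :+ con 1ℚ) :* b) refl ⌜ n ⌝ c ⟩
    (⌜ n ⌝ + 1ℚ) * c     ≡⟨ cong (_* c) (⌜⌝-suc n) ⟨
    ⌜ suc n ⌝ * c        ∎

  ∑-lip : ∀ n f g → ∣ ∑ n f - ∑ n g ∣ ≤ ∑ n (λ i → ∣ f i - g i ∣)
  ∑-lip zero    f g = ℚₚ.≤-refl
  ∑-lip (suc n) f g = ℚₚ.≤-trans (∣+∣-lip (∑ n f) (f n) (∑ n g) (g n))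
    (ℚₚ.+-monoˡ-≤ ∣ f n - g n ∣ (∑-lip n f g))

  ∑-++ : ∀ m n f → ∑ (n ℕ.+ m) f ≡ ∑ m f + ∑ n (λ j → f (j ℕ.+ m))
  ∑-++ m zero    f = sym (ℚₚ.+-identityʳ (∑ m f))
  ∑-++ m (suc n) f = trans (cong (_+ f (n ℕ.+ m)) (∑-++ m n f)) (ℚₚ.+-assoc (∑ m f) _ _)

  ∑-blocks : ∀ n m f → ∑ (n ℕ.* m) f ≡ ∑ n (λ i → ∑ m (λ j → f (j ℕ.+ i ℕ.* m)))
  ∑-blocks zero    m f = refl
  ∑-blocks (suc n) m f = trans (∑-++ (n ℕ.* m) m f) (cong (_+ ∑ m (λ j → f (j ℕ.+ n ℕ.* m))) (∑-blocks n m f))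

  node : ℚ → ℕ → ℚ
  node v i = 1ℚ + ⌜ i ⌝ * v

  riemannˡ : ℚ → ℕ → ℚ
  riemannˡ v n = ∑ n λ i → v * recip (node v i)

  module _ {v : ℚ} (0≤v : 0ℚ ≤ v) where

    node-mono : ∀ {i j} → i ℕ.≤ j → node v i ≤ node v j
    node-mono i≤j = ℚₚ.+-monoʳ-≤ 1ℚ (*-monoˡ 0≤v (⌜⌝-mono i≤j))

    riemann≤riemannˡ : ∀ n → riemann v n ≤ riemannˡ v n
    riemann≤riemannˡ n = ∑-mono n λ i _ → *-monoʳ 0≤v (recip-antitone (node-mono (ℕ.n≤1+n i)))

    riemannˡ≤riemann : ∀ n → riemannˡ v n ≤ riemann v n + v
    riemannˡ≤riemann n = begin
      riemannˡ v n                              ≡⟨ ℚₚ.+-identityʳ (riemannˡ v n) ⟨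
      riemannˡ v n + 0ℚ                         ≤⟨ ℚₚ.+-monoʳ-≤ (riemannˡ v n) (0≤p*q 0≤v (0≤recip (node v n))) ⟩
      riemannˡ v n + v * recip (node v n)       ≡⟨ telescope n ⟩
      riemann v n + v * recip (node v 0)        ≤⟨ ℚₚ.+-monoʳ-≤ (riemann v n) (*-monoʳ 0≤v (recip≤1 (node v 0))) ⟩
      riemann v n + v * 1ℚ                      ≡⟨ cong (_+_ (riemann v n)) (ℚₚ.*-identityʳ v) ⟩
      riemann v n + v                           ∎
      where
      telescope : ∀ n → riemannˡ v n + v * recip (node v n) ≡ riemann v n + v * recip (node v 0)
      telescope zero    = refl
      telescope (suc n) = begin-equality
        riemannˡ v n + a + b                      ≡⟨ cong (_+ b) (telescope n) ⟩
        riemann v n + c + b                       ≡⟨ solve 3 (λ x y z → x :+ y :+ z := x :+ z :+ y) refl (riemann v n) c b ⟩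
        riemann v n + b + c                       ∎
        where
        a = v * recip (node v n)
        b = v * recip (node v (suc n))
        c = v * recip (node v 0)

    coarse-node : ∀ m i → node (⌜ m ⌝ * v) i ≡ node v (i ℕ.* m)
    coarse-node m i = cong (_+_ 1ℚ) (trans (sym (ℚₚ.*-assoc ⌜ i ⌝ ⌜ m ⌝ v)) (cong (_* v) (sym (⌜⌝-* i m))))

    block : ∀ m i → ⌜ m ⌝ * v * recip (node (⌜ m ⌝ * v) i) ≡ ∑ m (λ _ → v * recip (node v (i ℕ.* m)))
    block m i = begin-equality
      ⌜ m ⌝ * v * recip (node (⌜ m ⌝ * v) i)      ≡⟨ cong (λ z → ⌜ m ⌝ * v * recip z) (coarse-node m i) ⟩
      ⌜ m ⌝ * v * recip (node v (i ℕ.* m))        ≡⟨ ℚₚ.*-assoc ⌜ m ⌝ v _ ⟩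
      ⌜ m ⌝ * (v * recip (node v (i ℕ.* m)))      ≡⟨ ∑-const m _ ⟨
      ∑ m (λ _ → v * recip (node v (i ℕ.* m)))    ∎

    refine : ∀ n m → riemann (⌜ m ⌝ * v) n ≤ riemann v (n ℕ.* m)
    refine n m = begin
      ∑ n (λ i → ⌜ m ⌝ * v * recip (node (⌜ m ⌝ * v) (suc i)))              ≡⟨ ∑-cong n (λ i → block m (suc i)) ⟩
      ∑ n (λ i → ∑ m (λ _ → v * recip (node v (suc i ℕ.* m))))              ≤⟨ ∑-mono n (λ i _ → ∑-mono m (λ j j<m →
                                                                                 *-monoʳ 0≤v (recip-antitone (node-mono (ℕ.+-monoˡ-≤ (i ℕ.* m) j<m))))) ⟩
      ∑ n (λ i → ∑ m (λ j → v * recip (node v (suc (j ℕ.+ i ℕ.* m)))))      ≡⟨ ∑-blocks n m (λ k → v * recip (node v (suc k))) ⟨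
      riemann v (n ℕ.* m)                                                   ∎

    refineˡ : ∀ n m → riemannˡ v (n ℕ.* m) ≤ riemannˡ (⌜ m ⌝ * v) n
    refineˡ n m = begin
      riemannˡ v (n ℕ.* m)                                                  ≡⟨ ∑-blocks n m (λ k → v * recip (node v k)) ⟩
      ∑ n (λ i → ∑ m (λ j → v * recip (node v (j ℕ.+ i ℕ.* m))))            ≤⟨ ∑-mono n (λ i _ → ∑-mono m (λ j _ →
                                                                                 *-monoʳ 0≤v (recip-antitone (node-mono (ℕ.m≤n+m (i ℕ.* m) j))))) ⟩
      ∑ n (λ i → ∑ m (λ _ → v * recip (node v (i ℕ.* m))))                  ≡⟨ ∑-cong n (λ i → block m i) ⟨
      riemannˡ (⌜ m ⌝ * v) n                                                ∎

  unit : ℕ → ℚ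
  unit k = + 1 / suc k

  0≤unit : ∀ k → 0ℚ ≤ unit k
  0≤unit k = ℚₚ.nonNegative⁻¹ (unit k) {{ℚₚ.normalize-nonNeg 1 (suc k)}}

  ⌜⌝*unit : ∀ k → ⌜ suc k ⌝ * unit k ≡ 1ℚ
  ⌜⌝*unit k = ℚₚ.toℚᵘ-injective (≃-trans (ℚₚ.toℚᵘ-homo-* ⌜ suc k ⌝ (unit k))
    (≃-trans (*-cong (ℚₚ.toℚᵘ-fromℚᵘ (ℚᵘ.mkℚᵘ (+ suc k) 0)) (ℚₚ.toℚᵘ-fromℚᵘ (ℚᵘ.mkℚᵘ (+ 1) k)))
      (ℚᵘ.*≡* (cong (λ z → + suc z) (eq k)))))
    where
    open import Data.Rational.Unnormalised.Properties using (≃-trans; *-cong)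
    eq : ∀ k → k ℕ.* 1 ℕ.* 1 ≡ k ℕ.+ 0 ℕ.+ 0
    eq k = trans (trans (cong (ℕ._* 1) (ℕ.*-identityʳ k)) (ℕ.*-identityʳ k))
                 (sym (trans (ℕ.+-identityʳ (k ℕ.+ 0)) (ℕ.+-identityʳ k)))

  common : ℕ → ℕ → ℕ
  common n m = m ℕ.+ n ℕ.* suc m

  unit-common : ∀ n m → ⌜ suc n ⌝ * ⌜ suc m ⌝ * unit (common n m) ≡ 1ℚ
  unit-common n m = trans (cong (_* unit (common n m)) (sym (⌜⌝-* (suc n) (suc m)))) (⌜⌝*unit (common n m))

  step-coarseˡ : ∀ h n m → ⌜ suc m ⌝ * step h (common n m) ≡ step h n
  step-coarseˡ h n m = begin-equality
    b * (h * w)              ≡⟨ ℚₚ.*-identityˡ _ ⟨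
    1ℚ * (b * (h * w))       ≡⟨ cong (_* (b * (h * w))) (⌜⌝*unit n) ⟨
    a * u * (b * (h * w))    ≡⟨ solve 5 (λ a b u h w → a :* u :* (b :* (h :* w)) := a :* b :* w :* (h :* u)) refl a b u h w ⟩
    a * b * w * (h * u)      ≡⟨ cong (_* (h * u)) (unit-common n m) ⟩
    1ℚ * (h * u)             ≡⟨ ℚₚ.*-identityˡ (h * u) ⟩
    h * u                    ∎
    where
    a = ⌜ suc n ⌝
    b = ⌜ suc m ⌝
    u = unit n
    w = unit (common n m)

  step-coarseʳ : ∀ h n m → ⌜ suc n ⌝ * step h (common n m) ≡ step h m
  step-coarseʳ h n m = begin-equality
    a * (h * w)              ≡⟨ ℚₚ.*-identityˡ _ ⟨
    1ℚ * (a * (h * w))       ≡⟨ cong (_* (a * (h * w))) (⌜⌝*unit m) ⟨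
    b * u * (a * (h * w))    ≡⟨ solve 5 (λ a b u h w → b :* u :* (a :* (h :* w)) := a :* b :* w :* (h :* u)) refl a b u h w ⟩
    a * b * w * (h * u)      ≡⟨ cong (_* (h * u)) (unit-common n m) ⟩
    1ℚ * (h * u)             ≡⟨ ℚₚ.*-identityˡ (h * u) ⟩
    h * u                    ∎
    where
    a = ⌜ suc n ⌝
    b = ⌜ suc m ⌝
    u = unit m
    w = unit (common n m)

  equiRiemann : ℚ → ℕ → ℚ
  equiRiemann h k = riemann (step h k) (suc k)

  0≤step : ∀ {h} → 0ℚ ≤ h → ∀ k → 0ℚ ≤ step h k
  0≤step 0≤h k = 0≤p*q 0≤h (0≤unit k)

  equiRiemann-close : ∀ {h} → 0ℚ ≤ h → ∀ n m → equiRiemann h n ≤ equiRiemann h m + step h m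
  equiRiemann-close {h} 0≤h n m = begin
    riemann (step h n) (suc n)             ≡⟨ cong (λ z → riemann z (suc n)) (step-coarseˡ h n m) ⟨
    riemann (⌜ suc m ⌝ * v) (suc n)        ≤⟨ refine 0≤v (suc n) (suc m) ⟩
    riemann v (suc n ℕ.* suc m)            ≤⟨ riemann≤riemannˡ 0≤v (suc n ℕ.* suc m) ⟩
    riemannˡ v (suc n ℕ.* suc m)           ≡⟨ cong (riemannˡ v) (ℕ.*-comm (suc n) (suc m)) ⟩
    riemannˡ v (suc m ℕ.* suc n)           ≤⟨ refineˡ 0≤v (suc m) (suc n) ⟩
    riemannˡ (⌜ suc n ⌝ * v) (suc m)       ≡⟨ cong (λ z → riemannˡ z (suc m)) (step-coarseʳ h n m) ⟩
    riemannˡ (step h m) (suc m)            ≤⟨ riemannˡ≤riemann (0≤step 0≤h m) (suc m) ⟩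
    riemann (step h m) (suc m) + step h m  ∎
    where
    v = step h (common n m)
    0≤v = 0≤step 0≤h (common n m)

  equiRiemann-lip : ∀ {h} → 0ℚ ≤ h → ∀ h′ k →
    ∣ equiRiemann h k - equiRiemann h′ k ∣ ≤ (1ℚ + h) * ∣ h - h′ ∣
  equiRiemann-lip {h} 0≤h h′ k = begin
    ∣ equiRiemann h k - equiRiemann h′ k ∣              ≤⟨ ∑-lip (suc k) _ _ ⟩
    ∑ (suc k) (λ i → ∣ v * r i - v′ * r′ i ∣)           ≤⟨ ∑-mono (suc k) term ⟩
    ∑ (suc k) (λ _ → (1ℚ + h) * (unit k * ∣ h - h′ ∣))  ≡⟨ ∑-const (suc k) _ ⟩
    ⌜ suc k ⌝ * ((1ℚ + h) * (unit k * ∣ h - h′ ∣))      ≡⟨ solve 4 (λ a b c d → a :* (b :* (c :* d)) := a :* c :* (b :* d)) refl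
                                                             ⌜ suc k ⌝ (1ℚ + h) (unit k) ∣ h - h′ ∣ ⟩
    ⌜ suc k ⌝ * unit k * ((1ℚ + h) * ∣ h - h′ ∣)        ≡⟨ cong (_* ((1ℚ + h) * ∣ h - h′ ∣)) (⌜⌝*unit k) ⟩
    1ℚ * ((1ℚ + h) * ∣ h - h′ ∣)                        ≡⟨ ℚₚ.*-identityˡ _ ⟩
    (1ℚ + h) * ∣ h - h′ ∣                               ∎
    where
    v = step h k
    v′ = step h′ k
    r r′ : ℕ → ℚ
    r i = recip (node v (suc i))
    r′ i = recip (node v′ (suc i))

    ∣v-v′∣ : ∣ v - v′ ∣ ≡ unit k * ∣ h - h′ ∣
    ∣v-v′∣ = begin-equality
      ∣ h * unit k - h′ * unit k ∣   ≡⟨ cong ∣_∣ (solve 3 (λ a b c → a :* c :- b :* c := c :* (a :- b)) refl h h′ (unit k)) ⟩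
      ∣ unit k * (h - h′) ∣          ≡⟨ ℚₚ.∣p*q∣≡∣p∣*∣q∣ (unit k) (h - h′) ⟩
      ∣ unit k ∣ * ∣ h - h′ ∣        ≡⟨ cong (_* ∣ h - h′ ∣) (ℚₚ.0≤p⇒∣p∣≡p (0≤unit k)) ⟩
      unit k * ∣ h - h′ ∣            ∎

    ∣node∣ : ∀ i → ∣ node v (suc i) - node v′ (suc i) ∣ ≡ ⌜ suc i ⌝ * ∣ v - v′ ∣
    ∣node∣ i = begin-equality
      ∣ node v (suc i) - node v′ (suc i) ∣   ≡⟨ cong ∣_∣ (solve 3 (λ a b c → (con 1ℚ :+ a :* b) :- (con 1ℚ :+ a :* c) := a :* (b :- c)) refl ⌜ suc i ⌝ v v′) ⟩
      ∣ ⌜ suc i ⌝ * (v - v′) ∣               ≡⟨ ℚₚ.∣p*q∣≡∣p∣*∣q∣ ⌜ suc i ⌝ (v - v′) ⟩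
      ∣ ⌜ suc i ⌝ ∣ * ∣ v - v′ ∣             ≡⟨ cong (_* ∣ v - v′ ∣) (ℚₚ.0≤p⇒∣p∣≡p 0≤⌜ suc i ⌝) ⟩
      ⌜ suc i ⌝ * ∣ v - v′ ∣                 ∎

    width : ∀ i → i ℕ.< suc k → v * ⌜ suc i ⌝ ≤ h
    width i i≤k = begin
      h * unit k * ⌜ suc i ⌝      ≤⟨ *-monoʳ (0≤step 0≤h k) (⌜⌝-mono i≤k) ⟩
      h * unit k * ⌜ suc k ⌝      ≡⟨ solve 3 (λ a b c → a :* b :* c := a :* (c :* b)) refl h (unit k) ⌜ suc k ⌝ ⟩
      h * (⌜ suc k ⌝ * unit k)    ≡⟨ cong (_*_ h) (⌜⌝*unit k) ⟩
      h * 1ℚ                      ≡⟨ ℚₚ.*-identityʳ h ⟩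
      h                           ∎

    term : ∀ i → i ℕ.< suc k → ∣ v * r i - v′ * r′ i ∣ ≤ (1ℚ + h) * (unit k * ∣ h - h′ ∣)
    term i i≤k = begin
      ∣ v * r i - v′ * r′ i ∣
        ≤⟨ ∣*∣-lip v (r i) v′ (r′ i) ⟩
      ∣ v ∣ * ∣ r i - r′ i ∣ + ∣ r′ i ∣ * ∣ v - v′ ∣
        ≡⟨ cong₂ (λ a b → a * ∣ r i - r′ i ∣ + b * ∣ v - v′ ∣)
             (ℚₚ.0≤p⇒∣p∣≡p (0≤step 0≤h k)) (ℚₚ.0≤p⇒∣p∣≡p (0≤recip (node v′ (suc i)))) ⟩
      v * ∣ r i - r′ i ∣ + r′ i * ∣ v - v′ ∣
        ≤⟨ ℚₚ.+-mono-≤ (*-monoʳ (0≤step 0≤h k) (recip-lip (node v (suc i)) (node v′ (suc i))))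
             (*-monoˡ (ℚₚ.0≤∣p∣ (v - v′)) (recip≤1 (node v′ (suc i)))) ⟩
      v * ∣ node v (suc i) - node v′ (suc i) ∣ + 1ℚ * ∣ v - v′ ∣
        ≡⟨ cong (λ z → v * z + 1ℚ * ∣ v - v′ ∣) (∣node∣ i) ⟩
      v * (⌜ suc i ⌝ * ∣ v - v′ ∣) + 1ℚ * ∣ v - v′ ∣
        ≡⟨ cong (_+ 1ℚ * ∣ v - v′ ∣) (ℚₚ.*-assoc v ⌜ suc i ⌝ ∣ v - v′ ∣) ⟨
      v * ⌜ suc i ⌝ * ∣ v - v′ ∣ + 1ℚ * ∣ v - v′ ∣
        ≤⟨ ℚₚ.+-monoˡ-≤ (1ℚ * ∣ v - v′ ∣) (*-monoˡ (ℚₚ.0≤∣p∣ (v - v′)) (width i i≤k)) ⟩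
      h * ∣ v - v′ ∣ + 1ℚ * ∣ v - v′ ∣
        ≡⟨ solve 2 (λ a b → a :* b :+ con 1ℚ :* b := (con 1ℚ :+ a) :* b) refl h ∣ v - v′ ∣ ⟩
      (1ℚ + h) * ∣ v - v′ ∣
        ≡⟨ cong (_*_ (1ℚ + h)) ∣v-v′∣ ⟩
      (1ℚ + h) * (unit k * ∣ h - h′ ∣) ∎

  step-vanishes : ∀ {B η} → 0ℚ < B → 0ℚ < η → ∃ λ N → ∀ {h m} → h ≤ B → N ℕ.≤ m → step h m ≤ η
  step-vanishes {B} {η} 0<B 0<η =
    let d , _ , ηd≡B = shrink 0<η 0<B
        N , d≤N = archimedean d
    in N , λ {h} {m} h≤B N≤m → begin
      h * unit m              ≤⟨ *-monoˡ (0≤unit m) h≤B ⟩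
      B * unit m              ≡⟨ cong (_* unit m) ηd≡B ⟨
      η * d * unit m          ≤⟨ *-monoˡ (0≤unit m) (*-monoʳ (ℚₚ.<⇒≤ 0<η)
                                   (ℚₚ.≤-trans d≤N (⌜⌝-mono (ℕ.m≤n⇒m≤1+n N≤m)))) ⟩
      η * ⌜ suc m ⌝ * unit m  ≡⟨ ℚₚ.*-assoc η ⌜ suc m ⌝ (unit m) ⟩
      η * (⌜ suc m ⌝ * unit m) ≡⟨ cong (_*_ η) (⌜⌝*unit m) ⟩
      η * 1ℚ                  ≡⟨ ℚₚ.*-identityʳ η ⟩
      η                       ∎

  isCauchy : ∀ {s} → IsCauchy s → IsCauchy (λ k → logApprox (s k) k)
  isCauchy {s} cs {ε} 0<ε =
    let B , K , 0<B , ∣h∣≤B = Cauchy.bounded h-cauchy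
        δ , 0<δ , [1+B]δ≡ = shrink (ℚₚ.+-mono-<-≤ (ℚₚ.positive⁻¹ 1ℚ) (ℚₚ.<⇒≤ 0<B)) (half 0<ε)
        M , close = h-cauchy 0<δ
        N , small = step-vanishes 0<B (half 0<ε)
        h≤B = λ {n} (K≤n : K ℕ.≤ n) → ℚₚ.≤-trans (p≤∣p∣ (h n)) (∣h∣≤B K≤n)
    in K ℕ.⊔ (M ℕ.⊔ N) , λ {m} {n} ≤m ≤n →
      let K≤m = ⊔-≤ˡ ≤m
          K≤n = ⊔-≤ˡ ≤n
          M≤m = ⊔-≤ˡ (⊔-≤ʳ {K} ≤m)
          M≤n = ⊔-≤ˡ (⊔-≤ʳ {K} ≤n)
          N≤m = ⊔-≤ʳ {M} (⊔-≤ʳ {K} ≤m)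
          N≤n = ⊔-≤ʳ {M} (⊔-≤ʳ {K} ≤n)
          R = equiRiemann
      in begin
        ∣ R (h m) m - R (h n) n ∣
          ≡⟨ cong ∣_∣ (solve 3 (λ a b c → a :- c := (a :- b) :+ (b :- c)) refl (R (h m) m) (R (h n) m) (R (h n) n)) ⟩
        ∣ (R (h m) m - R (h n) m) + (R (h n) m - R (h n) n) ∣
          ≤⟨ ℚₚ.∣p+q∣≤∣p∣+∣q∣ (R (h m) m - R (h n) m) (R (h n) m - R (h n) n) ⟩
        ∣ R (h m) m - R (h n) m ∣ + ∣ R (h n) m - R (h n) n ∣
          ≤⟨ ℚₚ.+-mono-≤
               (ℚₚ.≤-trans (equiRiemann-lip (0≤h m) (h n) m)
                 (*-mono (ℚₚ.+-mono-≤ 0≤1 (0≤h m)) (ℚₚ.<⇒≤ 0<δ) (ℚₚ.+-monoʳ-≤ 1ℚ (h≤B K≤m)) (close M≤m M≤n)))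
               (∣p-q∣≤
                 (ℚₚ.≤-trans (equiRiemann-close (0≤h n) m n) (ℚₚ.+-monoʳ-≤ (R (h n) n) (small (h≤B K≤n) N≤n)))
                 (ℚₚ.≤-trans (equiRiemann-close (0≤h n) n m) (ℚₚ.+-monoʳ-≤ (R (h n) m) (small (h≤B K≤n) N≤m)))) ⟩
        (1ℚ + B) * δ + ½ * ε
          ≡⟨ cong (_+ ½ * ε) [1+B]δ≡ ⟩
        ½ * ε + ½ * ε
          ≡⟨ ½+½ ε ⟩
        ε ∎
    where
    open Cauchy using (⊔-≤ˡ; ⊔-≤ʳ)
    h : ℕ → ℚ
    h k = 0ℚ ⊔ (s k - 1ℚ)

    0≤h : ∀ k → 0ℚ ≤ h k
    0≤h k = ℚₚ.p≤p⊔q 0ℚ (s k - 1ℚ)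

    h-cauchy : IsCauchy h
    h-cauchy 0<η = let N , close = cs 0<η in N , λ {m} {n} ≤m ≤n → begin
      ∣ h m - h n ∣                    ≤⟨ ⊔-lip 0ℚ (s m - 1ℚ) (s n - 1ℚ) ⟩
      ∣ (s m - 1ℚ) - (s n - 1ℚ) ∣      ≡⟨ cong ∣_∣ (solve 2 (λ a b → (a :- con 1ℚ) :- (b :- con 1ℚ) := a :- b) refl (s m) (s n)) ⟩
      ∣ s m - s n ∣                    ≤⟨ close ≤m ≤n ⟩
      _                                ∎

record ℝ : Set where
  constructor mkℝ
  field
    seq      : ℕ → ℚ
    isCauchy : IsCauchy seq

open ℝ public

infix  4 _≤_ _<_
infixl 6 _+_ _-_
infixl 7 _*_
infix  8 -_

_≤_ : ℝ → ℝ → Set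
x ≤ y = ∀ ε → 0ℚ ℚ.< ε → ∃ λ N → ∀ n → N ℕ.≤ n → seq x n ℚ.≤ seq y n ℚ.+ ε

_<_ : ℝ → ℝ → Set
x < y = ∃₂ λ ε N → 0ℚ ℚ.< ε × (∀ n → N ℕ.≤ n → seq x n ℚ.+ ε ℚ.≤ seq y n)

fromℚ : ℚ → ℝ
fromℚ q = mkℝ (λ _ → q) (Cauchy.const q)

fromℕ : ℕ → ℝ
fromℕ n = fromℚ ⌜ n ⌝

_+_ : ℝ → ℝ → ℝ
x + y = mkℝ (λ n → seq x n ℚ.+ seq y n) (Cauchy.plus {seq x} {seq y} (isCauchy x) (isCauchy y))

-_ : ℝ → ℝ
- x = mkℝ (λ n → ℚ.- seq x n) (Cauchy.negation {seq x} (isCauchy x))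

_-_ : ℝ → ℝ → ℝ
x - y = x + - y

_*_ : ℝ → ℝ → ℝ
x * y = mkℝ (λ n → seq x n ℚ.* seq y n) (Cauchy.product {seq x} {seq y} (isCauchy x) (isCauchy y))

∣_∣ : ℝ → ℝ
∣ x ∣ = mkℝ (λ n → ℚ.∣ seq x n ∣) (Cauchy.abs {seq x} (isCauchy x))

-- The argument 1 ≤ x keeps log to its domain; the clamp in logApprox only
-- affects rational approximations below 1.
log : (x : ℝ) → fromℕ 1 ≤ x → ℝ
log x _ = mkℝ (λ k → logApprox (seq x k) k) (Log.isCauchy {seq x} (isCauchy x))

-- Every group of order n is isomorphic to one with underlying set Fin n.
record FinGroup (n : ℕ) : Set where
  field
    _∙_     : Op₂ (Fin n)
    ε       : Fin n
    _⁻¹     : Op₁ (Fin n)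
    isGroup : IsGroup _≡_ _∙_ ε _⁻¹

  group : Group 0ℓ 0ℓ
  group = record { isGroup = isGroup }

  rawGroup : RawGroup 0ℓ 0ℓ
  rawGroup = Group.rawGroup group

open FinGroup using (group; rawGroup)

module _ {n : ℕ} (G : FinGroup n) where
  open FinGroup G

  IsAbelian : Set
  IsAbelian = Definitions.Commutative _≡_ _∙_

  record IsSubgroup (S : Subset n) : Set where
    field
      ∙-closed  : ∀ {x y} → x ∈ S → y ∈ S → (x ∙ y) ∈ S
      ε-closed  : ε ∈ S
      ⁻¹-closed : ∀ {x} → x ∈ S → (x ⁻¹) ∈ S

  subgroup : ∀ {S} → IsSubgroup S → RawGroup 0ℓ 0ℓ
  subgroup {S} isSubgroup = record
    { Carrier = ∃ (_∈ S)
    ; _≈_     = λ x y → proj₁ x ≡ proj₁ y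
    ; _∙_     = λ (x , x∈S) (y , y∈S) → x ∙ y , ∙-closed x∈S y∈S
    ; ε       = ε , ε-closed
    ; _⁻¹     = λ (x , x∈S) → x ⁻¹ , ⁻¹-closed x∈S
    }
    where open IsSubgroup isSubgroup

  Generates : Subset n → Set
  Generates T = ∀ S → IsSubgroup S → T ⊆ S → ∀ x → x ∈ S

  -- The least size of a generating set is at most r.
  RankAtMost : ℕ → Set
  RankAtMost r = ∃ λ T → Generates T × card T ℕ.≤ r

  isAbelian? : Dec IsAbelian
  isAbelian? = Fin.all? λ x → Fin.all? λ y → (x ∙ y) Fin.≟ (y ∙ x)

  isSubgroup? : U.Decidable IsSubgroup
  isSubgroup? S = map′
    (λ (p , q , r) → record { ∙-closed = λ {x} {y} → p x y ; ε-closed = q ; ⁻¹-closed = λ {x} → r x })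
    (λ s → let open IsSubgroup s in (λ _ _ → ∙-closed) , ε-closed , λ _ → ⁻¹-closed)
    (Fin.all? (λ x → Fin.all? λ y → (x Subset.∈? S) →-dec ((y Subset.∈? S) →-dec ((x ∙ y) Subset.∈? S)))
     ×-dec (ε Subset.∈? S)
     ×-dec Fin.all? (λ x → (x Subset.∈? S) →-dec ((x ⁻¹) Subset.∈? S)))

  generates? : U.Decidable Generates
  generates? T = map′
    (λ ¬bad S s T⊆S x → decidable-stable (x Subset.∈? S) λ x∉S → ¬bad (S , s , (λ {x} → T⊆S {x}) , λ all → x∉S (all x)))
    (λ gen (S , s , T⊆S , ¬all) → ¬all (gen S s (λ {x} → T⊆S {x})))
    (¬? (Subset.anySubset? λ S → isSubgroup? S ×-dec (T Subset.⊆? S) ×-dec ¬? (Fin.all? (Subset._∈? S))))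

  rankAtMost? : U.Decidable RankAtMost
  rankAtMost? r = Subset.anySubset? λ T → generates? T ×-dec (card T ℕ.≤? r)

infix 4 _≅_

_≅_ : Rel (RawGroup 0ℓ 0ℓ) _
G ≅ H = ∃ λ f → GroupMorphisms.IsGroupIsomorphism G H f

-- H is isomorphic to a subgroup of G.
_≲_ : ∀ {m n} → FinGroup m → FinGroup n → Set
H ≲ G = ∃₂ λ S (isSubgroup : IsSubgroup G S) → rawGroup H ≅ subgroup G isSubgroup

any-function? : ∀ {m n} {P : U.Pred (Fin m → Fin n) 0ℓ} → P Respects _≗_ → U.Decidable P → Dec (∃ P)
any-function? {P = P} resp P? = map′
  (λ (i , p) → finToFun i , p)
  (λ (f , p) → funToFin f , resp (λ x → sym (Fin.finToFun-funToFin f x)) p)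
  (Fin.any? λ i → P? (finToFun i))

module _ {m n : ℕ} (H : FinGroup m) (G : FinGroup n) where
  private
    module H = FinGroup H
    module G = FinGroup G
  open GroupMorphisms (rawGroup H) (rawGroup G)

  mkMono : ∀ {f} → (∀ x y → f (x H.∙ y) ≡ f x G.∙ f y) → (∀ x y → f x ≡ f y → x ≡ y) →
           f H.ε ≡ G.ε → (∀ x → f (x H.⁻¹) ≡ f x G.⁻¹) → IsGroupMonomorphism f
  mkMono {f} ∙-homo inj ε-homo ⁻¹-homo = record
    { isGroupHomomorphism = record
      { isMonoidHomomorphism = record
        { isMagmaHomomorphism = record
          { isRelHomomorphism = record { cong = cong f }
          ; homo = ∙-homo }
        ; ε-homo = ε-homo }
      ; ⁻¹-homo = ⁻¹-homo }
    ; injective = λ {x} {y} → inj x y }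

  isMono? : U.Decidable IsGroupMonomorphism
  isMono? f = map′
    (λ (p , q , r , s) → mkMono p q r s)
    (λ mono → let open IsGroupMonomorphism mono in ∙-homo , (λ _ _ → injective) , ε-homo , ⁻¹-homo)
    (Fin.all? (λ x → Fin.all? λ y → f (x H.∙ y) Fin.≟ (f x G.∙ f y))
     ×-dec Fin.all? (λ x → Fin.all? λ y → (f x Fin.≟ f y) →-dec (x Fin.≟ y))
     ×-dec (f H.ε Fin.≟ G.ε)
     ×-dec Fin.all? (λ x → f (x H.⁻¹) Fin.≟ (f x G.⁻¹)))

  isIso? : U.Decidable IsGroupIsomorphism
  isIso? f = map′
    (λ (mono , surj) → record
      { isGroupMonomorphism = mono
      ; surjective = λ y → proj₁ (surj y) , λ z≡x → trans (cong f z≡x) (proj₂ (surj y)) })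
    (λ iso → let open IsGroupIsomorphism iso in
      isGroupMonomorphism , λ y → proj₁ (surjective y) , proj₂ (surjective y) refl)
    (isMono? f ×-dec Fin.all? (λ y → Fin.any? λ x → f x Fin.≟ y))

  mono-resp : IsGroupMonomorphism Respects _≗_
  mono-resp {f} {g} f≗g mono = mkMono
    (λ x y → trans (sym (f≗g _)) (trans (∙-homo x y) (cong₂ G._∙_ (f≗g x) (f≗g y))))
    (λ x y gx≡gy → injective (trans (f≗g x) (trans gx≡gy (sym (f≗g y)))))
    (trans (sym (f≗g _)) ε-homo)
    (λ x → trans (sym (f≗g _)) (trans (⁻¹-homo x) (cong G._⁻¹ (f≗g x))))
    where open IsGroupMonomorphism mono

  iso-resp : IsGroupIsomorphism Respects _≗_
  iso-resp {f} {g} f≗g iso = record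
    { isGroupMonomorphism = mono-resp f≗g isGroupMonomorphism
    ; surjective = λ y → let x , fx≡y = surjective y in
        x , λ z≡x → trans (sym (f≗g _)) (fx≡y z≡x) }
    where open IsGroupIsomorphism iso

  iso? : Dec (rawGroup H ≅ rawGroup G)
  iso? = any-function? iso-resp isIso?

  image : (Fin m → Fin n) → Subset n
  image f = tabulate λ y → does (Fin.any? λ x → f x Fin.≟ y)

  f∈image : ∀ f x → f x ∈ image f
  f∈image f x = lookup⇒[]= (f x) (image f)
    (trans (lookup∘tabulate _ (f x)) (dec-true (Fin.any? λ z → f z Fin.≟ f x) (x , refl)))

  ∈image⇒ : ∀ f {y} → y ∈ image f → ∃ λ x → f x ≡ y
  ∈image⇒ f {y} y∈ with Fin.any? (λ x → f x Fin.≟ y) | trans (sym (lookup∘tabulate (λ y → does (Fin.any? λ x → f x Fin.≟ y)) y)) ([]=⇒lookup y∈)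
  ... | yes p | _ = p

  mono⇒≲ : ∃ IsGroupMonomorphism → H ≲ G
  mono⇒≲ (f , mono) = image f , isSubgroup , (λ x → f x , f∈image f x) , record
    { isGroupMonomorphism = record
      { isGroupHomomorphism = record
        { isMonoidHomomorphism = record
          { isMagmaHomomorphism = record
            { isRelHomomorphism = record { cong = cong f }
            ; homo = ∙-homo }
          ; ε-homo = ε-homo }
        ; ⁻¹-homo = ⁻¹-homo }
      ; injective = injective }
    ; surjective = λ (y , y∈) → let x , fx≡y = ∈image⇒ f y∈ in x , λ z≡x → trans (cong f z≡x) fx≡y }
    where
    open IsGroupMonomorphism mono
    isSubgroup : IsSubgroup G (image f)
    isSubgroup = record
      { ∙-closed = λ x∈ y∈ → let a , fa≡x = ∈image⇒ f x∈
                                 b , fb≡y = ∈image⇒ f y∈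
          in subst (_∈ image f) (trans (∙-homo a b) (cong₂ G._∙_ fa≡x fb≡y)) (f∈image f (a H.∙ b))
      ; ε-closed = subst (_∈ image f) ε-homo (f∈image f H.ε)
      ; ⁻¹-closed = λ x∈ → let a , fa≡x = ∈image⇒ f x∈
          in subst (_∈ image f) (trans (⁻¹-homo a) (cong G._⁻¹ fa≡x)) (f∈image f (a H.⁻¹))
      }

  ≲⇒mono : H ≲ G → ∃ IsGroupMonomorphism
  ≲⇒mono (S , isSubgroup , f , iso) = proj₁ ∘ f , mkMono ∙-homo (λ _ _ → injective) ε-homo ⁻¹-homo
    where open GroupMorphisms.IsGroupIsomorphism iso

  _≲?_ : Dec (H ≲ G)
  _≲?_ = map′ mono⇒≲ ≲⇒mono (any-function? mono-resp isMono?)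

_≅?_ : ∀ {n} → Decidable (λ (G H : FinGroup n) → rawGroup G ≅ rawGroup H)
G ≅? H = iso? G H

isGroup? : ∀ {n} (_∙_ : Op₂ (Fin n)) ε _⁻¹ → Dec (IsGroup _≡_ _∙_ ε _⁻¹)
isGroup? _∙_ ε _⁻¹ = map′
  (λ (assoc , idˡ , idʳ , invˡ , invʳ) → record
    { isMonoid = record
      { isSemigroup = record
        { isMagma = record { isEquivalence = isEquivalence ; ∙-cong = cong₂ _∙_ }
        ; assoc = assoc }
      ; identity = idˡ , idʳ }
    ; inverse = invˡ , invʳ
    ; ⁻¹-cong = cong _⁻¹ })
  (λ g → let open IsGroup g in assoc , identityˡ , identityʳ , inverseˡ , inverseʳ)
  (Fin.all? (λ x → Fin.all? λ y → Fin.all? λ z → ((x ∙ y) ∙ z) Fin.≟ (x ∙ (y ∙ z)))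
   ×-dec Fin.all? (λ x → (ε ∙ x) Fin.≟ x)
   ×-dec Fin.all? (λ x → (x ∙ ε) Fin.≟ x)
   ×-dec Fin.all? (λ x → ((x ⁻¹) ∙ x) Fin.≟ ε)
   ×-dec Fin.all? (λ x → (x ∙ (x ⁻¹)) Fin.≟ ε))

module _ {n : ℕ} where
  private
    op : Fin ((n ℕ.^ n) ℕ.^ n) → Op₂ (Fin n)
    op i x = finToFun (finToFun i x)

    code : Op₂ (Fin n) → Fin ((n ℕ.^ n) ℕ.^ n)
    code _∙_ = funToFin λ x → funToFin (x ∙_)

    op-code : ∀ _∙_ x y → op (code _∙_) x y ≡ x ∙ y
    op-code _∙_ x y = trans (cong (λ j → finToFun j y) (Fin.finToFun-funToFin (λ x → funToFin (x ∙_)) x))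
      (Fin.finToFun-funToFin (x ∙_) y)

    candidate : Fin ((n ℕ.^ n) ℕ.^ n) → Fin n → Fin (n ℕ.^ n) → Maybe (FinGroup n)
    candidate i e j = Maybe.map (λ isGroup → record { isGroup = isGroup })
      (dec⇒maybe (isGroup? (op i) e (finToFun j)))

  groups : List (FinGroup n)
  groups =
    List.concatMap (λ i →
      List.concatMap (λ e →
        List.concatMap (λ j → List.fromMaybe (candidate i e j)) (List.allFin (n ℕ.^ n)))
      (List.allFin n))
    (List.allFin ((n ℕ.^ n) ℕ.^ n))

  groups-complete : (G : FinGroup n) → Any (λ G′ → rawGroup G ≅ rawGroup G′) groups
  groups-complete G =
    Any.concatMap⁺ _ (lose (∈-allFin (code _∙_))
      (Any.concatMap⁺ _ (lose (∈-allFin ε)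
        (Any.concatMap⁺ _ (lose (∈-allFin (funToFin _⁻¹)) found)))))
    where
    open FinGroup G hiding (group; rawGroup)
    open IsGroup isGroup using (assoc; identityˡ; identityʳ; inverseˡ; inverseʳ)
    _∙′_ = op (code _∙_)
    _⁻¹′ = finToFun (funToFin _⁻¹)

    ∙′≡∙ : ∀ x y → x ∙′ y ≡ x ∙ y
    ∙′≡∙ = op-code _∙_

    ⁻¹′≡⁻¹ : ∀ x → x ⁻¹′ ≡ x ⁻¹
    ⁻¹′≡⁻¹ = Fin.finToFun-funToFin _⁻¹

    isGroup′ : IsGroup _≡_ _∙′_ ε _⁻¹′
    isGroup′ = record
      { isMonoid = record
        { isSemigroup = record
          { isMagma = record { isEquivalence = isEquivalence ; ∙-cong = cong₂ _∙′_ }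
          ; assoc = λ x y z → trans (trans (∙′≡∙ _ z) (cong (_∙ z) (∙′≡∙ x y)))
              (trans (assoc x y z) (sym (trans (∙′≡∙ x _) (cong (x ∙_) (∙′≡∙ y z))))) }
        ; identity = (λ x → trans (∙′≡∙ ε x) (identityˡ x)) , λ x → trans (∙′≡∙ x ε) (identityʳ x) }
      ; inverse = (λ x → trans (∙′≡∙ _ x) (trans (cong (_∙ x) (⁻¹′≡⁻¹ x)) (inverseˡ x)))
                , (λ x → trans (∙′≡∙ x _) (trans (cong (x ∙_) (⁻¹′≡⁻¹ x)) (inverseʳ x)))
      ; ⁻¹-cong = cong _⁻¹′ }

    found : Any (λ G′ → rawGroup G ≅ rawGroup G′) (List.fromMaybe (candidate (code _∙_) ε (funToFin _⁻¹)))
    found with isGroup? _∙′_ ε _⁻¹′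
    ... | yes g = here (id , record
      { isGroupMonomorphism = mkMono G (record { isGroup = g }) (λ x y → sym (∙′≡∙ x y)) (λ _ _ → id) refl
          (λ x → sym (⁻¹′≡⁻¹ x))
      ; surjective = λ y → y , id })
    ... | no ¬g = contradiction isGroup′ ¬g

-- One representative of each isomorphism class of groups of order n.
groupClasses : ∀ n → List (FinGroup n)
groupClasses n = deduplicate _≅?_ groups

-- A subgroup of G has order at most that of G.
subgroupClasses : ∀ {n} → FinGroup n → ℕ
subgroupClasses {n} G = sum (List.map (λ m → length (filter (_≲? G) (groupClasses m))) (upTo (suc n)))

A : ℕ → ℕ → ℕ
A r n = sum (List.map subgroupClasses
  (filter (λ G → isAbelian? G ×-dec rankAtMost? G r) (groupClasses n)))

-- ∑_{1 ≤ n ≤ m} a n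
summatory : (ℕ → ℕ) → ℕ → ℕ
summatory a m = sum (List.map (a ∘ suc) (upTo m))

-- A real number x ≥ 1 together with its integer part, which is not
-- constructively computable from x.
record [1,∞⟩ : Set where
  field
    point        : ℝ
    1≤point      : fromℕ 1 ≤ point
    ⌊point⌋      : ℕ
    ⌊point⌋≤     : fromℕ ⌊point⌋ ≤ point
    <1+⌊point⌋   : point < fromℕ (suc ⌊point⌋)

open [1,∞⟩ public

infix 3 _∼_

-- f/g → 1 at infinity, in the form f - g = o(g).
_∼_ : ([1,∞⟩ → ℝ) → ([1,∞⟩ → ℝ) → Set
f ∼ g = ∀ ε → 0ℚ ℚ.< ε → ∃ λ (X : ℕ) → ∀ x → fromℕ X ≤ point x →
  ∣ f x - g x ∣ ≤ fromℚ ε * ∣ g x ∣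

module Submission where

-- An abelian group of rank at most r has a unique type d₁ ∣ ⋯ ∣ dᵣ (its invariant
-- factors), its order is d₁ ⋯ dᵣ, and a group of type e embeds into one of type d
-- exactly when eᵢ ∣ dᵢ for all i.  So the sum counts pairs of chains e, d with eᵢ ∣ dᵢ.
-- Writing dᵢ = a₁ ⋯ aᵢ and cᵢ = dᵢ / eᵢ, the order is ∏ aᵢ ^ (r + 1 - i) and the
-- condition on eᵢ is cᵢ ∣ cᵢ₋₁ aᵢ, which makes the count P_r(1; x) for
--   P_s(c; y) = ∑_{a ≤ y} ∑_{q ∣ c a} P_{s-1}(q; ⌊y / a ^ s⌋),   P₀ = 1.
-- P₁(c; y) = ∑_{b ≤ c y} ⌊y gcd(b, c) / b⌋ is κ y H_y + O(y), as gcd(b, c) has period c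
-- in b (H_y is the harmonic sum).  For s ≥ 2 the series over a is dominated by
-- ∑ τ(a) ^ s / a ^ 2, so by Tannery's theorem P_s(c; y) / (y H_y) is a Cauchy sequence
-- of rationals; its limit for s = r and c = 1 is C_r.  Finally H_y = log y + O(1).

-- The least coefficient of a relation is a minimum over an unbounded family, so the structure
-- theory is proved only under double negation. This suffices: it is consumed by `sumOver-inject`,
-- whose conclusion is a decidable inequality of rationals, and the two opposite injections between
-- quadruples and codes make the counts equal.
--
-- The recursion for P_s carries no error terms. `Regular` asks instead for convergence at each
-- fixed c together with a bound of the form K τ(c) ^ s y H_y; the explicit dependence on c is
-- essential, because the recursion replaces c by divisors q of c a with a unbounded. The factor 1 /
-- a ^ 2 comes from a ^ s with s ≥ 2. The case s = 1 has no such factor and is treated by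
-- interchanging the sums over a and b.
--
-- An error relative to the main term also requires the constant to stay away from zero. Discarding
-- all but the terms with a = 1 and b = 1 gives P_s(1; y) ≥ P₁(1; y) ≥ y H_y - y, so the quotients
-- P_s(1; y) / (y H_y) are at least 1/2 from some point on.

-- Finite sums of rationals over lists, and harmonic numbers

module FiniteSums where
  open import Defs using (⌜_⌝; ⌜⌝-suc; recip; module Rational; module Log)
  open import Data.Empty using (⊥)
  open import Data.List.Base using (List; []; _∷_; _++_; map; concatMap; length)
  open import Data.List.Membership.Propositional using (_∈_)
  open import Data.List.Relation.Unary.All as All using (All; []; _∷_)
  open import Data.List.Relation.Unary.AllPairs using (AllPairs; []; _∷_)
  open import Data.List.Relation.Unary.Any using (here; there; _─_)
  open import Data.Nat.Base as ℕ using (ℕ; zero; suc)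
  import Data.Nat.Properties as ℕ
  open import Data.Product.Base using (∃; _×_; _,_; proj₂)
  open import Data.Rational.Base
  import Data.Rational.Properties as ℚ
  open import Data.Rational.Solver using (module +-*-Solver)
  open import Data.Sum.Base using (_⊎_; inj₁; inj₂)
  open import Function.Base using (_∘_)
  open import Relation.Binary.PropositionalEquality hiding ([_])
  open import Relation.Nullary using (¬_; contradiction; decidable-stable)
  open ℚ.≤-Reasoning
  open +-*-Solver using (solve; _:=_; _:+_; _:*_; con)
  open Rational

  private variable
    A B : Set

  sumOver : List A → (A → ℚ) → ℚ
  sumOver []       f = 0ℚ
  sumOver (x ∷ xs) f = f x + sumOver xs f

  sumOver-cong : ∀ (xs : List A) {f g} → (∀ {x} → x ∈ xs → f x ≡ g x) → sumOver xs f ≡ sumOver xs g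
  sumOver-cong []       eq = refl
  sumOver-cong (x ∷ xs) eq = cong₂ _+_ (eq (here refl)) (sumOver-cong xs (eq ∘ there))

  sumOver-mono : ∀ (xs : List A) {f g} → (∀ {x} → x ∈ xs → f x ≤ g x) → sumOver xs f ≤ sumOver xs g
  sumOver-mono []       le = ℚ.≤-refl
  sumOver-mono (x ∷ xs) le = ℚ.+-mono-≤ (le (here refl)) (sumOver-mono xs (le ∘ there))

  sumOver-nonneg : ∀ (xs : List A) {f} → (∀ {x} → x ∈ xs → 0ℚ ≤ f x) → 0ℚ ≤ sumOver xs f
  sumOver-nonneg []       0≤f = ℚ.≤-refl
  sumOver-nonneg (x ∷ xs) 0≤f = ℚ.+-mono-≤ (0≤f (here refl)) (sumOver-nonneg xs (0≤f ∘ there))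

  sumOver-*ˡ : ∀ (xs : List A) k f → sumOver xs (λ x → k * f x) ≡ k * sumOver xs f
  sumOver-*ˡ []       k f = sym (ℚ.*-zeroʳ k)
  sumOver-*ˡ (x ∷ xs) k f = trans (cong (k * f x +_) (sumOver-*ˡ xs k f))
    (sym (ℚ.*-distribˡ-+ k (f x) (sumOver xs f)))

  sumOver-*ʳ : ∀ (xs : List A) k f → sumOver xs (λ x → f x * k) ≡ sumOver xs f * k
  sumOver-*ʳ xs k f = trans (sumOver-cong xs λ {x} _ → ℚ.*-comm (f x) k)
    (trans (sumOver-*ˡ xs k f) (ℚ.*-comm k (sumOver xs f)))

  sumOver-+ : ∀ (xs : List A) f g → sumOver xs (λ x → f x + g x) ≡ sumOver xs f + sumOver xs g
  sumOver-+ []       f g = refl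
  sumOver-+ (x ∷ xs) f g = trans (cong (f x + g x +_) (sumOver-+ xs f g))
    (solve 4 (λ a b c d → a :+ b :+ (c :+ d) := a :+ c :+ (b :+ d)) refl (f x) (g x) (sumOver xs f) (sumOver xs g))

  sumOver-const : ∀ (xs : List A) k → sumOver xs (λ _ → k) ≡ ⌜ length xs ⌝ * k
  sumOver-const []       k = sym (ℚ.*-zeroˡ k)
  sumOver-const (x ∷ xs) k = begin-equality
    k + sumOver xs (λ _ → k)    ≡⟨ cong (k +_) (sumOver-const xs k) ⟩
    k + ⌜ length xs ⌝ * k       ≡⟨ solve 2 (λ a b → a :+ b :* a := (b :+ con 1ℚ) :* a) refl k ⌜ length xs ⌝ ⟩
    (⌜ length xs ⌝ + 1ℚ) * k    ≡⟨ cong (_* k) (⌜⌝-suc (length xs)) ⟨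
    ⌜ suc (length xs) ⌝ * k     ∎

  sumOver-1 : ∀ (xs : List A) → sumOver xs (λ _ → 1ℚ) ≡ ⌜ length xs ⌝
  sumOver-1 xs = trans (sumOver-const xs 1ℚ) (ℚ.*-identityʳ ⌜ length xs ⌝)

  sumOver-++ : ∀ (xs ys : List A) f → sumOver (xs ++ ys) f ≡ sumOver xs f + sumOver ys f
  sumOver-++ []       ys f = sym (ℚ.+-identityˡ (sumOver ys f))
  sumOver-++ (x ∷ xs) ys f = trans (cong (f x +_) (sumOver-++ xs ys f)) (sym (ℚ.+-assoc (f x) _ _))

  sumOver-map : ∀ (h : A → B) xs f → sumOver (map h xs) f ≡ sumOver xs (f ∘ h)
  sumOver-map h []       f = refl
  sumOver-map h (x ∷ xs) f = cong (f (h x) +_) (sumOver-map h xs f)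

  sumOver-concatMap : ∀ (h : A → List B) xs f →
    sumOver (concatMap h xs) f ≡ sumOver xs (λ x → sumOver (h x) f)
  sumOver-concatMap h []       f = refl
  sumOver-concatMap h (x ∷ xs) f = trans (sumOver-++ (h x) (concatMap h xs) f)
    (cong (sumOver (h x) f +_) (sumOver-concatMap h xs f))

  sumOver-─ : ∀ {y} {ys : List A} (y∈ : y ∈ ys) f → sumOver ys f ≡ f y + sumOver (ys ─ y∈) f
  sumOver-─ (here refl) f = refl
  sumOver-─ {y = y} {x ∷ ys} (there y∈) f = trans (cong (f x +_) (sumOver-─ y∈ f))
    (solve 3 (λ a b c → a :+ (b :+ c) := b :+ (a :+ c)) refl (f x) (f y) (sumOver (ys ─ y∈) f))

  ∈-─ : ∀ {y z} {ys : List A} (y∈ : y ∈ ys) → z ∈ ys → z ≡ y ⊎ z ∈ (ys ─ y∈)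
  ∈-─ (here refl) (here refl) = inj₁ refl
  ∈-─ (here refl) (there z∈)  = inj₂ z∈
  ∈-─ (there y∈)  (here refl) = inj₂ (here refl)
  ∈-─ (there y∈)  (there z∈) with ∈-─ y∈ z∈
  ... | inj₁ eq  = inj₁ eq
  ... | inj₂ z∈′ = inj₂ (there z∈′)

  -- Each partner is deleted from `ys` once it is used. As no two entries of `xs` share a partner,
  -- the remaining entries still find theirs in what is left. Partners that exist only under double
  -- negation are enough, because the conclusion is a decidable inequality.
  sumOver-inject : ∀ (R : A → B → Set) {f : A → ℚ} {g : B → ℚ} → (∀ y → 0ℚ ≤ g y) → ∀ {xs} ys →
    AllPairs (λ x x′ → ∀ {y} → R x y → R x′ y → ⊥) xs →
    (∀ {x} → x ∈ xs → ¬ ¬ (∃ λ y → y ∈ ys × R x y × f x ≤ g y)) →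
    sumOver xs f ≤ sumOver ys g
  sumOver-inject R 0≤g ys []              into = sumOver-nonneg ys λ {y} _ → 0≤g y
  sumOver-inject R {f} {g} 0≤g {x ∷ xs} ys (x# ∷ xs#) into =
    decidable-stable (_ ℚ.≤? _) λ ≰ → into (here refl) λ (y , y∈ , r , fx≤gy) → ≰ (begin
      f x + sumOver xs f          ≤⟨ ℚ.+-mono-≤ fx≤gy (sumOver-inject R 0≤g (ys ─ y∈) xs# λ x′∈ k →
                                       into (there x′∈) λ (y′ , y′∈ , r′ , le) →
                                         k (y′ , elsewhere y∈ r x′∈ y′∈ r′ , r′ , le)) ⟩
      g y + sumOver (ys ─ y∈) g   ≡⟨ sumOver-─ y∈ g ⟨
      sumOver ys g                ∎)
    where
    elsewhere : ∀ {y y′ x′} (y∈ : y ∈ ys) → R x y → x′ ∈ xs → y′ ∈ ys → R x′ y′ → y′ ∈ (ys ─ y∈)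
    elsewhere y∈ r x′∈ y′∈ r′ with ∈-─ y∈ y′∈
    ... | inj₁ refl = contradiction r′ (All.lookup x# x′∈ r)
    ... | inj₂ y′∈′ = y′∈′

  range : ℕ → List ℕ
  range zero    = []
  range (suc n) = suc n ∷ range n

  ∈-range⁺ : ∀ {a n} → 1 ℕ.≤ a → a ℕ.≤ n → a ∈ range n
  ∈-range⁺ {n = zero}  1≤a a≤0 = contradiction (ℕ.≤-trans 1≤a a≤0) λ ()
  ∈-range⁺ {n = suc n} 1≤a a≤1+n with ℕ.m≤n⇒m<n∨m≡n a≤1+n
  ... | inj₁ (ℕ.s≤s a≤n) = there (∈-range⁺ 1≤a a≤n)
  ... | inj₂ refl = here refl

  ∈-range⁻ : ∀ {a n} → a ∈ range n → 1 ℕ.≤ a × a ℕ.≤ n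
  ∈-range⁻ {n = suc n} (here refl) = ℕ.s≤s ℕ.z≤n , ℕ.≤-refl
  ∈-range⁻ {n = suc n} (there a∈)  = let 1≤a , a≤n = ∈-range⁻ a∈ in 1≤a , ℕ.m≤n⇒m≤1+n a≤n

  range-unique : ∀ n → AllPairs _≢_ (range n)
  range-unique zero    = []
  range-unique (suc n) = All.tabulate (λ a∈ eq → ℕ.<⇒≢ (ℕ.s≤s (proj₂ (∈-range⁻ a∈))) (sym eq)) ∷ range-unique n

  length-range : ∀ n → length (range n) ≡ n
  length-range zero    = refl
  length-range (suc n) = cong suc (length-range n)

  ⌜⌝-cancel-≤ : ∀ {m n} → ⌜ m ⌝ ≤ ⌜ n ⌝ → m ℕ.≤ n
  ⌜⌝-cancel-≤ {m} {n} le = ℕ.≮⇒≥ λ n<m → ℚ.<-irrefl refl (begin-strict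
    ⌜ n ⌝         ≡⟨ ℚ.+-identityʳ ⌜ n ⌝ ⟨
    ⌜ n ⌝ + 0ℚ    <⟨ ℚ.+-monoʳ-< ⌜ n ⌝ (ℚ.positive⁻¹ 1ℚ) ⟩
    ⌜ n ⌝ + 1ℚ    ≡⟨ ⌜⌝-suc n ⟨
    ⌜ suc n ⌝     ≤⟨ ⌜⌝-mono n<m ⟩
    ⌜ m ⌝         ≤⟨ le ⟩
    ⌜ n ⌝         ∎)

  recip-inverse : ∀ {t} → 1ℚ ≤ t → t * recip t ≡ 1ℚ
  recip-inverse {t} 1≤t = trans (ℚ.*-comm t (recip t))
    (trans (cong (recip t *_) (sym (ℚ.p≤q⇒p⊔q≡q 1≤t))) (Log.recip-inv t))

  opaque
    -- The reciprocal 1 / n, where the clamp in `recip` makes `inv 0` equal to 1. It is opaque so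
    -- that later proofs rest on the laws below alone.
    inv : ℕ → ℚ
    inv n = recip ⌜ n ⌝

    inv≡recip : ∀ n → inv n ≡ recip ⌜ n ⌝
    inv≡recip n = refl

    0≤inv : ∀ n → 0ℚ ≤ inv n
    0≤inv n = Log.0≤recip ⌜ n ⌝

    inv≤1 : ∀ n → inv n ≤ 1ℚ
    inv≤1 n = Log.recip≤1 ⌜ n ⌝

    inv-inverse : ∀ {n} → 1 ℕ.≤ n → ⌜ n ⌝ * inv n ≡ 1ℚ
    inv-inverse 1≤n = recip-inverse (⌜⌝-mono 1≤n)

    inv-antitone : ∀ {m n} → m ℕ.≤ n → inv n ≤ inv m
    inv-antitone m≤n = Log.recip-antitone (⌜⌝-mono m≤n)

  cancel-inverse : ∀ p p′ q {r} → p * p′ ≡ 1ℚ → p * q ≡ r → q ≡ p′ * r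
  cancel-inverse p p′ q {r} pp′≡1 pq≡r = begin-equality
    q               ≡⟨ ℚ.*-identityˡ q ⟨
    1ℚ * q          ≡⟨ cong (_* q) pp′≡1 ⟨
    p * p′ * q      ≡⟨ solve 3 (λ a b c → a :* b :* c := b :* (a :* c)) refl p p′ q ⟩
    p′ * (p * q)    ≡⟨ cong (p′ *_) pq≡r ⟩
    p′ * r          ∎

  inv-1 : inv 1 ≡ 1ℚ
  inv-1 = trans (sym (ℚ.*-identityˡ (inv 1))) (inv-inverse {1} (ℕ.s≤s ℕ.z≤n))

  inv-* : ∀ {m n} → 1 ℕ.≤ m → 1 ℕ.≤ n → inv (m ℕ.* n) ≡ inv m * inv n
  inv-* {m} {n} 1≤m 1≤n = trans (cancel-inverse ⌜ m ℕ.* n ⌝ (inv m * inv n) (inv (m ℕ.* n)) inverse (inv-inverse (ℕ.*-mono-≤ 1≤m 1≤n))) (ℚ.*-identityʳ _)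
    where
    inverse : ⌜ m ℕ.* n ⌝ * (inv m * inv n) ≡ 1ℚ
    inverse = begin-equality
      ⌜ m ℕ.* n ⌝ * (inv m * inv n)        ≡⟨ cong (_* (inv m * inv n)) (⌜⌝-* m n) ⟩
      ⌜ m ⌝ * ⌜ n ⌝ * (inv m * inv n)      ≡⟨ solve 4 (λ a b c d → a :* b :* (c :* d) := (a :* c) :* (b :* d)) refl ⌜ m ⌝ ⌜ n ⌝ (inv m) (inv n) ⟩
      (⌜ m ⌝ * inv m) * (⌜ n ⌝ * inv n)    ≡⟨ cong₂ _*_ (inv-inverse 1≤m) (inv-inverse 1≤n) ⟩
      1ℚ                                   ∎

  harmonic : ℕ → ℚ
  harmonic n = sumOver (range n) inv

  0≤harmonic : ∀ n → 0ℚ ≤ harmonic n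
  0≤harmonic n = sumOver-nonneg (range n) λ {a} _ → 0≤inv a

  harmonic≤ : ∀ n → harmonic n ≤ ⌜ n ⌝
  harmonic≤ n = begin
    harmonic n                    ≤⟨ sumOver-mono (range n) (λ {a} _ → inv≤1 a) ⟩
    sumOver (range n) (λ _ → 1ℚ)  ≡⟨ sumOver-1 (range n) ⟩
    ⌜ length (range n) ⌝          ≡⟨ cong ⌜_⌝ (length-range n) ⟩
    ⌜ n ⌝                         ∎

  harmonic-mono : ∀ {m n} → m ℕ.≤ n → harmonic m ≤ harmonic n
  harmonic-mono m≤n = go (ℕ.≤⇒≤′ m≤n)
    where
    go : ∀ {m n} → m ℕ.≤′ n → harmonic m ≤ harmonic n
    go (ℕ.≤′-reflexive refl) = ℚ.≤-refl
    go {m} {suc n} (ℕ.≤′-step m≤n) = begin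
      harmonic m                    ≤⟨ go m≤n ⟩
      harmonic n                    ≡⟨ ℚ.+-identityˡ (harmonic n) ⟨
      0ℚ + harmonic n               ≤⟨ ℚ.+-monoˡ-≤ (harmonic n) (0≤inv (suc n)) ⟩
      harmonic (suc n)              ∎

  1≤harmonic : ∀ {n} → 1 ℕ.≤ n → 1ℚ ≤ harmonic n
  1≤harmonic {n} 1≤n = begin
    1ℚ                  ≡⟨ inv-1 ⟨
    inv 1               ≡⟨ ℚ.+-identityʳ (inv 1) ⟨
    harmonic 1          ≤⟨ harmonic-mono 1≤n ⟩
    harmonic n          ∎

-- Cyclic decompositions of finite abelian groups, and generators of subgroups

module AbelianGroups where
  open import Defs using (FinGroup; IsAbelian)
  open import Algebra.Bundles using (CommutativeMonoid; Group)
  open import Algebra.Structures using (IsGroup)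
  import Algebra.Properties.Monoid.Mult as Mult
  import Algebra.Properties.Monoid.Sum as MonoidSum
  import Algebra.Properties.CommutativeMonoid.Sum as CommutativeMonoidSum
  import Algebra.Properties.CommutativeMonoid.Mult as CommutativeMonoidMult
  import Algebra.Properties.Group as GroupProperties
  open import Data.Empty using (⊥; ⊥-elim)
  open import Data.Fin.Base as Fin using (Fin; zero; suc; toℕ; punchIn; punchOut)
  import Data.Fin.Properties as Fin
  open import Data.Nat.Base as ℕ using (ℕ; zero; suc; _+_; _*_; _≤_; _<_; s≤s; NonZero)
  import Data.Nat.Properties as ℕ
  open import Data.Nat.Divisibility
  open import Data.Nat.DivMod using (_/_; _%_; m≡m%n+[m/n]*n; m%n<n)
  open import Data.Nat.Induction using (<-rec)
  open import Data.Product.Base using (∃; ∃₂; _×_; _,_; proj₁; proj₂)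
  open import Data.Vec.Functional as Vector using (Vector; removeAt; _∷_)
  open import Function.Base using (_∘_)
  open import Relation.Binary.PropositionalEquality hiding ([_])
  open import Relation.Nullary using (¬_; contradiction; yes; no)
  open FinGroup using (group)

  private variable
    n r : ℕ

  Positive : Vector ℕ r → Set
  Positive d = ∀ i → 1 ≤ d i

  Chain : Vector ℕ r → Set
  Chain d = ∀ {i j} → i Fin.≤ j → d i ∣ d j

  module Multiples (G : FinGroup n) where
    open FinGroup G public using (ε) renaming (_∙_ to infixl 7 _∙_; _⁻¹ to infix 9 _⁻¹)
    open IsGroup (FinGroup.isGroup G) public using (assoc; identityˡ; identityʳ; inverseˡ; inverseʳ)
    open Mult (Group.monoid (group G)) public using () renaming (_×_ to _·_; ×-homo-+ to ·-homo-+; ×-assocˡ to ·-assocˡ)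
    open MonoidSum (Group.monoid (group G)) public using (sum; sum-cong-≗)
    open GroupProperties (group G) public using (∙-cancelˡ; inverseˡ-unique)

    -- Natural coefficients suffice, since by `torsion` the inverse of an element is one of its
    -- multiples.
    lin : Vector ℕ r → Vector (Fin n) r → Fin n
    lin c x = sum λ i → c i · x i

    lin-cong : ∀ {a b : Vector ℕ r} (x : Vector (Fin n) r) → (∀ i → a i ≡ b i) → lin a x ≡ lin b x
    lin-cong x a≗b = sum-cong-≗ λ i → cong (_· x i) (a≗b i)

    lin-ε : ∀ (c : Vector ℕ r) x → (∀ i → c i · x i ≡ ε) → lin c x ≡ ε
    lin-ε {r = zero}  c x cx≡ε = refl
    lin-ε {r = suc r} c x cx≡ε = trans (cong₂ _∙_ (cx≡ε zero) (lin-ε (c ∘ suc) (x ∘ suc) (cx≡ε ∘ suc))) (identityˡ ε)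

    lin-0 : ∀ (x : Vector (Fin n) r) → lin (λ _ → 0) x ≡ ε
    lin-0 x = lin-ε (λ _ → 0) x λ _ → refl

    ·-ε : ∀ k → k · ε ≡ ε
    ·-ε zero    = refl
    ·-ε (suc k) = trans (identityˡ _) (·-ε k)

    record Span (x : Vector (Fin n) r) (g : Fin n) : Set where
      constructor _,_
      field
        coefficients : Vector ℕ r
        combination  : lin coefficients x ≡ g

    -- Among the n + 1 multiples 0 · g, ..., n · g two agree, and the difference of their factors
    -- kills `g`.
    torsion : ∀ g → ∃ λ k → suc k · g ≡ ε
    torsion g with Fin.pigeonhole (ℕ.n<1+n n) (λ i → toℕ i · g)
    ... | i , j , i<j , ig≡jg with ℕ.m≤n⇒∃[o]m+o≡n i<j
    ...   | k , eq = k , ∙-cancelˡ (toℕ i · g) _ _ (begin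
      toℕ i · g ∙ suc k · g    ≡⟨ ·-homo-+ g (toℕ i) (suc k) ⟨
      (toℕ i + suc k) · g      ≡⟨ cong (_· g) (trans (ℕ.+-suc (toℕ i) k) eq) ⟩
      toℕ j · g                ≡⟨ ig≡jg ⟨
      toℕ i · g                ≡⟨ identityʳ _ ⟨
      toℕ i · g ∙ ε            ∎)
      where open ≡-Reasoning

  module Abelian {n} (G : FinGroup n) (comm : IsAbelian G) where
    open Multiples G public
    open ≡-Reasoning

    commutativeMonoid : CommutativeMonoid _ _
    commutativeMonoid = record
      { isCommutativeMonoid = record { isMonoid = IsGroup.isMonoid (FinGroup.isGroup G) ; comm = comm } }

    open CommutativeMonoidSum commutativeMonoid public using (∑-distrib-+; sum-remove)
    open CommutativeMonoidMult commutativeMonoid public using () renaming (×-distrib-+ to ·-distrib-∙)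

    lin-+ : ∀ (a b : Vector ℕ r) x → lin (λ i → a i + b i) x ≡ lin a x ∙ lin b x
    lin-+ a b x = trans (sum-cong-≗ λ i → ·-homo-+ (x i) (a i) (b i)) (∑-distrib-+ (λ i → a i · x i) (λ i → b i · x i))

    lin-* : ∀ k (a : Vector ℕ r) x → lin (λ i → k * a i) x ≡ k · lin a x
    lin-* zero    a x = lin-0 x
    lin-* (suc k) a x = trans (lin-+ a (λ i → k * a i) x) (cong (lin a x ∙_) (lin-* k a x))

    unitVector : Fin r → Vector ℕ r
    unitVector zero    = 1 ∷ λ _ → 0
    unitVector (suc i) = 0 ∷ unitVector i

    lin-unitVector : ∀ i (x : Vector (Fin n) r) → lin (unitVector i) x ≡ x i
    lin-unitVector zero    x = trans (cong (1 · x zero ∙_) (lin-0 (x ∘ suc))) (trans (identityʳ _) (identityʳ _))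
    lin-unitVector (suc i) x = trans (identityˡ _) (lin-unitVector i (x ∘ suc))

    module _ {x : Vector (Fin n) r} where

      span-elem : ∀ i → Span x (x i)
      span-elem i = unitVector i , lin-unitVector i x

      span-ε : Span x ε
      span-ε = (λ _ → 0) , lin-0 x

      span-∙ : ∀ {g h} → Span x g → Span x h → Span x (g ∙ h)
      span-∙ (a , refl) (b , refl) = (λ i → a i + b i) , lin-+ a b x

      span-· : ∀ {g} k → Span x g → Span x (k · g)
      span-· k (a , refl) = (λ i → k * a i) , lin-* k a x

      span-⁻¹ : ∀ {g} → Span x g → Span x (g ⁻¹)
      span-⁻¹ {g} s = let k , eq = torsion g in
        subst (Span x) (inverseˡ-unique _ _ (trans (comm _ g) eq)) (span-· k s)

      span-lin : ∀ {s} (c : Vector ℕ s) {y} → (∀ i → Span x (y i)) → Span x (lin c y)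
      span-lin {zero}  c y⊆x = span-ε
      span-lin {suc s} c y⊆x = span-∙ (span-· (c zero) (y⊆x zero)) (span-lin (c ∘ suc) (y⊆x ∘ suc))

      span-tail : ∀ {w g} → Span x g → Span (w ∷ x) g
      span-tail (c , eq) = 0 ∷ c , trans (identityˡ _) eq

    record _⊑_ {r s} (x : Vector (Fin n) r) (y : Vector (Fin n) s) : Set where
      constructor within
      field
        element : ∀ i → Span y (x i)
    open _⊑_ public

    ⊑-trans : ∀ {r s t} {x : Vector (Fin n) r} {y : Vector (Fin n) s} {z : Vector (Fin n) t} → x ⊑ y → y ⊑ z → x ⊑ z
    element (⊑-trans x⊑y y⊑z) i = let c , eq = element x⊑y i in subst (Span _) eq (span-lin c (element y⊑z))

    ∷-⊑ : ∀ {r s} {w} {x : Vector (Fin n) r} {y : Vector (Fin n) s} → Span y w → (∀ i → Span y (x i)) → (w ∷ x) ⊑ y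
    element (∷-⊑ w∈ x⊑y) zero    = w∈
    element (∷-⊑ w∈ x⊑y) (suc i) = x⊑y i

    _≈ˢ_ : Vector (Fin n) r → Vector (Fin n) r → Set
    x ≈ˢ y = x ⊑ y × y ⊑ x

    ≈ˢ-trans : ∀ {x y z : Vector (Fin n) r} → x ≈ˢ y → y ≈ˢ z → x ≈ˢ z
    ≈ˢ-trans (a , b) (c , d) = ⊑-trans a c , ⊑-trans d b

    -- The relations among the `x i` are exactly those of a direct sum of cyclic groups of orders
    -- `d i`.
    record Independent (x : Vector (Fin n) r) (d : Vector ℕ r) : Set where
      field
        annihilates : ∀ i → d i · x i ≡ ε
        relation⇒∣  : ∀ c → lin c x ≡ ε → ∀ i → d i ∣ c i

    %-reduce : ∀ {m w} .{{_ : NonZero m}} a → m · w ≡ ε → a · w ≡ (a % m) · w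
    %-reduce {m} {w} a mw≡ε = begin
      a · w                              ≡⟨ cong (_· w) (m≡m%n+[m/n]*n a m) ⟩
      (a % m + a / m * m) · w            ≡⟨ ·-homo-+ w (a % m) (a / m * m) ⟩
      (a % m) · w ∙ (a / m * m) · w      ≡⟨ cong ((a % m) · w ∙_) (·-assocˡ w (a / m) m) ⟨
      (a % m) · w ∙ (a / m) · m · w      ≡⟨ cong (λ z → (a % m) · w ∙ (a / m) · z) mw≡ε ⟩
      (a % m) · w ∙ (a / m) · ε          ≡⟨ cong ((a % m) · w ∙_) (·-ε (a / m)) ⟩
      (a % m) · w ∙ ε                    ≡⟨ identityʳ _ ⟩
      (a % m) · w                        ∎

    ∣-annihilates : ∀ {d a g} → d · g ≡ ε → d ∣ a → a · g ≡ ε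
    ∣-annihilates {d} {g = g} dg≡ε (divides q refl) =
      trans (sym (·-assocˡ g q d)) (trans (cong (q ·_) dg≡ε) (·-ε q))

    -- Trivial summands with invariant 1 are kept. The length thus stays `r`, a bound on the rank is
    -- built in, and types of different groups can be compared position by position.
    record Decomposition (x : Vector (Fin n) r) : Set where
      field
        invariants  : Vector ℕ r
        basis       : Vector (Fin n) r
        positive    : Positive invariants
        chain       : Chain invariants
        sameSpan    : basis ≈ˢ x
        independent : Independent basis invariants

    -- Let m be the least positive coefficient of a relation among tuples with the same span as x. Subtracting
    -- multiples of m shows that m divides the other coefficients of such a relation, so some w with m · w ≡ ε
    -- splits off, and m divides the orders of whatever is left.
    module _ (x : Vector (Fin n) (suc r)) (IH : ∀ (z : Vector (Fin n) r) → ¬ ¬ Decomposition z) where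

      Coefficient : ℕ → Set
      Coefficient m = ∃₂ λ z c → z ≈ˢ x × lin c z ≡ ε × ∃ λ j → c j ≡ m

      module Minimal {m} .{{_ : NonZero m}} (minimal : ∀ {k} → Coefficient k → k < m → k ≡ 0) where

        shift : Fin n → Vector (Fin n) r → Vector ℕ r → Fin n
        shift w ws cs = w ∙ lin (λ i → cs i / m) ws

        module _ {w ws cs} (same : (w ∷ ws) ≈ˢ x) (relation : m · w ∙ lin cs ws ≡ ε) where

          private
            q ρ : Vector ℕ r
            q i = cs i / m
            ρ i = cs i % m
            w′ = shift w ws cs

          shift-sameSpan : (w′ ∷ ws) ≈ˢ x
          shift-sameSpan = ≈ˢ-trans
            ( ∷-⊑ (span-∙ (span-elem zero) (span-tail (q , refl))) (span-elem ∘ suc)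
            , ∷-⊑ (subst (Span (w′ ∷ ws)) unshift (span-∙ (span-elem zero) (span-⁻¹ (span-tail (q , refl))))) (span-elem ∘ suc))
            same
            where
            unshift : w′ ∙ lin q ws ⁻¹ ≡ w
            unshift = trans (assoc _ _ _) (trans (cong (w ∙_) (inverseʳ _)) (identityʳ w))

          shift-relation : m · w′ ∙ lin ρ ws ≡ ε
          shift-relation = begin
            m · (w ∙ lin q ws) ∙ lin ρ ws               ≡⟨ cong (_∙ lin ρ ws) (·-distrib-∙ w (lin q ws) m) ⟩
            m · w ∙ m · lin q ws ∙ lin ρ ws             ≡⟨ assoc _ _ _ ⟩
            m · w ∙ (m · lin q ws ∙ lin ρ ws)           ≡⟨ cong (λ z → m · w ∙ (z ∙ lin ρ ws)) (lin-* m q ws) ⟨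
            m · w ∙ (lin (λ i → m * q i) ws ∙ lin ρ ws) ≡⟨ cong (m · w ∙_) (lin-+ (λ i → m * q i) ρ ws) ⟨
            m · w ∙ lin (λ i → m * q i + ρ i) ws        ≡⟨ cong (m · w ∙_) (lin-cong ws λ i →
                                                             trans (trans (cong (_+ ρ i) (ℕ.*-comm m (q i))) (ℕ.+-comm _ (ρ i)))
                                                               (sym (m≡m%n+[m/n]*n (cs i) m))) ⟩
            m · w ∙ lin cs ws                           ≡⟨ relation ⟩
            ε                                           ∎

          tail-% : ∀ i → ρ i ≡ 0
          tail-% i = minimal ((w′ ∷ ws) , (m ∷ ρ) , shift-sameSpan , shift-relation , suc i , refl) (m%n<n (cs i) m)

          tail-∣ : ∀ i → m ∣ cs i
          tail-∣ i = m%n≡0⇒n∣m (cs i) m (tail-% i)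

          shift-order : m · w′ ≡ ε
          shift-order = begin
            m · w′                    ≡⟨ identityʳ _ ⟨
            m · w′ ∙ ε                ≡⟨ cong (m · w′ ∙_) (lin-ε ρ ws λ i → cong (_· ws i) (tail-% i)) ⟨
            m · w′ ∙ lin ρ ws         ≡⟨ shift-relation ⟩
            ε                         ∎

        split : ∀ {w ws} → (w ∷ ws) ≈ˢ x → m · w ≡ ε → Decomposition ws → Decomposition x
        split {w} {ws} same mw≡ε D = record
          { invariants  = m ∷ invariants
          ; basis       = w ∷ basis
          ; positive    = λ { zero → ℕ.>-nonZero⁻¹ m ; (suc i) → positive i }
          ; chain       = λ { {zero} {zero} _ → ∣-refl
                            ; {zero} {suc j} _ → tail-∣ {cs = invariants} same′ relation j
                            ; {suc i} {suc j} (s≤s i≤j) → chain i≤j }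
          ; sameSpan    = same′
          ; independent = record
              { annihilates = λ { zero → mw≡ε ; (suc i) → annihilates i }
              ; relation⇒∣  = λ c eq → λ
                  { zero    → m∣ c eq
                  ; (suc i) → relation⇒∣ (c ∘ suc)
                      (trans (sym (identityˡ _)) (trans (cong (_∙ lin (c ∘ suc) basis) (sym (∣-annihilates mw≡ε (m∣ c eq)))) eq)) i }
              }
          }
          where
          open Decomposition D
          open Independent independent

          same′ : (w ∷ basis) ≈ˢ x
          same′ = ≈ˢ-trans
            ( ∷-⊑ (span-elem zero) (λ i → span-tail (element (proj₁ sameSpan) i))
            , ∷-⊑ (span-elem zero) (λ i → span-tail (element (proj₂ sameSpan) i)))
            same

          -- Every term of this relation is zero, yet `tail-∣` applies to it and yields `m` dividing
          -- all the remaining invariants, which is the chain condition.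
          relation : m · w ∙ lin invariants basis ≡ ε
          relation = trans (cong₂ _∙_ mw≡ε (lin-ε invariants basis annihilates)) (identityˡ ε)

          m∣ : ∀ c → lin c (w ∷ basis) ≡ ε → m ∣ c zero
          -- Reducing the head coefficient modulo `m` preserves the relation, as `m · w ≡ ε`; by
          -- minimality the remainder is zero.
          m∣ c eq = m%n≡0⇒n∣m (c zero) m (minimal
            ((w ∷ basis) , (c zero % m ∷ c ∘ suc) , same′
            , trans (cong (_∙ lin (c ∘ suc) basis) (sym (%-reduce (c zero) mw≡ε))) eq , zero , refl)
            (m%n<n (c zero) m))

        decompose : Coefficient m → ¬ ¬ Decomposition x
        decompose (z , c , same , relation , j , refl) k = IH ws λ D →
          k (split (shift-sameSpan {cs = cs} same′ relation′) (shift-order {cs = cs} same′ relation′) D)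
          where
          ws = removeAt z j
          cs = removeAt c j

          z⊑ : ∀ i → Span (z j ∷ ws) (z i)
          z⊑ i with j Fin.≟ i
          ... | yes refl = span-elem zero
          ... | no j≢i   = subst (λ i′ → Span (z j ∷ ws) (z i′)) (Fin.punchIn-punchOut j≢i) (span-elem {x = z j ∷ ws} (suc (punchOut j≢i)))

          same′ : (z j ∷ ws) ≈ˢ x
          same′ = ≈ˢ-trans (∷-⊑ (span-elem j) (λ i → span-elem (punchIn j i)) , within z⊑) same

          relation′ : m · z j ∙ lin cs ws ≡ ε
          relation′ = trans (sym (sum-remove {i = j} (λ i → c i · z i))) relation

      -- Minimality is obtained without a search: once the goal is assumed to fail, the recursion
      -- refutes every smaller positive coefficient, so the one at hand is minimal. A positive
      -- multiple that kills `x zero` supplies the first coefficient.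
      decompose-suc : ¬ ¬ Decomposition x
      decompose-suc k = <-rec (λ m → Coefficient (suc m) → ¬ ¬ Decomposition x)
        (λ m rec coefficient k → Minimal.decompose
          (λ { {zero} _ _ → refl ; {suc m′} co (s≤s m′<m) → contradiction k (rec m′<m co) }) coefficient k)
        (proj₁ (torsion (x zero))) first k
        where
        first : Coefficient (suc (proj₁ (torsion (x zero))))
        first = x , (suc (proj₁ (torsion (x zero))) ∷ λ _ → 0) , (within span-elem , within span-elem)
          , trans (cong₂ _∙_ (proj₂ (torsion (x zero))) (lin-0 (x ∘ suc))) (identityˡ ε) , zero , refl

    decomposition : ∀ (x : Vector (Fin n) r) → ¬ ¬ Decomposition x
    decomposition {zero} x k = k record
      { invariants = λ () ; basis = λ () ; positive = λ () ; chain = λ {i} → contradiction i λ ()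
      ; sameSpan = within (λ ()) , within (λ ()) ; independent = record { annihilates = λ () ; relation⇒∣ = λ _ _ () } }
    decomposition {suc r} x = decompose-suc x decomposition

    module _ (P : Fin n → Set) (P-∙ : ∀ {g h} → P g → P h → P (g ∙ h)) (P-ε : P ε) (P-⁻¹ : ∀ {g} → P g → P (g ⁻¹)) where

      P-· : ∀ {g} k → P g → P (k · g)
      P-· zero    p = P-ε
      P-· (suc k) p = P-∙ p (P-· k p)

      -- The argument is that for subgroups of ℤ ^ r. Take an element of `P` with least positive
      -- coefficient at `x zero`; subtracting a multiple of it from any element of `P` leaves an
      -- element of `P` spanned by `x ∘ suc`, to which the induction applies. Hence a subgroup again
      -- has a type of length `r`.
      subgroup-generators : ∀ (x : Vector (Fin n) r) →
        ¬ ¬ ∃ λ (y : Vector (Fin n) r) → (∀ i → P (y i)) × (∀ {g} → P g → Span x g → Span y g)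
      subgroup-generators {zero}  x k = k ((λ ()) , (λ ()) , λ { _ (_ , eq) → (λ ()) , eq })
      subgroup-generators {suc r} x k = subgroup-generators (x ∘ suc) λ (y , P-y , y-spans) →
        <-rec (λ m → HeadCoefficient (suc m) → ¬ Goal → ⊥)
          (λ m rec → λ head k → k (extend y P-y y-spans m head
            λ { {zero} _ _ → refl ; {suc m′} head′ (s≤s m′<m) → ⊥-elim (rec m′<m head′ k) }))
          (proj₁ (torsion (x zero))) first k
        where
        Goal = ∃ λ (y : Vector (Fin n) (suc r)) → (∀ i → P (y i)) × (∀ {g} → P g → Span x g → Span y g)

        HeadCoefficient : ℕ → Set
        HeadCoefficient m = ∃ λ h → Span (x ∘ suc) h × P (m · x zero ∙ h)

        first : HeadCoefficient (suc (proj₁ (torsion (x zero))))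
        first = ε , span-ε , subst P (sym (trans (identityʳ _) (proj₂ (torsion (x zero))))) P-ε

        extend : ∀ (y : Vector (Fin n) r) → (∀ i → P (y i)) → (∀ {g} → P g → Span (x ∘ suc) g → Span y g) →
                 ∀ m → HeadCoefficient (suc m) → (∀ {k} → HeadCoefficient k → k < suc m → k ≡ 0) → Goal
        extend y P-y y-spans m (h , h∈ , Ph) minimal = y₀ ∷ y , (λ { zero → Ph ; (suc i) → P-y i }) , spans
          where
          y₀ = suc m · x zero ∙ h

          spans : ∀ {g} → P g → Span x g → Span (y₀ ∷ y) g
          spans {g} Pg (c , refl) = subst (Span (y₀ ∷ y)) recompose
            (span-∙ (span-· q (span-elem zero)) (span-tail (y-spans Pl (subst (Span (x ∘ suc)) (sym l≡h′) h′∈))))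
            where
            a = c zero
            q = a / suc m
            ρ = a % suc m
            t = lin (c ∘ suc) (x ∘ suc)
            -- What is left of `g` is ρ · x zero plus `h′`, where `h′` does not involve `x zero`. As
            -- it lies in `P` and `ρ` is below `suc m`, minimality gives `ρ≡0`.
            l = g ∙ (q · y₀) ⁻¹
            h′ = t ∙ (q · h) ⁻¹

            h′∈ : Span (x ∘ suc) h′
            h′∈ = span-∙ (c ∘ suc , refl) (span-⁻¹ (span-· q h∈))

            Pl : P l
            Pl = P-∙ Pg (P-⁻¹ (P-· q Ph))

            g≡ : g ≡ ρ · x zero ∙ h′ ∙ q · y₀
            g≡ = begin
              a · x zero ∙ t
                ≡⟨ cong (λ z → z · x zero ∙ t) (m≡m%n+[m/n]*n a (suc m)) ⟩
              (ρ + q * suc m) · x zero ∙ t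
                ≡⟨ cong (_∙ t) (·-homo-+ (x zero) ρ (q * suc m)) ⟩
              ρ · x zero ∙ (q * suc m) · x zero ∙ t
                ≡⟨ cong (λ z → ρ · x zero ∙ z ∙ t) (·-assocˡ (x zero) q (suc m)) ⟨
              ρ · x zero ∙ u ∙ t
                ≡⟨ assoc _ _ _ ⟩
              ρ · x zero ∙ (u ∙ t)
                ≡⟨ cong (ρ · x zero ∙_) (comm u t) ⟩
              ρ · x zero ∙ (t ∙ u)
                ≡⟨ cong (λ z → ρ · x zero ∙ (z ∙ u)) (trans (sym (identityʳ t)) (cong (t ∙_) (sym (inverseˡ (q · h))))) ⟩
              ρ · x zero ∙ (t ∙ ((q · h) ⁻¹ ∙ q · h) ∙ u)
                ≡⟨ cong (λ z → ρ · x zero ∙ (z ∙ u)) (assoc t _ _) ⟨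
              ρ · x zero ∙ (h′ ∙ q · h ∙ u)
                ≡⟨ cong (ρ · x zero ∙_) (trans (assoc h′ _ _) (cong (h′ ∙_) (comm (q · h) u))) ⟩
              ρ · x zero ∙ (h′ ∙ (u ∙ q · h))
                ≡⟨ cong (λ z → ρ · x zero ∙ (h′ ∙ z)) (·-distrib-∙ (suc m · x zero) h q) ⟨
              ρ · x zero ∙ (h′ ∙ q · y₀)
                ≡⟨ assoc _ _ _ ⟨
              ρ · x zero ∙ h′ ∙ q · y₀ ∎
              where u = q · suc m · x zero

            l≡ : l ≡ ρ · x zero ∙ h′
            l≡ = trans (cong (_∙ (q · y₀) ⁻¹) g≡) (trans (assoc _ _ _) (trans (cong (ρ · x zero ∙ h′ ∙_) (inverseʳ _)) (identityʳ _)))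

            ρ≡0 : ρ ≡ 0
            ρ≡0 = minimal (h′ , h′∈ , subst P l≡ Pl) (m%n<n a (suc m))

            l≡h′ : l ≡ h′
            l≡h′ = trans l≡ (trans (cong (λ z → z · x zero ∙ h′) ρ≡0) (identityˡ h′))

            recompose : q · y₀ ∙ l ≡ g
            recompose = trans (comm _ l) (trans (assoc _ _ _) (trans (cong (g ∙_) (inverseˡ _)) (identityʳ g)))

-- Types of abelian groups and the homomorphisms that they determine

module Types where
  open import Defs using (FinGroup; IsAbelian; _≲_; _≅_; mono⇒≲; ≲⇒mono; mkMono)
  open import Algebra.Morphism.Structures using (module GroupMorphisms)
  open import Data.Fin.Base as Fin using (Fin; zero; suc)
  import Data.Fin.Properties as Fin
  open import Data.Nat.Base as ℕ using (ℕ; zero; suc; _+_; _*_; _∸_; _≤_; NonZero)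
  import Data.Nat.Properties as ℕ
  open import Data.Nat.Divisibility
  open import Data.Nat.Solver using (module +-*-Solver)
  open import Data.Product.Base using (∃; _×_; _,_; proj₁; proj₂)
  open import Data.Vec.Functional as Vector using (Vector)
  open import Function.Base using (_∘_)
  open import Relation.Binary.PropositionalEquality hiding ([_])
  open import Relation.Nullary using (¬_)
  open AbelianGroups
  open FinGroup using (rawGroup)
  open +-*-Solver using (solve; _:=_; _:+_; _:*_)

  private variable
    m n r : ℕ

  -- Congruence modulo `d`, with multiples added on both sides in place of a subtraction.
  record Congruent (d a b : ℕ) : Set where
    constructor congruent
    field
      k l        : ℕ
      difference : a + k * d ≡ b + l * d

  congruent-*ʳ : ∀ {d a b} c → Congruent d a b → Congruent (c * d) (a * c) (b * c)
  congruent-*ʳ {d} {a} {b} c (congruent k l eq) = congruent k l (begin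
    a * c + k * (c * d)    ≡⟨ solve 4 (λ a c k d → a :* c :+ k :* (c :* d) := (a :+ k :* d) :* c) refl a c k d ⟩
    (a + k * d) * c        ≡⟨ cong (_* c) eq ⟩
    (b + l * d) * c        ≡⟨ solve 4 (λ a c k d → (a :+ k :* d) :* c := a :* c :+ k :* (c :* d)) refl b c l d ⟩
    b * c + l * (c * d)    ∎)
    where open ≡-Reasoning

  congruent-cancel : ∀ {d a b c} .{{_ : NonZero c}} → Congruent (c * d) (a * c) (b * c) → Congruent d a b
  congruent-cancel {d} {a} {b} {c} (congruent k l eq) = congruent k l (ℕ.*-cancelʳ-≡ _ _ c (begin
    (a + k * d) * c        ≡⟨ solve 4 (λ a c k d → (a :+ k :* d) :* c := a :* c :+ k :* (c :* d)) refl a c k d ⟩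
    a * c + k * (c * d)    ≡⟨ eq ⟩
    b * c + l * (c * d)    ≡⟨ solve 4 (λ a c k d → a :* c :+ k :* (c :* d) := (a :+ k :* d) :* c) refl b c l d ⟩
    (b + l * d) * c        ∎))
    where open ≡-Reasoning

  -- `G` is the internal direct sum of cyclic groups of orders `d i`. The chain condition on `d` is
  -- stated separately, where types have to be compared.
  record HasType (G : FinGroup n) (d : Vector ℕ r) : Set where
    field
      comm     : IsAbelian G
      positive : Positive d
      basis    : Vector (Fin n) r
    open Abelian G comm public
    field
      spans       : ∀ g → Span basis g
      independent : Independent basis d

    open Independent independent public

    coordinates : Fin n → Vector ℕ r
    coordinates g = Span.coefficients (spans g)

    lin-coordinates : ∀ g → lin (coordinates g) basis ≡ g
    lin-coordinates g = Span.combination (spans g)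

    congruent⇒lin≡ : ∀ a b → (∀ i → Congruent (d i) (a i) (b i)) → lin a basis ≡ lin b basis
    congruent⇒lin≡ a b a≡b = sum-cong-≗ λ i → let congruent k l eq = a≡b i in
      trans (add-multiple (a i) k i) (trans (cong (_· basis i) eq) (sym (add-multiple (b i) l i)))
      where
      add-multiple : ∀ c k i → c · basis i ≡ (c + k * d i) · basis i
      add-multiple c k i = sym (trans (·-homo-+ (basis i) c (k * d i))
        (trans (cong (c · basis i ∙_) (∣-annihilates {d i} {k * d i} (annihilates i) (n∣m*n k))) (identityʳ _)))

    -- The coefficient `(d i ∸ 1) * b i` stands in for -b i, because `d i` kills the basis element;
    -- this turns the equality into a relation.
    lin≡⇒congruent : ∀ a b → lin a basis ≡ lin b basis → ∀ i → Congruent (d i) (a i) (b i)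
    lin≡⇒congruent a b eq i with relation⇒∣ (λ i → a i + (d i ∸ 1) * b i) relation i
      where
      open ≡-Reasoning
      d*b : ∀ i → b i + (d i ∸ 1) * b i ≡ d i * b i
      d*b i = cong (_* b i) (ℕ.m+[n∸m]≡n (positive i))

      relation : lin (λ i → a i + (d i ∸ 1) * b i) basis ≡ ε
      relation = begin
        lin (λ i → a i + (d i ∸ 1) * b i) basis               ≡⟨ lin-+ a (λ i → (d i ∸ 1) * b i) basis ⟩
        lin a basis ∙ lin (λ i → (d i ∸ 1) * b i) basis       ≡⟨ cong (_∙ lin (λ i → (d i ∸ 1) * b i) basis) eq ⟩
        lin b basis ∙ lin (λ i → (d i ∸ 1) * b i) basis       ≡⟨ lin-+ b (λ i → (d i ∸ 1) * b i) basis ⟨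
        lin (λ i → b i + (d i ∸ 1) * b i) basis               ≡⟨ lin-cong basis d*b ⟩
        lin (λ i → d i * b i) basis                           ≡⟨ lin-ε (λ i → d i * b i) basis (λ i →
                                                                   ∣-annihilates {d i} {d i * b i} (annihilates i) (m∣m*n (b i))) ⟩
        ε ∎
    ... | divides k eq′ = congruent (b i) k (begin
      a i + b i * d i                          ≡⟨ cong (a i +_) (trans (ℕ.*-comm (b i) (d i)) (cong (_* b i) (sym (ℕ.m+[n∸m]≡n (positive i))))) ⟩
      a i + (b i + (d i ∸ 1) * b i)            ≡⟨ solve 3 (λ x y z → x :+ (y :+ z) := y :+ (x :+ z)) refl (a i) (b i) ((d i ∸ 1) * b i) ⟩
      b i + (a i + (d i ∸ 1) * b i)            ≡⟨ cong (b i +_) eq′ ⟩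
      b i + k * d i                            ∎)
      where open ≡-Reasoning

  module Homomorphisms {m n} (H : FinGroup m) (G : FinGroup n) where
    private
      module H = Multiples H
      module G = Multiples G
    open GroupMorphisms (rawGroup H) (rawGroup G) public using (IsGroupMonomorphism; IsGroupIsomorphism)

    module _ {f : Fin m → Fin n} (homo : ∀ x y → f (x H.∙ y) ≡ f x G.∙ f y) where

      ε-homo : f H.ε ≡ G.ε
      ε-homo = G.∙-cancelˡ (f H.ε) _ _ (trans (sym (homo _ _)) (trans (cong f (H.identityˡ _)) (sym (G.identityʳ _))))

      ⁻¹-homo : ∀ x → f (x H.⁻¹) ≡ f x G.⁻¹
      ⁻¹-homo x = G.inverseˡ-unique _ _ (trans (sym (homo _ _)) (trans (cong f (H.inverseˡ x)) ε-homo))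

      ·-homo : ∀ k x → f (k H.· x) ≡ k G.· f x
      ·-homo zero    x = ε-homo
      ·-homo (suc k) x = trans (homo _ _) (cong (f x G.∙_) (·-homo k x))

      lin-homo : ∀ {r} (c : Vector ℕ r) x → f (H.lin c x) ≡ G.lin c (f ∘ x)
      lin-homo {zero}  c x = ε-homo
      lin-homo {suc r} c x = trans (homo _ _) (cong₂ G._∙_ (·-homo (c zero) (x zero)) (lin-homo (c ∘ suc) (x ∘ suc)))

      monomorphism : (∀ x y → f x ≡ f y → x ≡ y) → IsGroupMonomorphism f
      monomorphism inj = mkMono H G homo inj ε-homo ⁻¹-homo

  module _ {H : FinGroup m} {G : FinGroup n} {e d : Vector ℕ r} (TH : HasType H e) (TG : HasType G d)
           (c : Vector ℕ r) (d≡ce : ∀ i → d i ≡ c i * e i) where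
    private
      module H = HasType TH
      module G = HasType TG

    open Homomorphisms H G

    -- The homomorphism taking each basis element of `H` to `c i` times that of `G`. It is computed
    -- from one choice of coordinates; `scale-lin` shows that the choice is immaterial, since
    -- congruence modulo `e i` becomes congruence modulo `c i * e i` after multiplication by `c i`.
    -- Cancelling `c i` again gives injectivity.
    scale : Fin m → Fin n
    scale h = G.lin (λ i → H.coordinates h i * c i) G.basis

    private
      scale-lin : ∀ a → scale (H.lin a H.basis) ≡ G.lin (λ i → a i * c i) G.basis
      scale-lin a = G.congruent⇒lin≡ (λ i → H.coordinates (H.lin a H.basis) i * c i) (λ i → a i * c i) λ i → subst (λ d → Congruent d _ _) (sym (d≡ce i))
        (congruent-*ʳ (c i) (H.lin≡⇒congruent (H.coordinates (H.lin a H.basis)) a (H.lin-coordinates (H.lin a H.basis)) i))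

    scale-homo : ∀ x y → scale (x H.∙ y) ≡ scale x G.∙ scale y
    scale-homo x y = begin
      scale (x H.∙ y)                                               ≡⟨ cong scale (cong₂ H._∙_ (H.lin-coordinates x) (H.lin-coordinates y)) ⟨
      scale (H.lin X H.basis H.∙ H.lin Y H.basis)                   ≡⟨ cong scale (H.lin-+ X Y H.basis) ⟨
      scale (H.lin (λ i → X i + Y i) H.basis)                       ≡⟨ scale-lin (λ i → X i + Y i) ⟩
      G.lin (λ i → (X i + Y i) * c i) G.basis                       ≡⟨ G.lin-cong G.basis (λ i → ℕ.*-distribʳ-+ (c i) (X i) (Y i)) ⟩
      G.lin (λ i → X i * c i + Y i * c i) G.basis                   ≡⟨ G.lin-+ (λ i → X i * c i) (λ i → Y i * c i) G.basis ⟩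
      scale x G.∙ scale y                                           ∎
      where
      open ≡-Reasoning
      X = H.coordinates x
      Y = H.coordinates y

    scale-injective : ∀ x y → scale x ≡ scale y → x ≡ y
    scale-injective x y eq = trans (sym (H.lin-coordinates x)) (trans (H.congruent⇒lin≡ _ _ coordinates≡) (H.lin-coordinates y))
      where
      coordinates≡ : ∀ i → Congruent (e i) (H.coordinates x i) (H.coordinates y i)
      coordinates≡ i = congruent-cancel {{ℕ.m*n≢0⇒m≢0 (c i) {{ℕ.>-nonZero (subst (1 ≤_) (d≡ce i) (G.positive i))}}}}
        (subst (λ d → Congruent d _ _) (d≡ce i) (G.lin≡⇒congruent (λ i → H.coordinates x i * c i) (λ i → H.coordinates y i * c i) eq i))

    scale-monomorphism : IsGroupMonomorphism scale
    scale-monomorphism = monomorphism scale-homo scale-injective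

    scale-surjective : (∀ i → c i ≡ 1) → ∀ g → ∃ λ h → scale h ≡ g
    scale-surjective c≡1 g = H.lin (G.coordinates g) H.basis , trans (scale-lin (G.coordinates g))
      (trans (G.lin-cong {b = G.coordinates g} G.basis λ i → trans (cong (G.coordinates g i *_) (c≡1 i)) (ℕ.*-identityʳ _)) (G.lin-coordinates g))

  ∣⇒≲ : ∀ {H : FinGroup m} {G : FinGroup n} {e d : Vector ℕ r} → HasType H e → HasType G d → (∀ i → e i ∣ d i) → H ≲ G
  ∣⇒≲ {H = H} {G} TH TG e∣d = mono⇒≲ H G (_ , scale-monomorphism TH TG (λ i → _∣_.quotient (e∣d i)) (λ i → _∣_.equality (e∣d i)))

  sameType⇒≅ : ∀ {H : FinGroup m} {G : FinGroup n} {d : Vector ℕ r} → HasType H d → HasType G d → rawGroup H ≅ rawGroup G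
  sameType⇒≅ {d = d} TH TG = scale TH TG (λ _ → 1) d≡ , record
    { isGroupMonomorphism = scale-monomorphism TH TG (λ _ → 1) d≡
    ; surjective = λ y → let x , eq = scale-surjective TH TG (λ _ → 1) d≡ (λ _ → refl) y in
        x , λ { refl → eq } }
    where d≡ = λ i → sym (ℕ.*-identityˡ (d i))

  sameType⇒sameOrder : ∀ {H : FinGroup m} {G : FinGroup n} {d : Vector ℕ r} → HasType H d → HasType G d → m ≡ n
  sameType⇒sameOrder {d = d} TH TG = Fin.cantor-schröder-bernstein
    (λ {x} {y} → scale-injective TH TG (λ _ → 1) d≡ x y) (λ {x} {y} → scale-injective TG TH (λ _ → 1) d≡ x y)
    where d≡ = λ i → sym (ℕ.*-identityˡ (d i))

  ≅-preserves-type : ∀ {H : FinGroup m} {G : FinGroup n} {d : Vector ℕ r} → rawGroup H ≅ rawGroup G → HasType H d → HasType G d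
  ≅-preserves-type {H = H} {G} {d} (f , iso) TH = record
    { comm = λ x y → let x′ , eq = preimage x ; y′ , eq′ = preimage y in
        subst₂ (λ x y → x G.∙ y ≡ y G.∙ x) eq eq′ (trans (sym (∙-homo x′ y′)) (trans (cong f (TH.comm x′ y′)) (∙-homo y′ x′)))
    ; positive = TH.positive
    ; basis = f ∘ TH.basis
    ; spans = λ g → let h , eq = preimage g in
        G._,_ (TH.coordinates h) (trans (sym (lin-homo ∙-homo (TH.coordinates h) TH.basis)) (trans (cong f (TH.lin-coordinates h)) eq))
    ; independent = record
      { annihilates = λ i → trans (sym (·-homo ∙-homo (d i) (TH.basis i))) (trans (cong f (TH.annihilates i)) (ε-homo ∙-homo))
      ; relation⇒∣ = λ c eq → TH.relation⇒∣ c (injective (trans (lin-homo ∙-homo c TH.basis) (trans eq (sym (ε-homo ∙-homo)))))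
      }
    }
    where
    module TH = HasType TH
    module G = Multiples G
    open Homomorphisms H G
    open IsGroupIsomorphism iso using (∙-homo; injective; surjective)
    preimage : ∀ g → ∃ λ h → f h ≡ g
    preimage g = proj₁ (surjective g) , proj₂ (surjective g) refl

  module _ (H : FinGroup m) (G : FinGroup n) where

    ≲-abelian : IsAbelian G → H ≲ G → IsAbelian H
    ≲-abelian comm H≲G x y = injective (trans (∙-homo x y) (trans (comm (f x) (f y)) (sym (∙-homo y x))))
      where
      f = proj₁ (≲⇒mono H G H≲G)
      open GroupMorphisms.IsGroupMonomorphism (proj₂ (≲⇒mono H G H≲G))

  spanning⇒type : ∀ {G : FinGroup n} (comm : IsAbelian G) (x : Vector (Fin n) r) → (∀ g → Multiples.Span G x g) →
    ¬ ¬ ∃ λ d → Chain d × HasType {r = r} G d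
  spanning⇒type {G = G} comm x spans k = decomposition x λ D → let open Decomposition D in
    k (invariants , chain , record
      { comm = comm ; positive = positive ; basis = basis ; independent = independent
      ; spans = λ g → let c , eq = spans g in subst (Span basis) eq (span-lin c (element (proj₂ sameSpan))) })
    where open Abelian G comm

  -- By `subgroup-generators` the image of `H` has as many generators as the basis of `G`, and their
  -- preimages span `H` because the embedding is injective.
  ≲⇒type : ∀ {H : FinGroup m} {G : FinGroup n} {d : Vector ℕ r} → HasType G d → H ≲ G → ¬ ¬ ∃ λ e → Chain e × HasType {r = r} H e
  ≲⇒type {H = H} {G} TG H≲G k = subgroup-generators (λ g → ∃ λ h → f h ≡ g)
    (λ (h , eq) (h′ , eq′) → h M.∙ h′ , trans (∙-homo h h′) (cong₂ _∙_ eq eq′))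
    (M.ε , ε-homo) (λ (h , eq) → h M.⁻¹ , trans (⁻¹-homo h) (cong _⁻¹ eq)) basis
    λ (y , fh≡y , y-spans) → spanning⇒type (≲-abelian H G comm H≲G) (proj₁ ∘ fh≡y)
      (λ g → let c , eq = y-spans (g , refl) (spans (f g)) in
        M._,_ c (injective (trans (Homomorphisms.lin-homo H G ∙-homo c (proj₁ ∘ fh≡y))
              (trans (sum-cong-≗ (λ i → cong (c i ·_) (proj₂ (fh≡y i)))) eq)))) k
    where
    open HasType TG
    module M = Multiples H
    f = proj₁ (≲⇒mono H G H≲G)
    open GroupMorphisms.IsGroupMonomorphism (proj₂ (≲⇒mono H G H≲G)) using (∙-homo; ε-homo; ⁻¹-homo; injective)

-- Embeddings force divisibility of types; rank and generating tuples

module Embeddings where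
  open import Defs using (FinGroup; IsAbelian; IsSubgroup; Generates; RankAtMost; _≲_; ≲⇒mono)
  open import Data.Empty using (⊥; ⊥-elim)
  open import Data.Fin.Base as Fin using (Fin; zero; suc; toℕ; fromℕ<; funToFin; finToFun; combine)
  import Data.Fin.Properties as Fin
  open import Data.Fin.Subset using (Subset; _∈_; inside; outside; ⁅_⁆; _∪_) renaming (∣_∣ to card)
  import Data.Fin.Subset as Subset
  import Data.Fin.Subset.Properties as Subset
  open import Data.Nat.Base as ℕ using (ℕ; zero; suc; _+_; _*_; _^_; ∣_-_∣; _≤_; _<_; z≤n; s≤s; NonZero)
  import Data.Nat.Properties as ℕ
  open import Data.Nat.Divisibility
  open import Data.Nat.DivMod using (_/_; _%_; m≡m%n+[m/n]*n; m%n<n)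
  open import Data.Nat.LCM using (lcm; m∣lcm[m,n]; n∣lcm[m,n]; lcm-least; gcd*lcm)
  open import Data.Nat.GCD using (gcd)
  open import Data.Nat.Solver using (module +-*-Solver)
  open import Data.Product.Base using (∃; _×_; _,_; proj₁; proj₂)
  open import Data.Sum.Base using (_⊎_; inj₁; inj₂; [_,_]′)
  open import Data.Vec.Functional as Vector using (Vector; _∷_)
  open import Data.Vec.Base as Vec using (tabulate)
  open import Data.Vec.Properties using (lookup∘tabulate; lookup⇒[]=; []=⇒lookup)
  open import Function.Base using (_∘_; id)
  open import Relation.Binary.PropositionalEquality hiding ([_])
  open import Relation.Nullary using (¬_; Dec; contradiction; yes; no; does; ¬¬-excluded-middle)
  open AbelianGroups
  open Types
  open +-*-Solver using (solve; _:=_; _:+_; _:*_)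

  private variable
    m n r : ℕ

  -- The number of positions after `i`. These and `i` itself are listed in order by `position i`,
  -- with `i` first, and `extend i` pads a vector indexed by them with zeros.
  above : Fin r → ℕ
  above {suc r} zero    = r
  above         (suc i) = above i

  position : (i : Fin r) → Fin (suc (above i)) → Fin r
  position zero    = id
  position (suc i) = suc ∘ position i

  ≤-position : ∀ (i : Fin r) j → i Fin.≤ position i j
  ≤-position zero    j = z≤n
  ≤-position (suc i) j = s≤s (≤-position i j)

  position-cover : ∀ (i j : Fin r) → j Fin.≤ i ⊎ ∃ λ j′ → j ≡ position i (suc j′)
  position-cover zero    zero    = inj₁ z≤n
  position-cover zero    (suc j) = inj₂ (j , refl)
  position-cover (suc i) zero    = inj₁ z≤n
  position-cover (suc i) (suc j) with position-cover i j
  ... | inj₁ j≤i        = inj₁ (s≤s j≤i)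
  ... | inj₂ (j′ , refl) = inj₂ (j′ , refl)

  extend : (i : Fin r) → Vector ℕ (suc (above i)) → Vector ℕ r
  extend zero    c = c
  extend (suc i) c = 0 ∷ extend i c

  extend-position : ∀ (i : Fin r) c j → extend i c (position i j) ≡ c j
  extend-position zero    c j = refl
  extend-position (suc i) c j = extend-position i c j

  lin-extend : ∀ (G : FinGroup n) (i : Fin r) c x → let open Multiples G in lin (extend i c) x ≡ lin c (x ∘ position i)
  lin-extend G zero    c x = refl
  lin-extend G (suc i) c x = trans (Multiples.identityˡ G _) (lin-extend G i c (x ∘ suc))

  congruent⇒∣ : ∀ {d a b} → Congruent d a b → d ∣ ∣ a - b ∣
  congruent⇒∣ {d} {a} {b} (congruent k l eq) = divides ∣ l - k ∣ (begin
    ∣ a - b ∣                      ≡⟨ ℕ.∣m+n-m+o∣≡∣n-o∣ (k * d) a b ⟨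
    ∣ k * d + a - k * d + b ∣      ≡⟨ cong₂ ∣_-_∣ (trans (ℕ.+-comm (k * d) a) eq) (ℕ.+-comm (k * d) b) ⟩
    ∣ b + l * d - b + k * d ∣      ≡⟨ ℕ.∣m+n-m+o∣≡∣n-o∣ b (l * d) (k * d) ⟩
    ∣ l * d - k * d ∣              ≡⟨ ℕ.*-distribʳ-∣-∣ d l k ⟨
    ∣ l - k ∣ * d                  ∎)
    where open ≡-Reasoning

  ∣∣-<⇒≡ : ∀ {q a b} → a < q → b < q → q ∣ ∣ a - b ∣ → a ≡ b
  ∣∣-<⇒≡ {q} {a} {b} a<q b<q q∣ with ∣ a - b ∣ in eq
  ... | zero  = ℕ.∣m-n∣≡0⇒m≡n eq
  ... | suc _ = contradiction (∣⇒≤ q∣) (ℕ.<⇒≱ (subst (_< q) eq (ℕ.≤-<-trans (ℕ.∣m-n∣≤m⊔n a b) (ℕ.⊔-lub a<q b<q))))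

  funToFin-cong : ∀ {f g : Fin m → Fin n} → (∀ i → f i ≡ g i) → funToFin f ≡ funToFin g
  funToFin-cong {zero}  f≗g = refl
  funToFin-cong {suc m} f≗g = cong₂ combine (f≗g zero) (funToFin-cong (f≗g ∘ suc))

  -- Such an `F` would embed q ^ (s + 1) tuples in q ^ s. Tuples are passed through `funToFin`
  -- because only their pointwise equality is available.
  function-pigeonhole : ∀ {q} s → 1 < q → (F : Vector (Fin q) (suc s) → Vector (Fin q) s) →
    (∀ {k k′} → (∀ j → F k j ≡ F k′ j) → ∀ j → k j ≡ k′ j) → ⊥
  function-pigeonhole {q} s 1<q F inj = ℕ.<⇒≱ (ℕ.^-monoʳ-< q 1<q (ℕ.n<1+n s)) (Fin.injective⇒≤ {f = funToFin ∘ F ∘ finToFun} λ {x} {y} eq →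
    trans (sym (Fin.funToFin-finToFin {suc s} {q} x)) (trans
      (funToFin-cong (inj λ j → trans (sym (Fin.finToFun-funToFin (F (finToFun x)) j))
        (trans (cong (λ z → finToFun z j) eq) (Fin.finToFun-funToFin (F (finToFun y)) j))))
      (Fin.funToFin-finToFin {suc s} {q} y)))

  residue : ∀ q .{{_ : NonZero q}} → ℕ → Fin q
  residue q a = fromℕ< (m%n<n a q)

  toℕ-residue : ∀ q .{{_ : NonZero q}} a → toℕ (residue q a) ≡ a % q
  toℕ-residue q a = Fin.toℕ-fromℕ< (m%n<n a q)

  multiples⇒congruent : ∀ {d a b} → d ∣ a → d ∣ b → Congruent d a b
  multiples⇒congruent {d} (divides k refl) (divides l refl) = congruent l k (ℕ.+-comm (k * d) (l * d))

  -- Here a = z d / q and b = w d / q, so a - b is (z - w) / q times d, and (z - w) / q is an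
  -- integer.
  quotients⇒congruent : ∀ {q d a b z w} .{{_ : NonZero q}} →
    q * a ≡ z * d → q * b ≡ w * d → z % q ≡ w % q → Congruent d a b
  quotients⇒congruent {q} {d} {a} {b} {z} {w} qa≡zd qb≡wd z≡w = congruent (w / q) (z / q) (ℕ.*-cancelˡ-≡ _ _ q (begin
    q * (a + w / q * d)                          ≡⟨ distribute a (w / q) ⟩
    q * a + w / q * q * d                        ≡⟨ cong (_+ w / q * q * d) (trans qa≡zd (cong (_* d) (m≡m%n+[m/n]*n z q))) ⟩
    (z % q + z / q * q) * d + w / q * q * d      ≡⟨ cong (λ x → (x + z / q * q) * d + w / q * q * d) z≡w ⟩
    (w % q + z / q * q) * d + w / q * q * d      ≡⟨ solve 4 (λ x y z d → (x :+ y) :* d :+ z :* d := (x :+ z) :* d :+ y :* d) refl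
                                                      (w % q) (z / q * q) (w / q * q) d ⟩
    (w % q + w / q * q) * d + z / q * q * d      ≡⟨ cong (_+ z / q * q * d) (trans qb≡wd (cong (_* d) (m≡m%n+[m/n]*n w q))) ⟨
    q * b + z / q * q * d                        ≡⟨ distribute b (z / q) ⟨
    q * (b + z / q * d)                          ∎))
    where
    open ≡-Reasoning
    distribute : ∀ x y → q * (x + y * d) ≡ q * x + y * q * d
    distribute x y = solve 4 (λ q x y d → q :* (x :+ y :* d) := q :* x :+ y :* q :* d) refl q x y d

  -- Put t = d i, and suppose that lcm t (e i) = q * t with q > 1. The elements of t H killed by q include
  -- q ^ (above i + 1) combinations of the basis elements from position i on, but t G has at most q ^ above i
  -- elements killed by q, since t kills the basis elements of G up to position i.
  -- Here L j * (q * t) = lcm t (e j) for the positions j from i on.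
  module _ {H : FinGroup m} {G : FinGroup n} {e d : Vector ℕ r} (TH : HasType H e) (TG : HasType G d)
           (chain-d : Chain d) (H≲G : H ≲ G) (i : Fin r)
           (q : ℕ) (L : Vector ℕ (suc (above i))) (Lq≢0 : ∀ j → NonZero (L j * (q * d i)))
           (E∣Lqt : ∀ j → e (position i j) ∣ L j * (q * d i))
           (Lqt-least : ∀ j {x} → d i ∣ x → e (position i j) ∣ x → L j * (q * d i) ∣ x) where
    private
      module H = HasType TH
      module G = HasType TG
      open Homomorphisms H G
      open ≡-Reasoning

      f = proj₁ (≲⇒mono H G H≲G)
      open IsGroupMonomorphism (proj₂ (≲⇒mono H G H≲G)) using (∙-homo; injective)

      s = above i
      t = d i
      E : Fin (suc s) → ℕ
      E j = e (position i j)

      X : Vector (Fin m) (suc s)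
      X = H.basis ∘ position i

      module _ (k : Vector (Fin q) (suc s)) where
        -- The factor `L j` makes t · L j · X j killed by `q`, since `E j` divides `L j * (q * t)`.
        -- The multiplication by `t` that follows places the element in t H, so that its image lies
        -- in t G.
        h′ = H.lin (λ j → toℕ (k j) * L j) X

        h = t H.· h′

        c : Vector ℕ r
        c = G.coordinates (f h′)

        h≡lin : h ≡ H.lin (λ j → t * (toℕ (k j) * L j)) X
        h≡lin = sym (H.lin-* t (λ j → toℕ (k j) * L j) X)

        fh≡lin : f h ≡ G.lin (λ j → t * c j) G.basis
        fh≡lin = begin
          f (t H.· h′)                        ≡⟨ ·-homo ∙-homo t h′ ⟩
          t G.· f h′                          ≡⟨ cong (t G.·_) (G.lin-coordinates (f h′)) ⟨
          t G.· G.lin c G.basis               ≡⟨ G.lin-* t c G.basis ⟨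
          G.lin (λ j → t * c j) G.basis       ∎

        qh≡ε : q H.· h ≡ H.ε
        qh≡ε = begin
          q H.· h                                                ≡⟨ cong (q H.·_) h≡lin ⟩
          q H.· H.lin (λ j → t * (toℕ (k j) * L j)) X            ≡⟨ H.lin-* q (λ j → t * (toℕ (k j) * L j)) X ⟨
          H.lin (λ j → q * (t * (toℕ (k j) * L j))) X            ≡⟨ H.lin-ε (λ j → q * (t * (toℕ (k j) * L j))) X (λ j →
                                                                      H.∣-annihilates {E j} {q * (t * (toℕ (k j) * L j))}
                                                                        (H.annihilates (position i j)) (E∣ j)) ⟩
          H.ε                                                    ∎
          where
          E∣ : ∀ j → E j ∣ q * (t * (toℕ (k j) * L j))
          E∣ j = ∣-trans (E∣Lqt j) (divides (toℕ (k j))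
            (solve 4 (λ q t k l → q :* (t :* (k :* l)) := k :* (l :* (q :* t))) refl q t (toℕ (k j)) (L j)))

        killed : ∀ j → d j ∣ q * (t * c j)
        killed = G.relation⇒∣ (λ j → q * (t * c j)) (begin
          G.lin (λ j → q * (t * c j)) G.basis       ≡⟨ G.lin-* q (λ j → t * c j) G.basis ⟩
          q G.· G.lin (λ j → t * c j) G.basis       ≡⟨ cong (q G.·_) fh≡lin ⟨
          q G.· f h                                 ≡⟨ ·-homo ∙-homo q h ⟨
          f (q H.· h)                               ≡⟨ cong f qh≡ε ⟩
          f H.ε                                     ≡⟨ ε-homo ∙-homo ⟩
          G.ε                                       ∎)

        z : Fin r → ℕ
        z j = _∣_.quotient (killed j)

      module _ (1<q : 1 < q) where
        instance
          _ : NonZero q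
          _ = ℕ.>-nonZero (ℕ.<⇒≤ 1<q)

        code : Vector (Fin q) (suc s) → Vector (Fin q) s
        -- As `t * c k j` equals z k j * d j / q, its class modulo `d j` depends only on `z k j`
        -- modulo `q`. At positions up to `i` it is a multiple of `d j` anyway, so `s` residues
        -- determine the image, whereas `k` has `s + 1` free entries.
        code k j = residue q (z k (position i (suc j)))

        tc≡ : ∀ k k′ → (∀ j → code k j ≡ code k′ j) → ∀ j → Congruent (d j) (t * c k j) (t * c k′ j)
        tc≡ k k′ eq j = [ low , (λ (j′ , j≡) → subst C (sym j≡) (high j′)) ]′ (position-cover i j)
          where
          C : Fin r → Set
          C j = Congruent (d j) (t * c k j) (t * c k′ j)

          low : ∀ {j} → j Fin.≤ i → C j
          low {j} j≤i = multiples⇒congruent (∣m⇒∣m*n (c k j) (chain-d j≤i)) (∣m⇒∣m*n (c k′ j) (chain-d j≤i))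

          high : ∀ j′ → C (position i (suc j′))
          high j′ = let j = position i (suc j′) in
            quotients⇒congruent {q} {d j} {t * c k j} {t * c k′ j} {z k j} {z k′ j}
              (_∣_.equality (killed k j)) (_∣_.equality (killed k′ j))
              (trans (sym (toℕ-residue q (z k j))) (trans (cong toℕ (eq j′)) (toℕ-residue q (z k′ j))))

        h≡⇒ : ∀ {k k′} → h k ≡ h k′ → ∀ j → k j ≡ k′ j
        h≡⇒ {k} {k′} eq j = Fin.toℕ-injective (∣∣-<⇒≡ (Fin.toℕ<n (k j)) (Fin.toℕ<n (k′ j)) q∣)
          where
          a b : Vector ℕ (suc s)
          a j = t * (toℕ (k j) * L j)
          b j = t * (toℕ (k′ j) * L j)

          E∣ : E j ∣ ∣ a j - b j ∣
          E∣ = congruent⇒∣ (subst₂ (Congruent (E j)) (extend-position i a j) (extend-position i b j)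
            (H.lin≡⇒congruent (extend i a) (extend i b) (begin
              H.lin (extend i a) H.basis      ≡⟨ lin-extend H i a H.basis ⟩
              H.lin a X                       ≡⟨ h≡lin k ⟨
              h k                             ≡⟨ eq ⟩
              h k′                            ≡⟨ h≡lin k′ ⟩
              H.lin b X                       ≡⟨ lin-extend H i b H.basis ⟨
              H.lin (extend i b) H.basis      ∎) (position i j)))

          t∣ : t ∣ ∣ a j - b j ∣
          t∣ = subst (t ∣_) (ℕ.*-distribˡ-∣-∣ t (toℕ (k j) * L j) (toℕ (k′ j) * L j)) (m∣m*n _)

          q∣ : q ∣ ∣ toℕ (k j) - toℕ (k′ j) ∣
          -- Both `t` and `E j` divide the difference of `a j` and `b j`, hence so does their least
          -- common multiple `L j * (q * t)`; the factor `L j * t` then cancels. Since `k j` and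
          -- `k′ j` are below `q`, they agree.
          q∣ = *-cancelˡ-∣ (L j * t) {{ℕ.m*n≢0⇒m≢0 (L j * t) {{subst NonZero reorder (Lq≢0 j)}}}}
            (subst₂ _∣_ reorder ∣a-b∣ (Lqt-least j t∣ E∣))
            where
            reorder : L j * (q * t) ≡ L j * t * q
            reorder = solve 3 (λ l q t → l :* (q :* t) := l :* t :* q) refl (L j) q t

            ∣a-b∣ : ∣ a j - b j ∣ ≡ L j * t * ∣ toℕ (k j) - toℕ (k′ j) ∣
            ∣a-b∣ = begin
              ∣ a j - b j ∣                                         ≡⟨ ℕ.*-distribˡ-∣-∣ t (toℕ (k j) * L j) (toℕ (k′ j) * L j) ⟨
              t * ∣ toℕ (k j) * L j - toℕ (k′ j) * L j ∣            ≡⟨ cong (t *_) (ℕ.*-distribʳ-∣-∣ (L j) (toℕ (k j)) (toℕ (k′ j))) ⟨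
              t * (∣ toℕ (k j) - toℕ (k′ j) ∣ * L j)                ≡⟨ solve 3 (λ t a l → t :* (a :* l) := l :* t :* a) refl t ∣ toℕ (k j) - toℕ (k′ j) ∣ (L j) ⟩
              L j * t * ∣ toℕ (k j) - toℕ (k′ j) ∣                  ∎

    torsion-count : 1 < q → ⊥
    torsion-count 1<q = function-pigeonhole s 1<q (code 1<q) λ {k} {k′} eq → h≡⇒ 1<q (injective (begin
      f (h k)                                 ≡⟨ fh≡lin k ⟩
      G.lin (λ j → t * c k j) G.basis         ≡⟨ G.congruent⇒lin≡ (λ j → t * c k j) (λ j → t * c k′ j) (tc≡ 1<q k k′ eq) ⟩
      G.lin (λ j → t * c k′ j) G.basis        ≡⟨ fh≡lin k′ ⟨
      f (h k′)                                ∎))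

  -- Writing lcm (d i) (e i) as q * d i, the task is to show q = 1. The chain condition on `e` makes
  -- this number divide lcm (d i) (e j) for every j from i on, with quotients `L j`, so
  -- `torsion-count` excludes q > 1; q = 0 would make the least common multiple zero.
  ≲⇒∣ : ∀ {H : FinGroup m} {G : FinGroup n} {e d : Vector ℕ r} → HasType H e → HasType G d →
    Chain e → Chain d → H ≲ G → ∀ i → e i ∣ d i
  ≲⇒∣ {e = e} {d} TH TG chain-e chain-d H≲G i = go (_∣_.quotient t∣K) (_∣_.equality t∣K)
    where
    t = d i
    E : Fin (suc (above i)) → ℕ
    E j = e (position i j)
    t∣K = m∣lcm[m,n] t (e i)

    K∣ : ∀ j → lcm t (e i) ∣ lcm t (E j)
    K∣ j = lcm-least (m∣lcm[m,n] t (E j)) (∣-trans (chain-e (≤-position i j)) (n∣lcm[m,n] t (E j)))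

    lcm≢0 : ∀ j → NonZero (lcm t (E j))
    lcm≢0 j = ℕ.≢-nonZero λ eq →
      ℕ.<⇒≢ (ℕ.*-mono-≤ (HasType.positive TG i) (HasType.positive TH (position i j))) (begin
        0                               ≡⟨ ℕ.*-zeroʳ (gcd t (E j)) ⟨
        gcd t (E j) * 0                 ≡⟨ cong (gcd t (E j) *_) eq ⟨
        gcd t (E j) * lcm t (E j)       ≡⟨ gcd*lcm t (E j) ⟩
        t * E j                         ∎)
      where open ≡-Reasoning

    go : ∀ q → lcm t (e i) ≡ q * t → e i ∣ t
    go q lcm≡qt with q ℕ.≤? 1
    ... | no q≰1 = ⊥-elim (torsion-count TH TG chain-d H≲G i q (λ j → _∣_.quotient (K∣ j))
            (λ j → subst NonZero (K≡ j) (lcm≢0 j))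
            (λ j → subst (E j ∣_) (K≡ j) (n∣lcm[m,n] t (E j)))
            (λ j t∣x E∣x → subst (_∣ _) (K≡ j) (lcm-least t∣x E∣x))
            (ℕ.≰⇒> q≰1))
      where
      K≡ : ∀ j → lcm t (E j) ≡ _∣_.quotient (K∣ j) * (q * t)
      K≡ j = trans (_∣_.equality (K∣ j)) (cong (_∣_.quotient (K∣ j) *_) lcm≡qt)
    ... | yes q≤1 = ∣-trans (n∣lcm[m,n] t (e i)) (subst (_∣ t) (sym lcm≡qt) (q*t∣t q q≤1 lcm≡qt))
      where
      q*t∣t : ∀ q → q ≤ 1 → lcm t (e i) ≡ q * t → q * t ∣ t
      q*t∣t zero _ eq = contradiction eq (ℕ.≢-nonZero⁻¹ _ {{subst (λ j → NonZero (lcm t (e j))) (position-zero i) (lcm≢0 zero)}})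
        where
        position-zero : ∀ {r} (i : Fin r) → position i zero ≡ i
        position-zero zero    = refl
        position-zero (suc i) = cong suc (position-zero i)
      q*t∣t (suc zero) _ _ = ∣-reflexive (ℕ.*-identityˡ t)
      q*t∣t (suc (suc _)) (s≤s ()) _

  -- A `Subset` is a vector of Booleans, whereas membership in a span asserts the existence of
  -- coefficients; this bridges the two in `rank⇒spanning`.
  ¬¬-decide : ∀ {n} (P : Fin n → Set) → ¬ ¬ (∀ i → Dec (P i))
  ¬¬-decide {zero}  P k = k λ ()
  ¬¬-decide {suc n} P k = ¬¬-excluded-middle λ P₀? → ¬¬-decide (P ∘ suc) λ P? →
    k λ { zero → P₀? ; (suc i) → P? i }

  -- The default `a` fills the places left over, so the tuple has length exactly `r` even when `T`
  -- is smaller.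
  enumerate : ∀ {A : Set} (T : Subset n) (ι : Fin n → A) → A → card T ≤ r →
    ∃ λ (x : Vector A r) → ∀ {i} → i ∈ T → ∃ λ j → x j ≡ ι i
  enumerate Vec.[] ι a _ = (λ _ → a) , λ ()
  enumerate (outside Vec.∷ T) ι a le = let x , covers = enumerate T (ι ∘ suc) a le in
    x , λ { {suc i} (Vec.there i∈) → covers i∈ }
  enumerate {r = suc r} (inside Vec.∷ T) ι a (s≤s le) = let x , covers = enumerate T (ι ∘ suc) a le in
    ι zero ∷ x , λ { {zero} Vec.here → zero , refl
                   ; {suc i} (Vec.there i∈) → let j , eq = covers i∈ in suc j , eq }

  rank⇒spanning : ∀ {G : FinGroup n} → IsAbelian G → RankAtMost G r → ¬ ¬ ∃ λ (x : Vector (Fin n) r) → ∀ g → Multiples.Span G x g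
  rank⇒spanning {n = n} {G = G} comm (T , generates , card≤r) k with enumerate T id (FinGroup.ε G) card≤r
  ... | x , covers = ¬¬-decide (Span x) λ span? → k (x , spans span?)
    where
    open Abelian G comm
    module _ (span? : ∀ g → Dec (Span x g)) where
      S : Subset n
      S = tabulate λ g → does (span? g)

      ∈S : ∀ {g} → Span x g → g ∈ S
      ∈S {g} s = lookup⇒[]= g S (trans (lookup∘tabulate _ g) (dec-true (span? g) s))
        where open import Relation.Nullary.Decidable using (dec-true)

      ∈S⁻ : ∀ {g} → g ∈ S → Span x g
      ∈S⁻ {g} g∈ with span? g | trans (sym (lookup∘tabulate (λ g → does (span? g)) g)) ([]=⇒lookup g∈)
      ... | yes s | _ = s

      spans : ∀ g → Span x g
      spans g = ∈S⁻ (generates S record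
        { ∙-closed = λ x∈ y∈ → ∈S (span-∙ (∈S⁻ x∈) (∈S⁻ y∈)) ; ε-closed = ∈S span-ε ; ⁻¹-closed = λ x∈ → ∈S (span-⁻¹ (∈S⁻ x∈)) }
        (λ i∈T → let j , eq = covers i∈T in ∈S (subst (Span x) eq (span-elem j))) g)

  classify : ∀ {G : FinGroup n} → IsAbelian G → RankAtMost G r → ¬ ¬ ∃ λ d → Chain d × HasType {r = r} G d
  classify comm rank k = rank⇒spanning comm rank λ (x , spans) → spanning⇒type comm x spans k

  members : Vector (Fin n) r → Subset n
  members {r = zero}  x = Subset.⊥
  members {r = suc r} x = ⁅ x zero ⁆ ∪ members (x ∘ suc)

  card-∪ : ∀ (p q : Subset n) → card (p ∪ q) ≤ card p + card q
  card-∪ Vec.[] Vec.[] = z≤n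
  card-∪ (outside Vec.∷ p) (outside Vec.∷ q) = card-∪ p q
  card-∪ (outside Vec.∷ p) (inside  Vec.∷ q) = ℕ.≤-trans (s≤s (card-∪ p q)) (ℕ.≤-reflexive (sym (ℕ.+-suc _ _)))
  card-∪ (inside  Vec.∷ p) (outside Vec.∷ q) = s≤s (card-∪ p q)
  card-∪ (inside  Vec.∷ p) (inside  Vec.∷ q) = s≤s (ℕ.≤-trans (card-∪ p q) (ℕ.+-monoʳ-≤ (card p) (ℕ.n≤1+n _)))

  card-members : ∀ (x : Vector (Fin n) r) → card (members x) ≤ r
  card-members {n} {zero}  x = ℕ.≤-reflexive (Subset.∣⊥∣≡0 n)
  card-members {n} {suc r} x = ℕ.≤-trans (card-∪ ⁅ x zero ⁆ (members (x ∘ suc)))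
    (ℕ.+-mono-≤ (ℕ.≤-reflexive (Subset.∣⁅x⁆∣≡1 (x zero))) (card-members (x ∘ suc)))

  ∈-members : ∀ (x : Vector (Fin n) r) i → x i ∈ members x
  ∈-members x zero    = Subset.x∈p∪q⁺ (inj₁ (Subset.x∈⁅x⁆ (x zero)))
  ∈-members x (suc i) = Subset.x∈p∪q⁺ {p = ⁅ x zero ⁆} (inj₂ (∈-members (x ∘ suc) i))

  type⇒rank : ∀ {G : FinGroup n} {d : Vector ℕ r} → HasType G d → RankAtMost G r
  type⇒rank {n = n} {G = G} TG = members basis , generates , card-members basis
    where
    open HasType TG
    module _ (S : Subset n) (isSubgroup : IsSubgroup G S) where
      open IsSubgroup isSubgroup
      lin∈ : ∀ {r} (c : Vector ℕ r) x → (∀ i → x i ∈ S) → lin c x ∈ S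
      lin∈ {zero}  c x x∈ = ε-closed
      lin∈ {suc r} c x x∈ = ∙-closed (multiple (c zero)) (lin∈ (c ∘ suc) (x ∘ suc) (x∈ ∘ suc))
        where
        multiple : ∀ k → k · x zero ∈ S
        multiple zero    = ε-closed
        multiple (suc k) = ∙-closed (x∈ zero) (multiple k)

    generates : Generates G (members basis)
    generates S isSubgroup ⊆S g = subst (_∈ S) (lin-coordinates g)
      (lin∈ S isSubgroup (coordinates g) basis λ i → ⊆S (∈-members basis i))

-- Every type is realised by a product of cyclic groups

module Realisation where
  open import Defs using (FinGroup; IsAbelian)
  open import Algebra.Structures using (IsGroup)
  open import Data.Fin.Base as Fin using (Fin; zero; suc; toℕ; combine; remQuot)
  import Data.Fin.Properties as Fin
  open import Data.Nat.Base as ℕ using (ℕ; zero; suc; _+_; _*_; _≤_)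
  import Data.Nat.Properties as ℕ
  open import Data.Nat.Divisibility
  open import Data.Nat.DivMod using (_%_; m<n⇒m%n≡m; %-distribˡ-+; m*n%n≡0)
  open import Data.Product.Base using (∃; _,_; proj₁; proj₂)
  open import Data.Vec.Functional as Vector using (Vector; _∷_)
  open import Function.Base using (_∘_)
  open import Relation.Binary.PropositionalEquality hiding ([_])
  open AbelianGroups
  open Types
  open Embeddings using (residue; toℕ-residue)

  private variable
    m n r : ℕ

  ∏ : Vector ℕ r → ℕ
  ∏ {zero}  d = 1
  ∏ {suc r} d = d zero * ∏ (d ∘ suc)

  mkGroup : (_∙_ : Fin n → Fin n → Fin n) (ε : Fin n) (_⁻¹ : Fin n → Fin n) →
    (∀ x y z → ((x ∙ y) ∙ z) ≡ (x ∙ (y ∙ z))) → (∀ x → (ε ∙ x) ≡ x) → (∀ x → (x ∙ ε) ≡ x) →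
    (∀ x → ((x ⁻¹) ∙ x) ≡ ε) → (∀ x → (x ∙ (x ⁻¹)) ≡ ε) → FinGroup n
  mkGroup _∙_ ε _⁻¹ assoc idˡ idʳ invˡ invʳ = record
    { _∙_ = _∙_ ; ε = ε ; _⁻¹ = _⁻¹
    ; isGroup = record
      { isMonoid = record
        { isSemigroup = record
          { isMagma = record { isEquivalence = isEquivalence ; ∙-cong = cong₂ _∙_ }
          ; assoc = assoc }
        ; identity = idˡ , idʳ }
      ; inverse = invˡ , invʳ
      ; ⁻¹-cong = cong _⁻¹ } }

  record IsCyclic (G : FinGroup n) : Set where
    open Multiples G
    field
      comm      : IsAbelian G
      generator : Fin n
      generates : ∀ g → ∃ λ k → k · generator ≡ g
      order     : n · generator ≡ ε
      order∣    : ∀ k → k · generator ≡ ε → n ∣ k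

  module Cyclic (k : ℕ) where
    N = suc k
    open ≡-Reasoning

    _∙_ : Fin N → Fin N → Fin N
    x ∙ y = residue N (toℕ x + toℕ y)

    residue-cong : ∀ a b → a % N ≡ b % N → residue N a ≡ residue N b
    residue-cong a b eq = Fin.toℕ-injective (trans (toℕ-residue N a) (trans eq (sym (toℕ-residue N b))))

    residue-toℕ : ∀ x → residue N (toℕ x) ≡ x
    residue-toℕ x = Fin.toℕ-injective (trans (toℕ-residue N (toℕ x)) (m<n⇒m%n≡m (Fin.toℕ<n x)))

    residue-∙ : ∀ a b → residue N a ∙ residue N b ≡ residue N (a + b)
    residue-∙ a b = residue-cong (toℕ (residue N a) + toℕ (residue N b)) (a + b) (begin
      (toℕ (residue N a) + toℕ (residue N b)) % N    ≡⟨ cong₂ (λ x y → (x + y) % N) (toℕ-residue N a) (toℕ-residue N b) ⟩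
      (a % N + b % N) % N                            ≡⟨ %-distribˡ-+ a b N ⟨
      (a + b) % N                                    ∎)

    assoc : ∀ x y z → (x ∙ y) ∙ z ≡ x ∙ (y ∙ z)
    assoc x y z = begin
      residue N (toℕ x + toℕ y) ∙ z                        ≡⟨ cong (residue N (toℕ x + toℕ y) ∙_) (residue-toℕ z) ⟨
      residue N (toℕ x + toℕ y) ∙ residue N (toℕ z)        ≡⟨ residue-∙ (toℕ x + toℕ y) (toℕ z) ⟩
      residue N (toℕ x + toℕ y + toℕ z)                    ≡⟨ cong (residue N) (ℕ.+-assoc (toℕ x) (toℕ y) (toℕ z)) ⟩
      residue N (toℕ x + (toℕ y + toℕ z))                  ≡⟨ residue-∙ (toℕ x) (toℕ y + toℕ z) ⟨
      residue N (toℕ x) ∙ residue N (toℕ y + toℕ z)        ≡⟨ cong (_∙ (y ∙ z)) (residue-toℕ x) ⟩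
      x ∙ (y ∙ z)                                          ∎

    comm : ∀ x y → x ∙ y ≡ y ∙ x
    comm x y = cong (residue N) (ℕ.+-comm (toℕ x) (toℕ y))

    identityˡ : ∀ x → zero ∙ x ≡ x
    identityˡ = residue-toℕ

    _⁻¹ : Fin N → Fin N
    -- Since k = N - 1, multiplication by `k` is negation modulo `N`.
    x ⁻¹ = residue N (k * toℕ x)

    inverseʳ : ∀ x → x ∙ (x ⁻¹) ≡ zero
    inverseʳ x = begin
      x ∙ residue N (k * toℕ x)                        ≡⟨ cong (_∙ residue N (k * toℕ x)) (residue-toℕ x) ⟨
      residue N (toℕ x) ∙ residue N (k * toℕ x)        ≡⟨ residue-∙ (toℕ x) (k * toℕ x) ⟩
      residue N (N * toℕ x)                            ≡⟨ residue-cong (N * toℕ x) 0 (trans (cong (_% N) (ℕ.*-comm N (toℕ x))) (m*n%n≡0 (toℕ x) N)) ⟩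
      zero                                             ∎

    cyclic : FinGroup N
    cyclic = mkGroup _∙_ zero _⁻¹ assoc identityˡ (λ x → trans (comm x zero) (identityˡ x))
      (λ x → trans (comm (x ⁻¹) x) (inverseʳ x)) inverseʳ

    open Multiples cyclic using (_·_)

    ·-residue : ∀ a → a · residue N 1 ≡ residue N a
    ·-residue zero    = refl
    ·-residue (suc a) = trans (cong (residue N 1 ∙_) (·-residue a)) (residue-∙ 1 a)

    isCyclic : IsCyclic cyclic
    isCyclic = record
      { comm = comm
      ; generator = residue N 1
      ; generates = λ g → toℕ g , trans (·-residue (toℕ g)) (residue-toℕ g)
      ; order = trans (·-residue N) (residue-cong N 0 (trans (cong (_% N) (sym (ℕ.*-identityˡ N))) (m*n%n≡0 1 N)))
      ; order∣ = λ a eq → m%n≡0⇒n∣m a N (trans (sym (toℕ-residue N a)) (cong toℕ (trans (sym (·-residue a)) eq)))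
      }

  module _ (H : FinGroup m) (G : FinGroup n) where
    private
      module H = FinGroup H
      module G = FinGroup G
      module HG = IsGroup H.isGroup
      module GG = IsGroup G.isGroup

    π₁ : Fin (m * n) → Fin m
    π₁ x = proj₁ (remQuot {m} n x)

    π₂ : Fin (m * n) → Fin n
    π₂ x = proj₂ (remQuot {m} n x)

    π₁-combine : ∀ (h : Fin m) (g : Fin n) → π₁ (combine h g) ≡ h
    π₁-combine h g = cong proj₁ (Fin.remQuot-combine h g)

    π₂-combine : ∀ (h : Fin m) (g : Fin n) → π₂ (combine h g) ≡ g
    π₂-combine h g = cong proj₂ (Fin.remQuot-combine h g)

    π-injective : ∀ {x y} → π₁ x ≡ π₁ y → π₂ x ≡ π₂ y → x ≡ y
    π-injective {x} {y} eq₁ eq₂ = trans (sym (Fin.combine-remQuot {m} n x)) (trans (cong₂ combine eq₁ eq₂) (Fin.combine-remQuot {m} n y))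

    private
      _∙_ : Fin (m * n) → Fin (m * n) → Fin (m * n)
      x ∙ y = combine (π₁ x H.∙ π₁ y) (π₂ x G.∙ π₂ y)

      ε : Fin (m * n)
      ε = combine H.ε G.ε

      _⁻¹ : Fin (m * n) → Fin (m * n)
      x ⁻¹ = combine (π₁ x H.⁻¹) (π₂ x G.⁻¹)

    π₁-homo : ∀ x y → π₁ (x ∙ y) ≡ π₁ x H.∙ π₁ y
    π₁-homo x y = π₁-combine (π₁ x H.∙ π₁ y) (π₂ x G.∙ π₂ y)

    π₂-homo : ∀ x y → π₂ (x ∙ y) ≡ π₂ x G.∙ π₂ y
    π₂-homo x y = π₂-combine (π₁ x H.∙ π₁ y) (π₂ x G.∙ π₂ y)

    private
      π₁-ε : π₁ ε ≡ H.ε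
      π₁-ε = π₁-combine H.ε G.ε

      π₂-ε : π₂ ε ≡ G.ε
      π₂-ε = π₂-combine H.ε G.ε

      π₁-⁻¹ : ∀ x → π₁ (x ⁻¹) ≡ π₁ x H.⁻¹
      π₁-⁻¹ x = π₁-combine (π₁ x H.⁻¹) (π₂ x G.⁻¹)

      π₂-⁻¹ : ∀ x → π₂ (x ⁻¹) ≡ π₂ x G.⁻¹
      π₂-⁻¹ x = π₂-combine (π₁ x H.⁻¹) (π₂ x G.⁻¹)

    product : FinGroup (m * n)
    product = mkGroup _∙_ ε _⁻¹
      (λ x y z → π-injective
        (trans (trans (π₁-homo (x ∙ y) z) (cong (H._∙ π₁ z) (π₁-homo x y)))
          (trans (HG.assoc (π₁ x) (π₁ y) (π₁ z)) (sym (trans (π₁-homo x (y ∙ z)) (cong (π₁ x H.∙_) (π₁-homo y z))))))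
        (trans (trans (π₂-homo (x ∙ y) z) (cong (G._∙ π₂ z) (π₂-homo x y)))
          (trans (GG.assoc (π₂ x) (π₂ y) (π₂ z)) (sym (trans (π₂-homo x (y ∙ z)) (cong (π₂ x G.∙_) (π₂-homo y z)))))))
      (λ x → π-injective
        (trans (π₁-homo ε x) (trans (cong (H._∙ π₁ x) π₁-ε) (HG.identityˡ (π₁ x))))
        (trans (π₂-homo ε x) (trans (cong (G._∙ π₂ x) π₂-ε) (GG.identityˡ (π₂ x)))))
      (λ x → π-injective
        (trans (π₁-homo x ε) (trans (cong (π₁ x H.∙_) π₁-ε) (HG.identityʳ (π₁ x))))
        (trans (π₂-homo x ε) (trans (cong (π₂ x G.∙_) π₂-ε) (GG.identityʳ (π₂ x)))))
      (λ x → π-injective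
        (trans (π₁-homo (x ⁻¹) x) (trans (cong (H._∙ π₁ x) (π₁-⁻¹ x)) (trans (HG.inverseˡ (π₁ x)) (sym π₁-ε))))
        (trans (π₂-homo (x ⁻¹) x) (trans (cong (G._∙ π₂ x) (π₂-⁻¹ x)) (trans (GG.inverseˡ (π₂ x)) (sym π₂-ε)))))
      (λ x → π-injective
        (trans (π₁-homo x (x ⁻¹)) (trans (cong (π₁ x H.∙_) (π₁-⁻¹ x)) (trans (HG.inverseʳ (π₁ x)) (sym π₁-ε))))
        (trans (π₂-homo x (x ⁻¹)) (trans (cong (π₂ x G.∙_) (π₂-⁻¹ x)) (trans (GG.inverseʳ (π₂ x)) (sym π₂-ε)))))

  module _ {H : FinGroup m} {G : FinGroup n} (CH : IsCyclic H) {d : Vector ℕ (suc r)} (d₀≡m : d zero ≡ m) (1≤m : 1 ≤ m) (TG : HasType G (d ∘ suc)) where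
    private
      module CH = IsCyclic CH
      module TG = HasType TG
      module H = Multiples H
      module G = Multiples G
      module P = Multiples (product H G)
      module π₁ = Homomorphisms (product H G) H
      module π₂ = Homomorphisms (product H G) G

      basis : Vector (Fin (m * n)) (suc r)
      basis zero    = combine CH.generator G.ε
      basis (suc i) = combine H.ε (TG.basis i)

      π₁-basis₀ : π₁ H G (basis zero) ≡ CH.generator
      π₁-basis₀ = π₁-combine H G CH.generator G.ε

      π₂-basis₀ : π₂ H G (basis zero) ≡ G.ε
      π₂-basis₀ = π₂-combine H G CH.generator G.ε

      π₁-basis : ∀ i → π₁ H G (basis (suc i)) ≡ H.ε
      π₁-basis i = π₁-combine H G H.ε (TG.basis i)

      π₂-basis : ∀ i → π₂ H G (basis (suc i)) ≡ TG.basis i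
      π₂-basis i = π₂-combine H G H.ε (TG.basis i)

      π₁-ε : π₁ H G P.ε ≡ H.ε
      π₁-ε = π₁-combine H G H.ε G.ε

      π₂-ε : π₂ H G P.ε ≡ G.ε
      π₂-ε = π₂-combine H G H.ε G.ε

      π₁-lin : ∀ c → π₁ H G (P.lin c basis) ≡ c zero H.· CH.generator
      π₁-lin c = begin
        π₁ H G (P.lin c basis)             ≡⟨ π₁.lin-homo (π₁-homo H G) c basis ⟩
        H.lin c (π₁ H G ∘ basis)           ≡⟨ cong₂ H._∙_ (cong (c zero H.·_) π₁-basis₀)
                                                (H.lin-ε (c ∘ suc) (π₁ H G ∘ basis ∘ suc) λ i → trans (cong (c (suc i) H.·_) (π₁-basis i)) (H.·-ε (c (suc i)))) ⟩
        c zero H.· CH.generator H.∙ H.ε    ≡⟨ H.identityʳ _ ⟩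
        c zero H.· CH.generator            ∎
        where open ≡-Reasoning

      π₂-lin : ∀ c → π₂ H G (P.lin c basis) ≡ G.lin (c ∘ suc) TG.basis
      π₂-lin c = begin
        π₂ H G (P.lin c basis)                        ≡⟨ π₂.lin-homo (π₂-homo H G) c basis ⟩
        G.lin c (π₂ H G ∘ basis)                      ≡⟨ cong₂ G._∙_ (trans (cong (c zero G.·_) π₂-basis₀) (G.·-ε (c zero)))
                                                           (G.sum-cong-≗ λ i → cong (c (suc i) G.·_) (π₂-basis i)) ⟩
        G.ε G.∙ G.lin (c ∘ suc) TG.basis              ≡⟨ G.identityˡ _ ⟩
        G.lin (c ∘ suc) TG.basis                      ∎
        where open ≡-Reasoning

      annihilates : ∀ i → d i P.· basis i ≡ P.ε
      annihilates zero = π-injective H G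
        (trans (π₁.·-homo (π₁-homo H G) (d zero) (basis zero)) (trans (cong₂ H._·_ d₀≡m π₁-basis₀) (trans CH.order (sym π₁-ε))))
        (trans (π₂.·-homo (π₂-homo H G) (d zero) (basis zero)) (trans (cong (d zero G.·_) π₂-basis₀) (trans (G.·-ε (d zero)) (sym π₂-ε))))
      annihilates (suc i) = π-injective H G
        (trans (π₁.·-homo (π₁-homo H G) (d (suc i)) (basis (suc i))) (trans (cong (d (suc i) H.·_) (π₁-basis i)) (trans (H.·-ε (d (suc i))) (sym π₁-ε))))
        (trans (π₂.·-homo (π₂-homo H G) (d (suc i)) (basis (suc i))) (trans (cong (d (suc i) G.·_) (π₂-basis i)) (trans (TG.annihilates i) (sym π₂-ε))))

      relation⇒∣ : ∀ c → P.lin c basis ≡ P.ε → ∀ i → d i ∣ c i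
      relation⇒∣ c eq zero    = subst (_∣ c zero) (sym d₀≡m) (CH.order∣ (c zero) (trans (sym (π₁-lin c)) (trans (cong (π₁ H G) eq) π₁-ε)))
      relation⇒∣ c eq (suc i) = TG.relation⇒∣ (c ∘ suc) (trans (sym (π₂-lin c)) (trans (cong (π₂ H G) eq) π₂-ε)) i

    cyclic-product : HasType (product H G) d
    cyclic-product = record
      { comm = λ x y → cong₂ combine (CH.comm (π₁ H G x) (π₁ H G y)) (TG.comm (π₂ H G x) (π₂ H G y))
      ; positive = λ { zero → subst (1 ≤_) (sym d₀≡m) 1≤m ; (suc i) → TG.positive i }
      ; basis = basis
      ; spans = λ x → let k , eq = CH.generates (π₁ H G x) in
          P._,_ (k ∷ TG.coordinates (π₂ H G x)) (π-injective H G
            (trans (π₁-lin (k ∷ TG.coordinates (π₂ H G x))) eq)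
            (trans (π₂-lin (k ∷ TG.coordinates (π₂ H G x))) (TG.lin-coordinates (π₂ H G x))))
      ; independent = record { annihilates = annihilates ; relation⇒∣ = relation⇒∣ }
      }

  realise : ∀ (d : Vector ℕ r) → Positive d → ∃ λ (G : FinGroup (∏ d)) → HasType G d
  realise {zero} d _ = Cyclic.cyclic 0 , record
    { comm = Cyclic.comm 0 ; positive = λ () ; basis = λ ()
    ; spans = λ { zero → Multiples._,_ (λ ()) refl }
    ; independent = record { annihilates = λ () ; relation⇒∣ = λ _ _ () } }
  realise {suc r} d pos = let G , TG = realise (d ∘ suc) (pos ∘ suc) in go (d zero) refl (pos zero) G TG
    where
    -- The first invariant is abstracted to `m` so that it can be matched as a successor, the form
    -- in which `Cyclic` takes its order.
    go : ∀ m → d zero ≡ m → 1 ≤ m → (G : FinGroup (∏ (d ∘ suc))) → HasType G (d ∘ suc) →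
         ∃ λ (G : FinGroup (m * ∏ (d ∘ suc))) → HasType G d
    go (suc k) eq 1≤m G TG = product (Cyclic.cyclic k) G , cyclic-product (Cyclic.isCyclic k) eq 1≤m TG

  order≡∏ : ∀ {G : FinGroup n} {d : Vector ℕ r} → HasType G d → n ≡ ∏ d
  order≡∏ {d = d} TG = sameType⇒sameOrder TG (proj₂ (realise d (HasType.positive TG)))

-- Codes for pairs of divisibility chains

module Codes where
  open import Data.Fin.Base as Fin using (zero; suc)
  open import Data.List.Base as List using (List; []; _∷_; map; concatMap; filter; cartesianProduct)
  open import Data.List.Membership.Propositional using (_∈_)
  open import Data.List.Membership.Propositional.Properties using (∈-++⁺ˡ; ∈-++⁺ʳ; ∈-++⁻; ∈-map⁺; ∈-map⁻; ∈-filter⁺; ∈-filter⁻; ∈-cartesianProduct⁺; ∈-cartesianProduct⁻)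
  open import Data.List.Relation.Unary.All as All using (All; []; _∷_)
  import Data.List.Relation.Unary.All.Properties as All
  open import Data.List.Relation.Unary.AllPairs as AllPairs using (AllPairs; []; _∷_)
  import Data.List.Relation.Unary.AllPairs.Properties as AllPairs
  import Data.List.Relation.Unary.Unique.Propositional.Properties as Unique
  open import Data.List.Relation.Unary.Any using (here; there)
  open import Data.Nat.Base as ℕ using (ℕ; zero; suc; _*_; _^_; _≤_; z≤n; s≤s)
  open import Data.Nat.Divisibility
  import Data.Nat.DivMod as ℕ
  import Data.Nat.Properties as ℕ
  open import Data.Nat.Solver using (module +-*-Solver)
  open import Data.Product.Base using (∃; _×_; _,_; proj₁; proj₂)
  open import Data.Rational.Base as ℚ using (ℚ; 1ℚ)
  import Data.Rational.Properties as ℚ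
  open import Data.Sum.Base using (inj₁; inj₂)
  open import Data.Unit.Base using (⊤; tt)
  open import Data.Vec.Base as Vec using (Vec)
  open import Data.Vec.Functional using (Vector)
  open import Function.Base using (_∘_)
  open import Relation.Binary.PropositionalEquality hiding ([_])
  open FiniteSums
  open AbelianGroups using (Positive; Chain)
  open Realisation using (∏)
  open +-*-Solver using (solve; _:=_; _:*_)

  private variable
    A B : Set

  ∈-concatMap⁺ : ∀ (f : A → List B) {xs x y} → x ∈ xs → y ∈ f x → y ∈ concatMap f xs
  ∈-concatMap⁺ f {xs = x ∷ xs} (here refl) y∈ = ∈-++⁺ˡ y∈
  ∈-concatMap⁺ f {xs = x ∷ xs} (there x∈)  y∈ = ∈-++⁺ʳ (f x) (∈-concatMap⁺ f x∈ y∈)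

  ∈-concatMap⁻ : ∀ (f : A → List B) xs {y} → y ∈ concatMap f xs → ∃ λ x → x ∈ xs × y ∈ f x
  ∈-concatMap⁻ f (x ∷ xs) y∈ with ∈-++⁻ (f x) y∈
  ... | inj₁ y∈fx = x , here refl , y∈fx
  ... | inj₂ y∈′  = let x′ , x′∈ , y∈fx′ = ∈-concatMap⁻ f xs y∈′ in x′ , there x′∈ , y∈fx′

  AllPairs-concatMap : ∀ {R : B → B → Set} (f : A → List B) {xs} → (∀ {x} → x ∈ xs → AllPairs R (f x)) →
    AllPairs (λ x x′ → ∀ {y y′} → y ∈ f x → y′ ∈ f x′ → R y y′) xs → AllPairs R (concatMap f xs)
  AllPairs-concatMap f within []         = []
  AllPairs-concatMap {R = R} f {x ∷ xs} within (x# ∷ xs#) =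
    AllPairs.++⁺ (within (here refl)) (AllPairs-concatMap f (within ∘ there) xs#) (All.tabulate λ y∈ → All.tabulate λ y′∈ →
      let x′ , x′∈ , y′∈fx′ = ∈-concatMap⁻ f xs y′∈ in All.lookup x# x′∈ y∈ y′∈fx′)

  infixl 7 _÷_

  -- y ÷ 0 = 0
  _÷_ : ℕ → ℕ → ℕ
  y ÷ zero  = 0
  y ÷ suc k = y ℕ./ suc k

  ÷-* : ∀ y k → y ÷ k * k ≤ y
  ÷-* y zero    = z≤n
  ÷-* y (suc k) = ℕ.m/n*n≤m y (suc k)

  *≤⇒≤÷ : ∀ {y k m} → 1 ≤ k → k * m ≤ y → m ≤ y ÷ k
  *≤⇒≤÷ {y} {suc k} {m} _ le = subst (_≤ y ℕ./ suc k) (trans (cong (ℕ._/ suc k) (ℕ.*-comm (suc k) m)) (ℕ.m*n/n≡m m (suc k)))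
    (ℕ./-monoˡ-≤ (suc k) le)

  ≤÷⇒*≤ : ∀ {y k m} → m ≤ y ÷ k → k * m ≤ y
  ≤÷⇒*≤ {y} {k} {m} le = ℕ.≤-trans (ℕ.*-monoʳ-≤ k le) (ℕ.≤-trans (ℕ.≤-reflexive (ℕ.*-comm k (y ÷ k))) (÷-* y k))

  ≤-*-trans : ∀ {m n o} → 1 ≤ n → m * n ≤ o → m ≤ o
  ≤-*-trans {m} 1≤n le = ℕ.≤-trans (ℕ.≤-trans (ℕ.≤-reflexive (sym (ℕ.*-identityʳ m))) (ℕ.*-monoʳ-≤ m 1≤n)) le

  1≤*⇒1≤ˡ : ∀ m {n} → 1 ≤ m * n → 1 ≤ m
  1≤*⇒1≤ˡ (suc m) _ = s≤s z≤n

  1≤*⇒1≤ʳ : ∀ m {n} → 1 ≤ m * n → 1 ≤ n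
  1≤*⇒1≤ʳ m {n} le = 1≤*⇒1≤ˡ n (subst (1 ≤_) (ℕ.*-comm m n) le)

  factorings : ℕ → List (ℕ × ℕ)
  factorings n = filter (λ (b , q) → b * q ℕ.≟ n) (cartesianProduct (range n) (range n))

  ∈-factorings⁺ : ∀ {n b q} → 1 ≤ n → b * q ≡ n → (b , q) ∈ factorings n
  ∈-factorings⁺ {n} {b} {q} 1≤n bq≡n = ∈-filter⁺ (λ (b , q) → b * q ℕ.≟ n) (∈-cartesianProduct⁺
    (∈-range⁺ 1≤b (≤-*-trans 1≤q (ℕ.≤-reflexive bq≡n)))
    (∈-range⁺ 1≤q (≤-*-trans 1≤b (ℕ.≤-reflexive (trans (ℕ.*-comm q b) bq≡n))))) bq≡n
    where
    1≤bq = subst (1 ≤_) (sym bq≡n) 1≤n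
    1≤b = 1≤*⇒1≤ˡ b 1≤bq
    1≤q = 1≤*⇒1≤ʳ b 1≤bq

  ∈-factorings⁻ : ∀ {n b q} → (b , q) ∈ factorings n → b * q ≡ n × 1 ≤ b × 1 ≤ q
  ∈-factorings⁻ {n} p = let ∈× , eq = ∈-filter⁻ (λ (b , q) → b * q ℕ.≟ n) {xs = cartesianProduct (range n) (range n)} p
                            b∈ , q∈ = ∈-cartesianProduct⁻ (range n) (range n) ∈×
    in eq , proj₁ (∈-range⁻ b∈) , proj₁ (∈-range⁻ q∈)

  factorings-unique : ∀ n → AllPairs _≢_ (factorings n)
  factorings-unique n = Unique.filter⁺ (λ (b , q) → b * q ℕ.≟ n) (Unique.cartesianProduct⁺ (range-unique n) (range-unique n))

  -- A code (a₁ , b₁) ∷ … ∷ (aₛ , bₛ) stands for the chains dᵢ = a₁ ⋯ aᵢ and eᵢ = b₁ ⋯ bᵢ;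
  -- the parameter c below is the quotient dᵢ / eᵢ reached so far.
  Code : ℕ → Set
  Code = Vec (ℕ × ℕ)

  module _ {s} (a : ℕ) (f : ℕ → List (Code s)) where

    branch : ℕ × ℕ → List (Code (suc s))
    branch (b , q) = map ((a , b) Vec.∷_) (f q)

    branches : ℕ → List (Code (suc s))
    branches n = concatMap branch (factorings n)

    branch-head : ∀ bq {v} → v ∈ branch bq → Vec.head v ≡ (a , proj₁ bq)
    branch-head _ v∈ = let _ , _ , eq = ∈-map⁻ _ v∈ in cong Vec.head eq

    branches-head : ∀ n {v} → v ∈ branches n → proj₁ (Vec.head v) ≡ a
    branches-head n v∈ = let bq , _ , v∈′ = ∈-concatMap⁻ branch (factorings n) v∈ in cong proj₁ (branch-head bq v∈′)

  -- In b * q = c * a the number `q` is the next quotient dᵢ / eᵢ. A chosen `a` divides the current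
  -- dᵢ and all `s` later ones, so it takes a factor `a ^ suc s` out of the bound on the order.
  codes : ∀ s → ℕ → ℕ → List (Code s)
  codes zero    c y = Vec.[] ∷ []
  codes (suc s) c y = concatMap (λ a → branches a (λ q → codes s q (y ÷ a ^ suc s)) (c * a)) (range y)

  -- This is P_s(c; y). It is separated from the list of codes because the estimates use only the
  -- recursion.
  count : ℕ → ℕ → ℕ → ℚ
  count zero    c y = 1ℚ
  count (suc s) c y = sumOver (range y) λ a → sumOver (factorings (c * a)) λ (b , q) → count s q (y ÷ a ^ suc s)

  count≡length : ∀ s c y → count s c y ≡ sumOver (codes s c y) (λ _ → 1ℚ)
  count≡length zero    c y = sym (ℚ.+-identityʳ 1ℚ)
  count≡length (suc s) c y = sym (trans
    (sumOver-concatMap (λ a → branches a (λ q → codes s q (y ÷ a ^ suc s)) (c * a)) (range y) (λ _ → 1ℚ))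
    (sumOver-cong (range y) λ {a} _ → trans
      (sumOver-concatMap (branch a (λ q → codes s q (y ÷ a ^ suc s))) (factorings (c * a)) (λ _ → 1ℚ))
      (sumOver-cong (factorings (c * a)) λ {(b , q)} _ → trans
        (sumOver-map ((a , b) Vec.∷_) (codes s q (y ÷ a ^ suc s)) (λ _ → 1ℚ))
        (sym (count≡length s q (y ÷ a ^ suc s))))))

  Valid : ∀ {s} → ℕ → Code s → Set
  Valid c Vec.[]              = ⊤
  Valid c ((a , b) Vec.∷ v) = 1 ≤ a × ∃ λ q → b * q ≡ c * a × Valid q v

  -- The order of a group of type `dChain 1 v`: each aᵢ is a factor of dᵢ and of all later
  -- invariants. See `∏-dChain`.
  weight : ∀ {s} → Code s → ℕ
  weight Vec.[]                      = 1
  weight {suc s} ((a , b) Vec.∷ v) = a ^ suc s * weight v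

  ratio-positive : ∀ {c a b q} → 1 ≤ c → 1 ≤ a → b * q ≡ c * a → 1 ≤ b × 1 ≤ q
  ratio-positive {b = b} 1≤c 1≤a eq = 1≤*⇒1≤ˡ b 1≤bq , 1≤*⇒1≤ʳ b 1≤bq
    where 1≤bq = subst (1 ≤_) (sym eq) (ℕ.*-mono-≤ 1≤c 1≤a)

  1≤^ : ∀ {a} s → 1 ≤ a → 1 ≤ a ^ s
  1≤^ {a} s 1≤a = ℕ.m^n>0 a {{ℕ.>-nonZero 1≤a}} s

  1≤weight : ∀ {s c} (v : Code s) → Valid c v → 1 ≤ weight v
  1≤weight Vec.[] _ = s≤s z≤n
  1≤weight {suc s} ((a , b) Vec.∷ v) (1≤a , _ , _ , valid) = ℕ.*-mono-≤ (1≤^ (suc s) 1≤a) (1≤weight v valid)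

  ∈-codes⁺ : ∀ {s c y} (v : Code s) → 1 ≤ c → Valid c v → weight v ≤ y → v ∈ codes s c y
  ∈-codes⁺ Vec.[] _ _ _ = here refl
  ∈-codes⁺ {suc s} {c} {y} ((a , b) Vec.∷ v) 1≤c (1≤a , q , eq , valid) le =
    ∈-concatMap⁺ (λ a → branches a (λ q → codes s q (y ÷ a ^ suc s)) (c * a)) (∈-range⁺ 1≤a a≤y)
      (∈-concatMap⁺ (branch a (λ q → codes s q (y ÷ a ^ suc s)))
      (∈-factorings⁺ (ℕ.*-mono-≤ 1≤c 1≤a) eq) (∈-map⁺ _
      (∈-codes⁺ v (proj₂ (ratio-positive {c} {a} {b} 1≤c 1≤a eq)) valid (*≤⇒≤÷ (1≤^ (suc s) 1≤a) le))))
    where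
    a≤y : a ≤ y
    a≤y = ≤-*-trans (1≤^ s 1≤a) (≤-*-trans (1≤weight v valid) le)

  -- The empty code has weight 1 but is listed for every `y`, even 0, hence the condition at length
  -- 0. One level up it is met because the chosen `a` is at most `y`.
  ∈-codes⁻ : ∀ {s c y} (v : Code s) → (s ≡ 0 → 1 ≤ y) → v ∈ codes s c y → Valid c v × weight v ≤ y
  ∈-codes⁻ {y = y} Vec.[] 1≤y _ = tt , 1≤y refl
  ∈-codes⁻ {suc s} {c} {y} (ab Vec.∷ v) _ v∈
    with ∈-concatMap⁻ (λ a → branches a (λ q → codes s q (y ÷ a ^ suc s)) (c * a)) (range y) v∈
  ... | a , a∈ , v∈′ with ∈-concatMap⁻ (branch a (λ q → codes s q (y ÷ a ^ suc s))) (factorings (c * a)) v∈′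
  ...   | (b , q) , bq∈ , v∈″ with ∈-map⁻ _ v∈″
  ...     | v′ , v′∈ , refl =
    let 1≤a , a≤y = ∈-range⁻ a∈
        valid , le = ∈-codes⁻ v′ (λ { refl → *≤⇒≤÷ (1≤^ 1 1≤a) (ℕ.≤-trans (ℕ.≤-reflexive (trans (ℕ.*-identityʳ (a ^ 1)) (ℕ.^-identityʳ a))) a≤y) }) v′∈
    in (1≤a , q , proj₁ (∈-factorings⁻ {c * a} bq∈) , valid) , ≤÷⇒*≤ {k = a ^ suc s} le

  AllPairs-∈ : ∀ {R S : A → A → Set} {xs} → (∀ {x y} → x ∈ xs → y ∈ xs → R x y → S x y) → AllPairs R xs → AllPairs S xs
  AllPairs-∈ f []          = []
  AllPairs-∈ f (x# ∷ xs#) = All.tabulate (λ y∈ → f (here refl) (there y∈) (All.lookup x# y∈)) ∷ AllPairs-∈ (λ x∈ y∈ → f (there x∈) (there y∈)) xs#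

  factoring-unique : ∀ {n b q b′ q′} → (b , q) ∈ factorings n → (b′ , q′) ∈ factorings n → b ≡ b′ → (b , q) ≡ (b′ , q′)
  factoring-unique {n} {b} {q} {b′} {q′} bq∈ bq′∈ refl =
    let bq≡ , 1≤b , _ = ∈-factorings⁻ {n} bq∈ ; bq′≡ , _ = ∈-factorings⁻ {n} bq′∈
    in cong (b ,_) (ℕ.*-cancelˡ-≡ q q′ b {{ℕ.>-nonZero 1≤b}} (trans bq≡ (sym bq′≡)))

  codes-unique : ∀ s c y → AllPairs _≢_ (codes s c y)
  codes-unique zero    c y = [] ∷ []
  codes-unique (suc s) c y = AllPairs-concatMap (λ a → branches a (f a) (c * a))
    (λ {a} _ → AllPairs-concatMap (branch a (f a))
      (λ {(b , q)} _ → Unique.map⁺ (λ { refl → refl }) (codes-unique s q (y ÷ a ^ suc s)))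
      (AllPairs-∈ (λ {bq} {bq′} bq∈ bq′∈ ≢ {v} {v′} v∈ v′∈ v≡v′ → ≢ (factoring-unique {c * a} bq∈ bq′∈ (cong proj₂
        (trans (sym (branch-head a (f a) bq v∈)) (trans (cong Vec.head v≡v′) (branch-head a (f a) bq′ v′∈))))))
        (factorings-unique (c * a))))
    (AllPairs.map (λ {a} {a′} ≢ {v} {v′} v∈ v′∈ v≡v′ → ≢
      (trans (sym (branches-head a (f a) (c * a) v∈)) (trans (cong (proj₁ ∘ Vec.head) v≡v′) (branches-head a′ (f a′) (c * a′) v′∈))))
      (range-unique y))
    where
    f : ℕ → ℕ → List (Code s)
    f a q = codes s q (y ÷ a ^ suc s)

  module _ {A : Set} (π : A → ℕ) where
    partials : ∀ {s} → ℕ → Vec A s → Vector ℕ s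
    partials D (x Vec.∷ v) zero    = D * π x
    partials D (x Vec.∷ v) (suc i) = partials (D * π x) v i

    ∣-partials : ∀ {s} D (v : Vec A s) i → D ∣ partials D v i
    ∣-partials D (x Vec.∷ v) zero    = m∣m*n (π x)
    ∣-partials D (x Vec.∷ v) (suc i) = ∣-trans (m∣m*n (π x)) (∣-partials (D * π x) v i)

    partials-chain : ∀ {s} D (v : Vec A s) → Chain (partials D v)
    partials-chain D (x Vec.∷ v) {zero}  {zero}  _ = ∣-refl
    partials-chain D (x Vec.∷ v) {zero}  {suc j} _ = ∣-partials (D * π x) v j
    partials-chain D (x Vec.∷ v) {suc i} {suc j} (s≤s i≤j) = partials-chain (D * π x) v i≤j

  dChain eChain : ∀ {s} → ℕ → Code s → Vector ℕ s
  dChain = partials proj₁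
  eChain = partials proj₂

  dChain-positive : ∀ {s c} D (v : Code s) → 1 ≤ D → Valid c v → Positive (dChain D v)
  dChain-positive D (_ Vec.∷ v) 1≤D (1≤a , _)             zero    = ℕ.*-mono-≤ 1≤D 1≤a
  dChain-positive D (_ Vec.∷ v) 1≤D (1≤a , _ , _ , valid) (suc i) = dChain-positive _ v (ℕ.*-mono-≤ 1≤D 1≤a) valid i

  eChain-positive : ∀ {s c} E (v : Code s) → 1 ≤ c → 1 ≤ E → Valid c v → Positive (eChain E v)
  eChain-positive {c = c} E (_ Vec.∷ v) 1≤c 1≤E (1≤a , _ , eq , _) zero =
    ℕ.*-mono-≤ 1≤E (proj₁ (ratio-positive {c} 1≤c 1≤a eq))
  eChain-positive {c = c} E (_ Vec.∷ v) 1≤c 1≤E (1≤a , _ , eq , valid) (suc i) = let 1≤b , 1≤q = ratio-positive {c} 1≤c 1≤a eq in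
    eChain-positive _ v 1≤q (ℕ.*-mono-≤ 1≤E 1≤b) valid i

  eChain∣dChain : ∀ {s c} D E (v : Code s) → D ≡ E * c → Valid c v → ∀ i → eChain E v i ∣ dChain D v i
  eChain∣dChain {c = c} D E ((a , b) Vec.∷ v) D≡Ec (1≤a , q , bq≡ca , valid) = λ
    { zero    → divides q (trans Da≡ (ℕ.*-comm (E * b) q))
    ; (suc i) → eChain∣dChain (D * a) (E * b) v Da≡ valid i }
    where
    open ≡-Reasoning
    Da≡ : D * a ≡ E * b * q
    Da≡ = begin
      D * a          ≡⟨ cong (_* a) D≡Ec ⟩
      E * c * a      ≡⟨ ℕ.*-assoc E c a ⟩
      E * (c * a)    ≡⟨ cong (E *_) bq≡ca ⟨
      E * (b * q)    ≡⟨ ℕ.*-assoc E b q ⟨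
      E * b * q      ∎

  ^-distribʳ-* : ∀ s a b → (a * b) ^ s ≡ a ^ s * b ^ s
  ^-distribʳ-* zero    a b = refl
  ^-distribʳ-* (suc s) a b = trans (cong (a * b *_) (^-distribʳ-* s a b))
    (solve 4 (λ a b x y → a :* b :* (x :* y) := a :* x :* (b :* y)) refl a b (a ^ s) (b ^ s))

  ∏-dChain : ∀ {s} D (v : Code s) → ∏ (dChain D v) ≡ D ^ s * weight v
  ∏-dChain D Vec.[] = refl
  ∏-dChain {suc s} D ((a , b) Vec.∷ v) = begin
    D * a * ∏ (dChain (D * a) v)              ≡⟨ cong (D * a *_) (∏-dChain (D * a) v) ⟩
    D * a * ((D * a) ^ s * weight v)          ≡⟨ cong (λ x → D * a * (x * weight v)) (^-distribʳ-* s D a) ⟩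
    D * a * (D ^ s * a ^ s * weight v)        ≡⟨ solve 5 (λ D a x y w → D :* a :* (x :* y :* w) := D :* x :* (a :* y :* w)) refl D a (D ^ s) (a ^ s) (weight v) ⟩
    D ^ suc s * (a ^ suc s * weight v)        ∎
    where open ≡-Reasoning

  -- `D` and `E` are the members of the two chains reached so far, and `D ≡ E * c` keeps `c` equal
  -- to their quotient. Dividing the next members by them gives `a` and `b`; cancelling `E` in E b q
  -- = E c a gives the equation that a valid code demands.
  encode : ∀ {s c} D E (d e : Vector ℕ s) → 1 ≤ D → 1 ≤ E → D ≡ E * c → Positive d →
    (∀ i → D ∣ d i) → (∀ i → E ∣ e i) → Chain d → Chain e → (∀ i → e i ∣ d i) →
    ∃ λ v → Valid c v × (∀ i → dChain D v i ≡ d i) × (∀ i → eChain E v i ≡ e i)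
  encode {zero} _ _ _ _ _ _ _ _ _ _ _ _ _ = Vec.[] , tt , (λ ()) , λ ()
  encode {suc s} {c} D E d e 1≤D 1≤E D≡Ec positive D∣d E∣e chain-d chain-e e∣d
    with D∣d zero | E∣e zero | e∣d zero
  ... | divides a d≡ | divides b e≡ | divides q d≡qe =
    let v , valid , dv , ev = encode {s} {q} (D * a) (E * b) (d ∘ suc) (e ∘ suc) 1≤Da 1≤Eb Da≡Ebq (positive ∘ suc)
          (λ i → subst (_∣ d (suc i)) d₀ (chain-d z≤n)) (λ i → subst (_∣ e (suc i)) e₀ (chain-e z≤n))
          (λ i≤j → chain-d (s≤s i≤j)) (λ i≤j → chain-e (s≤s i≤j)) (e∣d ∘ suc)
    in (a , b) Vec.∷ v , (1≤*⇒1≤ʳ D 1≤Da , q , bq≡ca , valid)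
      , (λ { zero → sym d₀ ; (suc i) → dv i }) , (λ { zero → sym e₀ ; (suc i) → ev i })
    where
    open ≡-Reasoning
    d₀ : d zero ≡ D * a
    d₀ = trans d≡ (ℕ.*-comm a D)
    e₀ : e zero ≡ E * b
    e₀ = trans e≡ (ℕ.*-comm b E)
    1≤Da = subst (1 ≤_) d₀ (positive zero)
    Da≡Ebq : D * a ≡ E * b * q
    Da≡Ebq = trans (sym d₀) (trans d≡qe (trans (cong (q *_) e₀) (ℕ.*-comm q (E * b))))
    1≤Eb = 1≤*⇒1≤ˡ (E * b) (subst (1 ≤_) Da≡Ebq 1≤Da)
    bq≡ca : b * q ≡ c * a
    bq≡ca = ℕ.*-cancelˡ-≡ (b * q) (c * a) E {{ℕ.>-nonZero 1≤E}} (begin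
      E * (b * q)    ≡⟨ ℕ.*-assoc E b q ⟨
      E * b * q      ≡⟨ Da≡Ebq ⟨
      D * a          ≡⟨ cong (_* a) D≡Ec ⟩
      E * c * a      ≡⟨ ℕ.*-assoc E c a ⟩
      E * (c * a)    ∎)

  decode-injective : ∀ {s c} D E (v v′ : Code s) → 1 ≤ c → 1 ≤ D → 1 ≤ E → Valid c v →
    (∀ i → dChain D v i ≡ dChain D v′ i) → (∀ i → eChain E v i ≡ eChain E v′ i) → v ≡ v′
  decode-injective D E Vec.[] Vec.[] _ _ _ _ _ _ = refl
  decode-injective {c = c} D E ((a , b) Vec.∷ v) ((a′ , b′) Vec.∷ v′) 1≤c 1≤D 1≤E (1≤a , q , eq , valid) d≡ e≡
    with ℕ.*-cancelˡ-≡ a a′ D {{ℕ.>-nonZero 1≤D}} (d≡ zero) | ℕ.*-cancelˡ-≡ b b′ E {{ℕ.>-nonZero 1≤E}} (e≡ zero)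
  ... | refl | refl = let 1≤b , 1≤q = ratio-positive {c} 1≤c 1≤a eq in
    cong ((a , b) Vec.∷_) (decode-injective (D * a) (E * b) v v′ 1≤q (ℕ.*-mono-≤ 1≤D 1≤a) (ℕ.*-mono-≤ 1≤E 1≤b) valid (d≡ ∘ suc) (e≡ ∘ suc))

-- Subgroup classes correspond to codes

module Counting where
  open import Defs using (⌜_⌝; FinGroup; IsAbelian; RankAtMost; isAbelian?; rankAtMost?; _≲_; _≲?_; _≅_; _≅?_; groups; groups-complete; groupClasses; summatory; A; ≲⇒mono)
  open import Algebra.Morphism.Structures using (module GroupMorphisms)
  open import Data.Empty using (⊥)
  open import Data.Fin.Base as Fin using (Fin; zero; suc)
  import Data.Fin.Properties as Fin
  open import Data.List.Base as List using (List; []; _∷_; map; concatMap; filter; length; deduplicate; upTo)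
  import Data.List.Properties as List
  open import Data.List.Membership.Propositional using (_∈_; find)
  open import Data.List.Membership.Propositional.Properties using (∈-map⁺; ∈-map⁻; ∈-filter⁺; ∈-filter⁻; ∈-upTo⁺; ∈-upTo⁻)
  open import Data.List.Relation.Unary.All as All using (All; []; _∷_)
  import Data.List.Relation.Unary.All.Properties as All
  open import Data.List.Relation.Unary.AllPairs as AllPairs using (AllPairs; []; _∷_)
  import Data.List.Relation.Unary.AllPairs.Properties as AllPairs
  import Data.List.Relation.Unary.Unique.Propositional.Properties as Unique
  open import Data.List.Relation.Unary.Any as Any using (Any)
  import Data.List.Relation.Unary.Any.Properties as Any
  open import Data.Nat.Base as ℕ using (ℕ; zero; suc; _+_; _*_; _≤_; _<_; z≤n; s≤s)
  open import Data.Nat.Divisibility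
  open import Data.Nat.ListAction using (sum)
  import Data.Nat.Properties as ℕ
  open import Data.Product.Base using (∃; ∃₂; Σ; _×_; _,_; proj₁; proj₂)
  open import Data.Rational.Base as ℚ using (ℚ; 0ℚ; 1ℚ)
  import Data.Rational.Properties as ℚ
  open import Data.Vec.Functional using (Vector)
  open import Function.Base using (_∘_)
  open import Relation.Binary.Definitions using (Decidable)
  open import Relation.Binary.PropositionalEquality hiding ([_])
  open import Relation.Nullary using (Dec; ¬_; contradiction)
  open import Relation.Nullary.Decidable using (¬?; _×-dec_)
  open FiniteSums
  open AbelianGroups
  open Types
  open Embeddings
  open Realisation
  open Codes
  open FinGroup using (rawGroup)

  ≅-sym : ∀ {m n} (G : FinGroup m) (H : FinGroup n) → rawGroup G ≅ rawGroup H → rawGroup H ≅ rawGroup G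
  ≅-sym G H (f , iso) = g , record
    { isGroupMonomorphism = Homomorphisms.monomorphism H G {g}
        (λ x y → injective (trans (fg (x H.∙ y)) (sym (trans (∙-homo (g x) (g y)) (cong₂ H._∙_ (fg x) (fg y))))))
        (λ x y gx≡gy → trans (sym (fg x)) (trans (cong f gx≡gy) (fg y)))
    ; surjective = λ y → f y , λ { refl → injective (fg (f y)) } }
    where
    open GroupMorphisms.IsGroupIsomorphism iso using (∙-homo; injective; surjective)
    module G = FinGroup G
    module H = FinGroup H
    g = λ y → proj₁ (surjective y)
    fg : ∀ y → f (g y) ≡ y
    fg y = proj₂ (surjective y) refl

  HasType-resp : ∀ {n r} {G : FinGroup n} {d e : Vector ℕ r} → (∀ i → d i ≡ e i) → HasType G d → HasType G e
  HasType-resp {e = e} d≗e TG = record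
    { comm = comm ; basis = basis ; spans = spans
    ; positive = λ i → subst (1 ≤_) (d≗e i) (positive i)
    ; independent = record
      { annihilates = λ i → subst (λ d → d · basis i ≡ ε) (d≗e i) (annihilates i)
      ; relation⇒∣ = λ c eq i → subst (_∣ c i) (d≗e i) (relation⇒∣ c eq i) } }
    where open HasType TG

  deduplicate-AllPairs : ∀ {A : Set} {R : A → A → Set} (R? : Decidable R) xs → AllPairs (λ x y → ¬ R x y) (deduplicate R? xs)
  deduplicate-AllPairs R? []       = []
  deduplicate-AllPairs R? (x ∷ xs) = All.all-filter (¬? ∘ R? x) (deduplicate R? xs) ∷ AllPairs.filter⁺ (¬? ∘ R? x) (deduplicate-AllPairs R? xs)

  -- The list of all groups contains an isomorphic copy of `G`. A type is invariant under
  -- isomorphism, so it survives when `deduplicate` replaces that copy by an isomorphic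
  -- representative.
  class-of-type : ∀ {n r} {d : Vector ℕ r} {G : FinGroup n} → HasType G d → ∃ λ G′ → G′ ∈ groupClasses n × HasType G′ d
  class-of-type {G = G} TG = find (Any.deduplicate⁺ _≅?_
    (λ {x} {y} y≅x Tx → ≅-preserves-type (≅-sym y x y≅x) Tx)
    (Any.map (λ {G′} G≅G′ → ≅-preserves-type G≅G′ TG) (groups-complete G)))

  ≲⇒≤ : ∀ {m n} {H : FinGroup m} {G : FinGroup n} → H ≲ G → m ≤ n
  ≲⇒≤ {H = H} {G} H≲G = Fin.injective⇒≤ (GroupMorphisms.IsGroupMonomorphism.injective (proj₂ (≲⇒mono H G H≲G)))

  -- (n , G , m , H): a group G of order n and a subgroup class H of G of order m.
  Quad : Set
  Quad = Σ ℕ λ n → FinGroup n × Σ ℕ FinGroup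

  length-concatMap : ∀ {A B : Set} (f : A → List B) (g : A → ℕ) xs → (∀ x → length (f x) ≡ g x) →
    length (concatMap f xs) ≡ sum (map g xs)
  length-concatMap f g []       eq = refl
  length-concatMap f g (x ∷ xs) eq = trans (List.length-++ (f x)) (cong₂ _+_ (eq x) (length-concatMap f g xs eq))

  -- The decision procedures and the list of classes are parameters: only the separation of the
  -- classes and the presence of every type enter, so nothing depends on how groups are enumerated.
  module Quads (r : ℕ)
    (admissible? : ∀ {n} (G : FinGroup n) → Dec (IsAbelian G × RankAtMost G r))
    (_≲?_ : ∀ {m n} (H : FinGroup m) (G : FinGroup n) → Dec (H ≲ G))
    (classes : ∀ n → List (FinGroup n))
    (classes-separate : ∀ n → AllPairs (λ G H → ¬ rawGroup G ≅ rawGroup H) (classes n))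
    (class-of-type : ∀ {n} {d : Vector ℕ r} {G : FinGroup n} → HasType G d → ∃ λ G′ → G′ ∈ classes n × HasType G′ d)
    where

    quadsH : ∀ {n} → FinGroup n → ℕ → List Quad
    quadsH G m = map (λ H → _ , G , m , H) (filter (_≲? G) (classes m))

    quadsG : ∀ {n} → FinGroup n → List Quad
    quadsG {n} G = concatMap (quadsH G) (upTo (suc n))

    quadsN : ℕ → List Quad
    quadsN n = concatMap quadsG (filter admissible? (classes n))

    quads : ℕ → List Quad
    quads N = concatMap (quadsN ∘ suc) (upTo N)

    subclasses : ∀ {n} → FinGroup n → ℕ
    subclasses {n} G = sum (map (λ m → length (filter (_≲? G) (classes m))) (upTo (suc n)))

    total : ℕ → ℕ
    total n = sum (map subclasses (filter admissible? (classes n)))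

    length-quads : ∀ N → length (quads N) ≡ sum (map (total ∘ suc) (upTo N))
    length-quads N = length-concatMap (quadsN ∘ suc) (total ∘ suc) (upTo N) λ n →
      length-concatMap quadsG subclasses (filter admissible? (classes (suc n))) λ G →
        length-concatMap (quadsH G) (λ m → length (filter (_≲? G) (classes m))) (upTo (suc (suc n))) λ m →
          List.length-map {A = FinGroup m} {B = Quad} (λ H → suc n , G , m , H) (filter (_≲? G) (classes m))

    data IsQuad (N : ℕ) : Quad → Set where
      isQuad : ∀ {n G m H} → n < N → G ∈ classes (suc n) → IsAbelian G → RankAtMost G r →
               H ∈ classes m → H ≲ G → IsQuad N (suc n , G , m , H)

    ∈-quadsH⁻ : ∀ {n} (G : FinGroup n) m {q} → q ∈ quadsH G m → ∃ λ H → q ≡ (n , G , m , H) × H ∈ classes m × H ≲ G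
    ∈-quadsH⁻ G m q∈ = let H , H∈ , eq = ∈-map⁻ _ q∈ ; H∈′ , H≲G = ∈-filter⁻ (_≲? G) {xs = classes m} H∈ in H , eq , H∈′ , H≲G

    ∈-quadsG⁻ : ∀ {n} (G : FinGroup n) {q} → q ∈ quadsG G → ∃₂ λ m H → q ≡ (n , G , m , H) × H ∈ classes m × H ≲ G
    ∈-quadsG⁻ {n} G q∈ = let m , _ , q∈′ = ∈-concatMap⁻ (quadsH G) (upTo (suc n)) q∈ in m , ∈-quadsH⁻ G m q∈′

    ∈-quadsN⁻ : ∀ n {q} → q ∈ quadsN n → ∃ λ G → ∃₂ λ m H → q ≡ (n , G , m , H) ×
      (G ∈ classes n × IsAbelian G × RankAtMost G r) × H ∈ classes m × H ≲ G
    ∈-quadsN⁻ n q∈ =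
      let G , G∈ , q∈′ = ∈-concatMap⁻ quadsG (filter admissible? (classes n)) q∈
          G∈′ , admissible = ∈-filter⁻ admissible? {xs = classes n} G∈
          m , H , eq , H∈ , H≲G = ∈-quadsG⁻ G q∈′
      in G , m , H , eq , (G∈′ , admissible) , H∈ , H≲G

    ∈-quads⁻ : ∀ N {q} → q ∈ quads N → IsQuad N q
    ∈-quads⁻ N q∈ = let n , n∈ , q∈′ = ∈-concatMap⁻ (quadsN ∘ suc) (upTo N) q∈ in build (∈-upTo⁻ n∈) (∈-quadsN⁻ (suc n) q∈′)
      where
      build : ∀ {n q} → n < N → (∃ λ G → ∃₂ λ m H → q ≡ (suc n , G , m , H) ×
        (G ∈ classes (suc n) × IsAbelian G × RankAtMost G r) × H ∈ classes m × H ≲ G) → IsQuad N q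
      build n<N (G , m , H , refl , (G∈ , abelian , rank) , H∈ , H≲G) = isQuad n<N G∈ abelian rank H∈ H≲G

    ∈-quads⁺ : ∀ N {q} → IsQuad N q → q ∈ quads N
    ∈-quads⁺ N (isQuad {n} {G} {m} {H} n<N G∈ abelian rank H∈ H≲G) =
      ∈-concatMap⁺ (quadsN ∘ suc) (∈-upTo⁺ n<N) (∈-concatMap⁺ quadsG (∈-filter⁺ admissible? G∈ (abelian , rank))
        (∈-concatMap⁺ (quadsH G) (∈-upTo⁺ (s≤s (≲⇒≤ {H = H} {G} H≲G))) (∈-map⁺ _ (∈-filter⁺ (_≲? G) H∈ H≲G))))

    -- A relation rather than a function, because the code of a quadruple is available only under
    -- double negation.
    Encodes : Quad → Code r → Set
    Encodes (n , G , m , H) v = Valid 1 v × HasType G (dChain 1 v) × HasType H (eChain 1 v)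

    Separate : Quad → Quad → Set
    Separate q q′ = ∀ v → Encodes q v → Encodes q′ v → ⊥

    -- A type determines both the order and the isomorphism class. Two quadruples with a common code
    -- would therefore agree in the order of `G`, in `G`, in the order of `H` and in `H`, which the
    -- nested lists exclude one level at a time.
    quads-separate : ∀ N → AllPairs Separate (quads N)
    quads-separate N = AllPairs-concatMap (quadsN ∘ suc)
      (λ {n} _ → AllPairs-concatMap quadsG
        (λ {G} _ → AllPairs-concatMap (quadsH G)
          (λ {m} _ → AllPairs.map⁺ (AllPairs.map
            (λ {H} {H′} H≇H′ v (_ , _ , TH) (_ , _ , TH′) → H≇H′ (sameType⇒≅ TH TH′))
            (AllPairs.filter⁺ (_≲? G) (classes-separate _))))
          (AllPairs.map (λ {m} {m′} m≢m′ {q} {q′} q∈ q′∈ → sameM G m≢m′ (∈-quadsH⁻ G m q∈) (∈-quadsH⁻ G m′ q′∈))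
            (Unique.upTo⁺ (suc (suc n)))))
        (AllPairs.map (λ {G} {G′} G≇G′ {q} {q′} q∈ q′∈ → sameG G≇G′ (∈-quadsG⁻ G q∈) (∈-quadsG⁻ G′ q′∈))
          (AllPairs.filter⁺ admissible? (classes-separate _))))
      (AllPairs.map (λ {n} {n′} n≢n′ {q} {q′} q∈ q′∈ → sameN n≢n′ (∈-quadsN⁻ (suc n) q∈) (∈-quadsN⁻ (suc n′) q′∈))
        (Unique.upTo⁺ N))
      where
      sameM : ∀ {n m m′ q q′} (G : FinGroup n) {P : FinGroup m → Set} {P′ : FinGroup m′ → Set} → m ≢ m′ →
        (∃ λ H → q ≡ (n , G , m , H) × P H) → (∃ λ H → q′ ≡ (n , G , m′ , H) × P′ H) → Separate q q′
      sameM G m≢m′ (H , refl , _) (H′ , refl , _) v (_ , _ , TH) (_ , _ , TH′) = m≢m′ (sameType⇒sameOrder TH TH′)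

      sameG : ∀ {n q q′} {G G′ : FinGroup n} {P P′ : ∀ m → FinGroup m → Set} → ¬ rawGroup G ≅ rawGroup G′ →
        (∃₂ λ m H → q ≡ (n , G , m , H) × P m H) → (∃₂ λ m H → q′ ≡ (n , G′ , m , H) × P′ m H) → Separate q q′
      sameG G≇G′ (_ , _ , refl , _) (_ , _ , refl , _) v (_ , TG , _) (_ , TG′ , _) = G≇G′ (sameType⇒≅ TG TG′)

      sameN : ∀ {n n′ q q′} {P : FinGroup (suc n) → ∀ m → FinGroup m → Set} {P′ : FinGroup (suc n′) → ∀ m → FinGroup m → Set} → n ≢ n′ →
        (∃ λ G → ∃₂ λ m H → q ≡ (suc n , G , m , H) × P G m H) → (∃ λ G → ∃₂ λ m H → q′ ≡ (suc n′ , G , m , H) × P′ G m H) → Separate q q′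
      sameN n≢n′ (_ , _ , _ , refl , _) (_ , _ , _ , refl , _) v (_ , TG , _) (_ , TG′ , _) =
        n≢n′ (ℕ.suc-injective (sameType⇒sameOrder TG TG′))

    quad⇒code : ∀ {N q} → IsQuad N q → ¬ ¬ ∃ λ v → v ∈ codes r 1 N × Encodes q v
    quad⇒code {N} (isQuad {n} {G} {m} {H} n<N _ abelian rank _ H≲G) k =
      classify abelian rank λ (d , chain-d , TG) → ≲⇒type TG H≲G λ (e , chain-e , TH) →
        let v , valid , dv , ev = encode {c = 1} 1 1 d e (s≤s z≤n) (s≤s z≤n) refl (HasType.positive TG)
              (λ i → 1∣ d i) (λ i → 1∣ e i) chain-d chain-e (≲⇒∣ TH TG chain-e chain-d H≲G)
            TG′ = HasType-resp (λ i → sym (dv i)) TG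
            weight≡ : weight v ≡ suc n
            weight≡ = sym (trans (order≡∏ TG′) (trans (∏-dChain 1 v) (trans (cong (_* weight v) (ℕ.^-zeroˡ r)) (ℕ.*-identityˡ (weight v)))))
        in k (v , ∈-codes⁺ v (s≤s z≤n) valid (subst (_≤ N) (sym weight≡) n<N)
               , valid , TG′ , HasType-resp (λ i → sym (ev i)) TH)

    -- A group embeds in itself, so `≲⇒∣` applied in both directions shows that two chains which are
    -- types of the same group are equal.
    encodes-injective : ∀ {q v v′} → Encodes q v → Encodes q v′ → v ≡ v′
    encodes-injective {q = n , G , m , H} {v} {v′} (valid , TG , TH) (valid′ , TG′ , TH′) =
      decode-injective {c = 1} 1 1 v v′ (s≤s z≤n) (s≤s z≤n) (s≤s z≤n) valid
        (sameType G TG TG′ (partials-chain _ 1 v) (partials-chain _ 1 v′))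
        (sameType H TH TH′ (partials-chain _ 1 v) (partials-chain _ 1 v′))
      where
      sameType : ∀ {n} (G : FinGroup n) {d d′ : Vector ℕ r} → HasType G d → HasType G d′ → Chain d → Chain d′ → ∀ i → d i ≡ d′ i
      sameType G T T′ chain chain′ i = ∣-antisym
        (≲⇒∣ T T′ chain chain′ (∣⇒≲ T T (λ _ → ∣-refl)) i) (≲⇒∣ T′ T chain′ chain (∣⇒≲ T T (λ _ → ∣-refl)) i)

    code⇒quad : ∀ {N} (v : Code r) → Valid 1 v → weight v ≤ N → ∃ λ q → q ∈ quads N × Encodes q v
    code⇒quad {N} v valid le with realise (dChain 1 v) (dChain-positive {c = 1} 1 v (s≤s z≤n) valid)
      | realise (eChain 1 v) (eChain-positive {c = 1} 1 v (s≤s z≤n) (s≤s z≤n) valid)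
    ... | G₀ , TG₀ | H₀ , TH₀ with ∏ (dChain 1 v) | ∏-dChain 1 v
    -- The order is `1 ^ r * weight v`, which is at least 1; it must be exhibited as a successor
    -- because `quads` runs over orders `suc n`.
    ...   | zero | 0≡ = contradiction (ℕ.≤-trans (ℕ.*-mono-≤ (1≤^ {1} r (s≤s z≤n)) (1≤weight v valid)) (ℕ.≤-reflexive (sym 0≡))) λ ()
    ...   | suc n | n≡ =
      let G , G∈ , TG = class-of-type TG₀ ; H , H∈ , TH = class-of-type TH₀
          n<N = subst (_≤ N) (sym (trans n≡ (trans (cong (_* weight v) (ℕ.^-zeroˡ r)) (ℕ.*-identityˡ (weight v))))) le
      in _ , ∈-quads⁺ N (isQuad n<N G∈ (HasType.comm TG) (type⇒rank TG) H∈ (∣⇒≲ TH TG (eChain∣dChain {c = 1} 1 1 v refl valid)))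
         , valid , TG , TH

    length-quads≡count : 1 ≤ r → ∀ N → ⌜ length (quads N) ⌝ ≡ count r 1 N
    length-quads≡count 1≤r N = begin
      ⌜ length (quads N) ⌝                      ≡⟨ sumOver-1 (quads N) ⟨
      sumOver (quads N) (λ _ → 1ℚ)              ≡⟨ ℚ.≤-antisym
                                                     (sumOver-inject Encodes 0≤1 (codes r 1 N) (AllPairs.map (λ separate {v} → separate v) (quads-separate N))
                                                       λ q∈ k → quad⇒code (∈-quads⁻ N q∈) λ (v , v∈ , enc) → k (v , v∈ , enc , ℚ.≤-refl))
                                                     (sumOver-inject (λ v q → Encodes q v) 0≤1 (quads N)
                                                       (AllPairs.map (λ v≢v′ {q} enc enc′ → v≢v′ (encodes-injective {q} enc enc′)) (codes-unique r 1 N))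
                                                       λ {v} v∈ k → let valid , le = ∈-codes⁻ v (λ r≡0 → contradiction (subst (1 ≤_) r≡0 1≤r) λ ()) v∈
                                                                        q , q∈ , enc = code⇒quad v valid le in k (q , q∈ , enc , ℚ.≤-refl)) ⟩
      sumOver (codes r 1 N) (λ _ → 1ℚ)          ≡⟨ count≡length r 1 N ⟨
      count r 1 N                               ∎
      where
      open ≡-Reasoning
      0≤1 : ∀ {B : Set} (y : B) → 0ℚ ℚ.≤ 1ℚ
      0≤1 _ = ℚ.nonNegative⁻¹ 1ℚ

  module _ (r : ℕ) where
    private
      admissible? : ∀ {n} (G : FinGroup n) → Dec (IsAbelian G × RankAtMost G r)
      admissible? G = isAbelian? G ×-dec rankAtMost? G r

      module Q = Quads r admissible? _≲?_ groupClasses (λ n → deduplicate-AllPairs _≅?_ groups) class-of-type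

      total≡A : ∀ n → Q.total n ≡ A r n
      total≡A n = cong sum (List.map-cong (λ G → refl) (filter admissible? (groupClasses n)))

    summatory≡count : 1 ≤ r → ∀ N → ⌜ summatory (A r) N ⌝ ≡ count r 1 N
    summatory≡count 1≤r N = trans
      (cong ⌜_⌝ (sym (trans (Q.length-quads N) (cong sum (List.map-cong (total≡A ∘ suc) (upTo N))))))
      (Q.length-quads≡count 1≤r N)

-- Periodic weights, and the count for chains of length one

module Divisors where
  open import Defs using (⌜_⌝; ⌜⌝-suc; module Rational; module Log)
  open import Data.Empty using (⊥)
  open import Data.List.Base as List using (List; _∷_; map; concatMap; length)
  open import Data.List.Membership.Propositional using (_∈_)
  open import Data.List.Membership.Propositional.Properties using (∈-map⁺; ∈-map⁻)
  open import Data.List.Relation.Unary.AllPairs as AllPairs using (AllPairs; _∷_)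
  import Data.List.Relation.Unary.Unique.Propositional.Properties as Unique
  open import Data.List.Relation.Unary.Any using (here; there)
  open import Data.Nat.Base as ℕ using (ℕ; zero; suc)
  open import Data.Nat.Divisibility
  import Data.Nat.DivMod as ℕ
  open import Data.Nat.GCD using (gcd; gcd[m,n]∣m; gcd[m,n]∣n; gcd-greatest; c*gcd[m,n]≡gcd[cm,cn])
  import Data.Nat.Properties as ℕ
  open import Data.Product.Base using (∃; _×_; _,_; proj₁; proj₂)
  open import Data.Rational.Base hiding (_÷_)
  import Data.Rational.Properties as ℚ
  open import Data.Rational.Solver using (module +-*-Solver)
  open import Data.Nat.Solver using () renaming (module +-*-Solver to ℕ-Solver)
  open import Function.Base using (_∘_)
  open import Relation.Binary.PropositionalEquality hiding ([_])
  open FiniteSums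
  open Codes
  open ℚ.≤-Reasoning
  open +-*-Solver using (solve; _:=_; _:+_; _:*_)
  open Rational

  private variable
    A B : Set

  pairs : List A → (A → List B) → List (A × B)
  pairs xs f = concatMap (λ x → map (x ,_) (f x)) xs

  ∈-pairs⁺ : ∀ {xs : List A} {f : A → List B} {x y} → x ∈ xs → y ∈ f x → (x , y) ∈ pairs xs f
  ∈-pairs⁺ {f = f} x∈ y∈ = ∈-concatMap⁺ (λ x → map (x ,_) (f x)) x∈ (∈-map⁺ _ y∈)

  ∈-pairs⁻ : ∀ (xs : List A) (f : A → List B) {x y} → (x , y) ∈ pairs xs f → x ∈ xs × y ∈ f x
  ∈-pairs⁻ xs f p∈ with ∈-concatMap⁻ (λ x → map (x ,_) (f x)) xs p∈
  ... | x , x∈ , p∈′ with ∈-map⁻ (x ,_) p∈′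
  ...   | y , y∈ , refl = x∈ , y∈

  pairs-unique : ∀ {xs : List A} {f : A → List B} → AllPairs _≢_ xs → (∀ x → AllPairs _≢_ (f x)) → AllPairs _≢_ (pairs xs f)
  pairs-unique {f = f} xs! fx! = AllPairs-concatMap (λ x → map (x ,_) (f x)) (λ {x} _ → Unique.map⁺ (λ { refl → refl }) (fx! x))
    (AllPairs.map (λ {x} {x′} x≢x′ {p} {p′} p∈ p′∈ p≡p′ →
      let _ , _ , eq = ∈-map⁻ (x ,_) p∈ ; _ , _ , eq′ = ∈-map⁻ (x′ ,_) p′∈
      in x≢x′ (trans (cong proj₁ (sym eq)) (trans (cong proj₁ p≡p′) (cong proj₁ eq′)))) xs!)

  sumOver-pairs : ∀ (xs : List A) (f : A → List B) g → sumOver (pairs xs f) g ≡ sumOver xs λ x → sumOver (f x) λ y → g (x , y)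
  sumOver-pairs xs f g = trans (sumOver-concatMap _ xs g) (sumOver-cong xs λ {x} _ → sumOver-map (x ,_) (f x) g)

  sumOver-member : ∀ {xs : List A} {f x} → (∀ {x} → x ∈ xs → 0ℚ ≤ f x) → x ∈ xs → f x ≤ sumOver xs f
  sumOver-member {xs = x ∷ xs} {f} 0≤f (here refl) = begin
    f x                     ≡⟨ ℚ.+-identityʳ (f x) ⟨
    f x + 0ℚ                ≤⟨ ℚ.+-monoʳ-≤ (f x) (sumOver-nonneg xs (0≤f ∘ there)) ⟩
    f x + sumOver xs f      ∎
  sumOver-member {xs = z ∷ xs} {f} {x} 0≤f (there x∈) = begin
    f x                     ≡⟨ ℚ.+-identityˡ (f x) ⟨
    0ℚ + f x                ≤⟨ ℚ.+-mono-≤ (0≤f (here refl)) (sumOver-member (0≤f ∘ there) x∈) ⟩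
    f z + sumOver xs f      ∎

  sumOver-range-+ : ∀ m n f → sumOver (range (m ℕ.+ n)) f ≡ sumOver (range m) (λ j → f (j ℕ.+ n)) + sumOver (range n) f
  sumOver-range-+ zero    n f = sym (ℚ.+-identityˡ _)
  sumOver-range-+ (suc m) n f = trans (cong (f (suc m ℕ.+ n) +_) (sumOver-range-+ m n f)) (sym (ℚ.+-assoc (f (suc m ℕ.+ n)) _ _))

  sumOver-range-mono : ∀ {m n f} → (∀ a → 0ℚ ≤ f a) → m ℕ.≤ n → sumOver (range m) f ≤ sumOver (range n) f
  sumOver-range-mono {m} {n} {f} 0≤f m≤n = begin
    sumOver (range m) f                                                      ≡⟨ ℚ.+-identityˡ _ ⟨
    0ℚ + sumOver (range m) f                                                 ≤⟨ ℚ.+-monoˡ-≤ _ (sumOver-nonneg (range (n ℕ.∸ m)) λ {j} _ → 0≤f (j ℕ.+ m)) ⟩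
    sumOver (range (n ℕ.∸ m)) (λ j → f (j ℕ.+ m)) + sumOver (range m) f      ≡⟨ sumOver-range-+ (n ℕ.∸ m) m f ⟨
    sumOver (range (n ℕ.∸ m ℕ.+ m)) f                                        ≡⟨ cong (λ k → sumOver (range k) f) (ℕ.m∸n+n≡m m≤n) ⟩
    sumOver (range n) f                                                      ∎

  p≤p+q : ∀ {p q} → 0ℚ ≤ q → p ≤ p + q
  p≤p+q {p} 0≤q = ℚ.≤-trans (ℚ.≤-reflexive (sym (ℚ.+-identityʳ p))) (ℚ.+-monoʳ-≤ p 0≤q)

  p≤q+p : ∀ {p q} → 0ℚ ≤ q → p ≤ q + p
  p≤q+p {p} 0≤q = ℚ.≤-trans (ℚ.≤-reflexive (sym (ℚ.+-identityˡ p))) (ℚ.+-monoˡ-≤ p 0≤q)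

  -- Each of the K blocks of length c contributes about W / (c k).
  module _ {c : ℕ} (1≤c : 1 ℕ.≤ c) {w : ℕ → ℚ} (0≤w : ∀ b → 0ℚ ≤ w b) (periodic : ∀ j K → w (j ℕ.+ K ℕ.* c) ≡ w j) where
    private
      f : ℕ → ℚ
      f b = w b * inv b

      W = sumOver (range c) w

      0≤W : 0ℚ ≤ W
      0≤W = sumOver-nonneg (range c) λ {j} _ → 0≤w j

      block : ℕ → ℚ
      block K = sumOver (range c) λ j → f (j ℕ.+ K ℕ.* c)

      block≡ : ∀ K → block K ≡ sumOver (range c) λ j → w j * inv (j ℕ.+ K ℕ.* c)
      block≡ K = sumOver-cong (range c) λ {j} _ → cong (_* inv (j ℕ.+ K ℕ.* c)) (periodic j K)

      scaled : ∀ K → W * inv (K ℕ.* c) ≡ sumOver (range c) λ j → w j * inv (K ℕ.* c)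
      scaled K = sym (sumOver-*ʳ (range c) (inv (K ℕ.* c)) w)

      W*inv : ∀ K → W * inv (suc K ℕ.* c) ≡ W * inv c * inv (suc K)
      W*inv K = trans (cong (W *_) (trans (inv-* {suc K} {c} (ℕ.s≤s ℕ.z≤n) 1≤c) (ℚ.*-comm (inv (suc K)) (inv c))))
        (sym (ℚ.*-assoc W (inv c) (inv (suc K))))

    -- The arguments in the block that follows K c are at most (K + 1) c, so each reciprocal there
    -- is at least 1 / ((K + 1) c).
    periodic-lower : ∀ K → W * inv c * harmonic K ≤ sumOver (range (K ℕ.* c)) f
    periodic-lower zero    = ℚ.≤-reflexive (ℚ.*-zeroʳ (W * inv c))
    periodic-lower (suc K) = begin
      W * inv c * (inv (suc K) + harmonic K)              ≡⟨ ℚ.*-distribˡ-+ (W * inv c) (inv (suc K)) (harmonic K) ⟩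
      W * inv c * inv (suc K) + W * inv c * harmonic K    ≤⟨ ℚ.+-mono-≤ (begin
                                                               W * inv c * inv (suc K)       ≡⟨ W*inv K ⟨
                                                               W * inv (suc K ℕ.* c)         ≡⟨ scaled (suc K) ⟩
                                                               sumOver (range c) (λ j → w j * inv (suc K ℕ.* c))
                                                                                             ≤⟨ sumOver-mono (range c) (λ {j} j∈ → *-monoʳ (0≤w j)
                                                                                                  (inv-antitone (ℕ.+-monoˡ-≤ (K ℕ.* c) (proj₂ (∈-range⁻ j∈))))) ⟩
                                                               sumOver (range c) (λ j → w j * inv (j ℕ.+ K ℕ.* c))
                                                                                             ≡⟨ block≡ K ⟨
                                                               block K                       ∎) (periodic-lower K) ⟩
      block K + sumOver (range (K ℕ.* c)) f               ≡⟨ sumOver-range-+ c (K ℕ.* c) f ⟨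
      sumOver (range (c ℕ.+ K ℕ.* c)) f                   ∎

    private
      first : block 0 ≤ W
      first = sumOver-mono (range c) λ {j} _ → begin
        w (j ℕ.+ 0) * inv (j ℕ.+ 0)    ≤⟨ *-monoʳ (0≤w (j ℕ.+ 0)) (inv≤1 (j ℕ.+ 0)) ⟩
        w (j ℕ.+ 0) * 1ℚ               ≡⟨ ℚ.*-identityʳ _ ⟩
        w (j ℕ.+ 0)                    ≡⟨ cong w (ℕ.+-identityʳ j) ⟩
        w j                            ∎

      -- The first block is bounded by `W` outright. In later blocks all arguments exceed the last
      -- multiple of `c` before them; compared with `periodic-lower` this shifts the blocks by one,
      -- at the cost of that single `W`.
      upper : ∀ K → sumOver (range (suc K ℕ.* c)) f ≤ W + W * inv c * harmonic K
      upper zero = begin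
        sumOver (range (c ℕ.+ 0)) f          ≡⟨ sumOver-range-+ c 0 f ⟩
        block 0 + 0ℚ                         ≤⟨ ℚ.+-monoˡ-≤ 0ℚ first ⟩
        W + 0ℚ                               ≡⟨ cong (W +_) (ℚ.*-zeroʳ (W * inv c)) ⟨
        W + W * inv c * 0ℚ                   ∎
      upper (suc K) = begin
        sumOver (range (c ℕ.+ suc K ℕ.* c)) f                  ≡⟨ sumOver-range-+ c (suc K ℕ.* c) f ⟩
        block (suc K) + sumOver (range (suc K ℕ.* c)) f        ≤⟨ ℚ.+-mono-≤ (begin
                                                                    block (suc K)                ≡⟨ block≡ (suc K) ⟩
                                                                    sumOver (range c) (λ j → w j * inv (j ℕ.+ suc K ℕ.* c))
                                                                                                 ≤⟨ sumOver-mono (range c) (λ {j} _ → *-monoʳ (0≤w j)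
                                                                                                      (inv-antitone (ℕ.m≤n+m (suc K ℕ.* c) j))) ⟩
                                                                    sumOver (range c) (λ j → w j * inv (suc K ℕ.* c))
                                                                                                 ≡⟨ scaled (suc K) ⟨
                                                                    W * inv (suc K ℕ.* c)        ≡⟨ W*inv K ⟩
                                                                    W * inv c * inv (suc K)      ∎) (upper K) ⟩
        W * inv c * inv (suc K) + (W + W * inv c * harmonic K) ≡⟨ solve 4 (λ w i x h → w :* i :* x :+ (w :+ w :* i :* h) := w :+ w :* i :* (x :+ h)) refl
                                                                    W (inv c) (inv (suc K)) (harmonic K) ⟩
        W + W * inv c * harmonic (suc K)                       ∎

    periodic-upper : ∀ K → sumOver (range (K ℕ.* c)) f ≤ W + W * inv c * harmonic K
    periodic-upper zero    = ℚ.≤-trans 0≤W (ℚ.≤-reflexive (sym (trans (cong (W +_) (ℚ.*-zeroʳ (W * inv c))) (ℚ.+-identityʳ W))))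
    periodic-upper (suc K) = ℚ.≤-trans (upper K) (ℚ.+-monoʳ-≤ W (*-monoʳ (0≤p*q 0≤W (0≤inv c)) (harmonic-mono (ℕ.n≤1+n K))))

  -- The constant weight 1 has period `c` and sum `c` over a period. The estimate says H_{Kc} = H_K
  -- + O(c), which makes H_y insensitive to dividing `y` by a constant.
  harmonic-* : ∀ {c} → 1 ℕ.≤ c → ∀ K → harmonic (K ℕ.* c) ≤ ⌜ c ⌝ + harmonic K
  harmonic-* {c} 1≤c K = begin
    harmonic (K ℕ.* c)                                   ≡⟨ sumOver-cong (range (K ℕ.* c)) (λ {b} _ → ℚ.*-identityˡ (inv b)) ⟨
    sumOver (range (K ℕ.* c)) (λ b → 1ℚ * inv b)         ≤⟨ periodic-upper 1≤c (λ _ → Log.0≤1) (λ _ _ → refl) K ⟩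
    W + W * inv c * harmonic K                           ≡⟨ cong (λ w → w + w * inv c * harmonic K) W≡c ⟩
    ⌜ c ⌝ + ⌜ c ⌝ * inv c * harmonic K                   ≡⟨ cong (λ z → ⌜ c ⌝ + z * harmonic K) (inv-inverse 1≤c) ⟩
    ⌜ c ⌝ + 1ℚ * harmonic K                              ≡⟨ cong (⌜ c ⌝ +_) (ℚ.*-identityˡ (harmonic K)) ⟩
    ⌜ c ⌝ + harmonic K                                   ∎
    where
    W = sumOver (range c) (λ _ → 1ℚ)
    W≡c = trans (sumOver-1 (range c)) (cong ⌜_⌝ (length-range c))

  ⌜÷⌝-upper : ∀ y {k} → 1 ℕ.≤ k → ⌜ y ÷ k ⌝ ≤ ⌜ y ⌝ * inv k
  ⌜÷⌝-upper y {k} 1≤k = begin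
    ⌜ y ÷ k ⌝                          ≡⟨ ℚ.*-identityʳ _ ⟨
    ⌜ y ÷ k ⌝ * 1ℚ                     ≡⟨ cong (⌜ y ÷ k ⌝ *_) (inv-inverse 1≤k) ⟨
    ⌜ y ÷ k ⌝ * (⌜ k ⌝ * inv k)        ≡⟨ ℚ.*-assoc ⌜ y ÷ k ⌝ ⌜ k ⌝ (inv k) ⟨
    ⌜ y ÷ k ⌝ * ⌜ k ⌝ * inv k          ≡⟨ cong (_* inv k) (⌜⌝-* (y ÷ k) k) ⟨
    ⌜ y ÷ k ℕ.* k ⌝ * inv k            ≤⟨ *-monoˡ (0≤inv k) (⌜⌝-mono (÷-* y k)) ⟩
    ⌜ y ⌝ * inv k                      ∎

  ≤[1+÷]* : ∀ y {k} → 1 ℕ.≤ k → y ℕ.≤ suc (y ÷ k) ℕ.* k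
  ≤[1+÷]* y {suc k} _ = ℕ.≤-trans (ℕ.≤-reflexive (ℕ.m≡m%n+[m/n]*n y (suc k))) (ℕ.+-monoˡ-≤ (y ℕ./ suc k ℕ.* suc k) (ℕ.<⇒≤ (ℕ.m%n<n y (suc k))))

  ⌜÷⌝-lower : ∀ y {k} → 1 ℕ.≤ k → ⌜ y ⌝ * inv k ≤ ⌜ y ÷ k ⌝ + 1ℚ
  ⌜÷⌝-lower y {k} 1≤k = begin
    ⌜ y ⌝ * inv k                          ≤⟨ *-monoˡ (0≤inv k) (⌜⌝-mono (≤[1+÷]* y 1≤k)) ⟩
    ⌜ suc (y ÷ k) ℕ.* k ⌝ * inv k          ≡⟨ cong (_* inv k) (⌜⌝-* (suc (y ÷ k)) k) ⟩
    ⌜ suc (y ÷ k) ⌝ * ⌜ k ⌝ * inv k        ≡⟨ ℚ.*-assoc ⌜ suc (y ÷ k) ⌝ ⌜ k ⌝ (inv k) ⟩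
    ⌜ suc (y ÷ k) ⌝ * (⌜ k ⌝ * inv k)      ≡⟨ cong (⌜ suc (y ÷ k) ⌝ *_) (inv-inverse 1≤k) ⟩
    ⌜ suc (y ÷ k) ⌝ * 1ℚ                   ≡⟨ ℚ.*-identityʳ _ ⟩
    ⌜ suc (y ÷ k) ⌝                        ≡⟨ ⌜⌝-suc (y ÷ k) ⟩
    ⌜ y ÷ k ⌝ + 1ℚ                         ∎

  -- b ∣ c * a exactly when reduced b ∣ a.
  module Reduced (c : ℕ) where

    reduced : ℕ → ℕ
    reduced b = _∣_.quotient (gcd[m,n]∣m b c)

    b≡ : ∀ b → b ≡ reduced b ℕ.* gcd b c
    b≡ b = _∣_.equality (gcd[m,n]∣m b c)

    module _ {b : ℕ} (1≤b : 1 ℕ.≤ b) where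
      1≤reduced : 1 ℕ.≤ reduced b
      1≤reduced = 1≤*⇒1≤ˡ (reduced b) (subst (1 ℕ.≤_) (b≡ b) 1≤b)

      1≤gcd : 1 ℕ.≤ gcd b c
      1≤gcd = 1≤*⇒1≤ʳ (reduced b) (subst (1 ℕ.≤_) (b≡ b) 1≤b)

      inv-reduced : inv (reduced b) ≡ ⌜ gcd b c ⌝ * inv b
      inv-reduced = begin-equality
        inv (reduced b)                                        ≡⟨ ℚ.*-identityˡ _ ⟨
        1ℚ * inv (reduced b)                                   ≡⟨ cong (_* inv (reduced b)) (inv-inverse 1≤gcd) ⟨
        ⌜ gcd b c ⌝ * inv (gcd b c) * inv (reduced b)          ≡⟨ ℚ.*-assoc ⌜ gcd b c ⌝ (inv (gcd b c)) (inv (reduced b)) ⟩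
        ⌜ gcd b c ⌝ * (inv (gcd b c) * inv (reduced b))        ≡⟨ cong (⌜ gcd b c ⌝ *_) (inv-* 1≤gcd 1≤reduced) ⟨
        ⌜ gcd b c ⌝ * inv (gcd b c ℕ.* reduced b)              ≡⟨ cong (λ z → ⌜ gcd b c ⌝ * inv z) (trans (ℕ.*-comm (gcd b c) (reduced b)) (sym (b≡ b))) ⟩
        ⌜ gcd b c ⌝ * inv b                                    ∎

      reduced∣ : ∀ {a} → b ∣ c ℕ.* a → reduced b ∣ a
      reduced∣ {a} b∣ca = *-cancelʳ-∣ (gcd b c) {{ℕ.>-nonZero 1≤gcd}} (subst₂ _∣_ (b≡ b) gcd≡ (gcd-greatest (n∣m*n a) (subst (b ∣_) (ℕ.*-comm c a) b∣ca)))
        where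
        gcd≡ : gcd (a ℕ.* b) (a ℕ.* c) ≡ a ℕ.* gcd b c
        gcd≡ = sym (c*gcd[m,n]≡gcd[cm,cn] a b c)

    ∣-reduced : ∀ b k → b ∣ c ℕ.* (k ℕ.* reduced b)
    ∣-reduced b k = divides (k ℕ.* g) (trans (cong (ℕ._* (k ℕ.* reduced b)) (_∣_.equality (gcd[m,n]∣n b c)))
      (trans (ℕ-Solver.solve 4 (λ g d k r → g ⊗ d ⊗ (k ⊗ r) ℕ-Solver.:= k ⊗ g ⊗ (r ⊗ d)) refl g (gcd b c) k (reduced b))
        (cong (k ℕ.* g ℕ.*_) (sym (b≡ b)))))
      where
      open ℕ-Solver using () renaming (_:*_ to _⊗_)
      g = _∣_.quotient (gcd[m,n]∣n b c)

    gcd-periodic : ∀ j K → gcd (j ℕ.+ K ℕ.* c) c ≡ gcd j c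
    gcd-periodic j K = ∣-antisym
      (gcd-greatest (∣m+n∣n⇒∣m (gcd[m,n]∣m (j ℕ.+ K ℕ.* c) c) (∣n⇒∣m*n K (gcd[m,n]∣n (j ℕ.+ K ℕ.* c) c))) (gcd[m,n]∣n (j ℕ.+ K ℕ.* c) c))
      (gcd-greatest (∣m∣n⇒∣m+n (gcd[m,n]∣m j c) (∣n⇒∣m*n K (gcd[m,n]∣n j c))) (gcd[m,n]∣n j c))
      where
      ∣m+n∣n⇒∣m : ∀ {i m n} → i ∣ m ℕ.+ n → i ∣ n → i ∣ m
      ∣m+n∣n⇒∣m {i} {m} {n} p q = ∣m+n∣m⇒∣n (subst (i ∣_) (ℕ.+-comm m n) p) q

    module _ (1≤c : 1 ℕ.≤ c) (y : ℕ) where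
      private
        solutions : List (ℕ × ℕ × ℕ)
        solutions = pairs (range y) (λ a → factorings (c ℕ.* a))

        multiples : List (ℕ × ℕ)
        multiples = pairs (range (y ℕ.* c)) (λ b → range (y ÷ reduced b))

        R : ℕ × ℕ × ℕ → ℕ × ℕ → Set
        R (a , b , q) (b′ , k) = b ≡ b′ × 1 ℕ.≤ b × a ≡ k ℕ.* reduced b × b ℕ.* q ≡ c ℕ.* a

        0≤1 : ∀ {B : Set} (y : B) → 0ℚ ≤ 1ℚ
        0≤1 _ = Log.0≤1

        R-injective : ∀ {x x′ p} → x ≢ x′ → R x p → R x′ p → ⊥
        R-injective {a , b , q} {a′ , b′ , q′} x≢x′ (refl , 1≤b , refl , bq) (refl , _ , refl , bq′) =
          x≢x′ (cong (λ q → a , b , q) (ℕ.*-cancelˡ-≡ q q′ b {{ℕ.>-nonZero 1≤b}} (trans bq (sym bq′))))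

        R-functional : ∀ {p p′ x} → p ≢ p′ → R x p → R x p′ → ⊥
        R-functional {b , k} {b′ , k′} p≢p′ (refl , 1≤b , eq , _) (refl , _ , eq′ , _) =
          p≢p′ (cong (b ,_) (ℕ.*-cancelʳ-≡ k k′ (reduced b) {{ℕ.>-nonZero (1≤reduced 1≤b)}} (trans (sym eq) eq′)))

        into : ∀ {x} → x ∈ solutions → ∃ λ p → p ∈ multiples × R x p
        into {a , b , q} x∈ with ∈-pairs⁻ (range y) (λ a → factorings (c ℕ.* a)) x∈
        ... | a∈ , bq∈ with ∈-range⁻ a∈ | ∈-factorings⁻ {c ℕ.* a} bq∈
        ...   | 1≤a , a≤y | bq≡ , 1≤b , 1≤q with reduced∣ 1≤b (divides q (trans (sym bq≡) (ℕ.*-comm b q)))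
        ...     | divides k a≡ = (b , k)
                  , ∈-pairs⁺ (∈-range⁺ 1≤b (≤-*-trans 1≤q (ℕ.≤-trans (ℕ.≤-reflexive (trans bq≡ (ℕ.*-comm c a))) (ℕ.*-monoˡ-≤ c a≤y))))
                      (∈-range⁺ (1≤*⇒1≤ˡ k (subst (1 ℕ.≤_) a≡ 1≤a))
                        (*≤⇒≤÷ (1≤reduced 1≤b) (subst (ℕ._≤ y) (trans a≡ (ℕ.*-comm k (reduced b))) a≤y)))
                  , refl , 1≤b , a≡ , bq≡

        onto : ∀ {p} → p ∈ multiples → ∃ λ x → x ∈ solutions × R x p
        onto {b , k} p∈ with ∈-pairs⁻ (range (y ℕ.* c)) (λ b → range (y ÷ reduced b)) p∈
        ... | b∈ , k∈ with ∈-range⁻ b∈ | ∈-range⁻ k∈ | ∣-reduced b k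
        ...   | 1≤b , _ | 1≤k , k≤ | divides q ca≡ = (k ℕ.* reduced b , b , q)
                , ∈-pairs⁺ (∈-range⁺ 1≤a (subst (ℕ._≤ y) (ℕ.*-comm (reduced b) k) (≤÷⇒*≤ {k = reduced b} k≤)))
                    (∈-factorings⁺ (ℕ.*-mono-≤ 1≤c 1≤a) bq≡)
                , refl , 1≤b , refl , bq≡
                where
                1≤a = ℕ.*-mono-≤ 1≤k (1≤reduced 1≤b)
                bq≡ = trans (ℕ.*-comm b q) (sym ca≡)

        solutions≡multiples : sumOver solutions (λ _ → 1ℚ) ≡ sumOver multiples (λ _ → 1ℚ)
        solutions≡multiples = ℚ.≤-antisym
          (sumOver-inject R 0≤1 multiples
            (AllPairs.map (λ x≢x′ {p} → R-injective {p = p} x≢x′) (pairs-unique (range-unique y) (λ a → factorings-unique (c ℕ.* a))))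
            λ x∈ k → let p , p∈ , r = into x∈ in k (p , p∈ , r , ℚ.≤-refl))
          (sumOver-inject (λ p x → R x p) 0≤1 solutions
            (AllPairs.map (λ p≢p′ {x} → R-functional {x = x} p≢p′) (pairs-unique (range-unique (y ℕ.* c)) (λ b → range-unique (y ÷ reduced b))))
            λ p∈ k → let x , x∈ , r = onto p∈ in k (x , x∈ , r , ℚ.≤-refl))

      -- The sums are interchanged. For fixed `b` the admissible `a` are the multiples k * reduced b
      -- up to `y`, and b ≤ y c holds throughout because b q = c a.
      count-1 : count 1 c y ≡ sumOver (range (y ℕ.* c)) (λ b → ⌜ y ÷ reduced b ⌝)
      count-1 = begin-equality
        count 1 c y                                                         ≡⟨ sumOver-pairs (range y) (λ a → factorings (c ℕ.* a)) (λ _ → 1ℚ) ⟨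
        sumOver solutions (λ _ → 1ℚ)                                        ≡⟨ solutions≡multiples ⟩
        sumOver multiples (λ _ → 1ℚ)                                        ≡⟨ sumOver-pairs (range (y ℕ.* c)) (λ b → range (y ÷ reduced b)) (λ _ → 1ℚ) ⟩
        sumOver (range (y ℕ.* c)) (λ b → sumOver (range (y ÷ reduced b)) (λ _ → 1ℚ))
                                                                            ≡⟨ sumOver-cong (range (y ℕ.* c)) (λ {b} _ →
                                                                                 trans (sumOver-1 (range (y ÷ reduced b))) (cong ⌜_⌝ (length-range (y ÷ reduced b)))) ⟩
        sumOver (range (y ℕ.* c)) (λ b → ⌜ y ÷ reduced b ⌝)                 ∎

      private
        w : ℕ → ℚ
        w b = ⌜ gcd b c ⌝

        S = sumOver (range (y ℕ.* c)) (λ b → w b * inv b)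

        y*S : sumOver (range (y ℕ.* c)) (λ b → ⌜ y ⌝ * inv (reduced b)) ≡ ⌜ y ⌝ * S
        y*S = trans (sumOver-cong (range (y ℕ.* c)) λ b∈ → cong (⌜ y ⌝ *_) (inv-reduced (proj₁ (∈-range⁻ b∈))))
          (sumOver-*ˡ (range (y ℕ.* c)) ⌜ y ⌝ (λ b → w b * inv b))

      count-1-upper : count 1 c y ≤ ⌜ y ⌝ * S
      count-1-upper = begin
        count 1 c y                                                      ≡⟨ count-1 ⟩
        sumOver (range (y ℕ.* c)) (λ b → ⌜ y ÷ reduced b ⌝)              ≤⟨ sumOver-mono (range (y ℕ.* c)) (λ b∈ → ⌜÷⌝-upper y (1≤reduced (proj₁ (∈-range⁻ b∈)))) ⟩
        sumOver (range (y ℕ.* c)) (λ b → ⌜ y ⌝ * inv (reduced b))        ≡⟨ y*S ⟩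
        ⌜ y ⌝ * S                                                        ∎

      -- Rounding down loses at most 1 for each of the y c values of `b`.
      count-1-lower : ⌜ y ⌝ * S ≤ count 1 c y + ⌜ c ⌝ * ⌜ y ⌝
      count-1-lower = begin
        ⌜ y ⌝ * S                                                        ≡⟨ y*S ⟨
        sumOver (range (y ℕ.* c)) (λ b → ⌜ y ⌝ * inv (reduced b))        ≤⟨ sumOver-mono (range (y ℕ.* c)) (λ b∈ → ⌜÷⌝-lower y (1≤reduced (proj₁ (∈-range⁻ b∈)))) ⟩
        sumOver (range (y ℕ.* c)) (λ b → ⌜ y ÷ reduced b ⌝ + 1ℚ)         ≡⟨ sumOver-+ (range (y ℕ.* c)) (λ b → ⌜ y ÷ reduced b ⌝) (λ _ → 1ℚ) ⟩
        sumOver (range (y ℕ.* c)) (λ b → ⌜ y ÷ reduced b ⌝) + sumOver (range (y ℕ.* c)) (λ _ → 1ℚ)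
                                                                         ≡⟨ cong₂ _+_ (sym count-1) (trans (sumOver-1 (range (y ℕ.* c)))
                                                                              (trans (cong ⌜_⌝ (length-range (y ℕ.* c))) (trans (⌜⌝-* y c) (ℚ.*-comm ⌜ y ⌝ ⌜ c ⌝)))) ⟩
        count 1 c y + ⌜ c ⌝ * ⌜ y ⌝                                      ∎

      W : ℚ
      W = sumOver (range c) w

      -- The constant W / c is the mean of gcd (b, c) over a period in b; it is the κ of P₁.
      S-lower : W * inv c * harmonic y ≤ S
      S-lower = periodic-lower 1≤c {w} (λ b → 0≤⌜ gcd b c ⌝) (λ j K → cong ⌜_⌝ (gcd-periodic j K)) y

      S-upper : S ≤ W + W * inv c * harmonic y
      S-upper = periodic-upper 1≤c {w} (λ b → 0≤⌜ gcd b c ⌝) (λ j K → cong ⌜_⌝ (gcd-periodic j K)) y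

-- Convergence of ∑ τ(a) ^ s / a ^ 2

module DivisorSeries where
  open import Defs using (⌜_⌝; ⌜⌝-suc; module Rational; module Log)
  open import Data.Empty using (⊥)
  open import Data.List.Base as List using (length)
  open import Data.List.Membership.Propositional using (_∈_)
  open import Data.Nat.Base as ℕ using (ℕ; zero; suc)
  open import Data.Nat.Divisibility
  open import Data.Nat.GCD using (gcd; gcd[m,n]∣n)
  import Data.Nat.Properties as ℕ
  open import Data.Product.Base using (∃; _×_; _,_; proj₁; proj₂)
  open import Data.Rational.Base hiding (_÷_)
  import Data.Rational.Properties as ℚ
  open import Data.Rational.Solver using (module +-*-Solver)
  open import Data.Nat.Solver using () renaming (module +-*-Solver to ℕ-Solver)
  open import Data.Sum.Base using (inj₁; inj₂; [_,_]′)
  open import Relation.Binary.PropositionalEquality hiding ([_])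
  open import Relation.Nullary using (contradiction; yes; no)
  open FiniteSums
  open Codes
  open Divisors
  open ℚ.≤-Reasoning
  open +-*-Solver using (solve; _:=_; _:+_; _:*_; con)
  open Rational

  τ : ℕ → ℕ
  τ n = length (factorings n)

  0≤1 : ∀ {A : Set} (x : A) → 0ℚ ≤ 1ℚ
  0≤1 _ = Log.0≤1

  -- A factorisation d * e of a * b is determined by d, and d splits as g * u with g = gcd d a and u ∣ b.
  τ-submultiplicative : ∀ {a b} → 1 ℕ.≤ a → 1 ℕ.≤ b → τ (a ℕ.* b) ℕ.≤ τ a ℕ.* τ b
  τ-submultiplicative {a} {b} 1≤a 1≤b = ⌜⌝-cancel-≤ (begin
    ⌜ τ (a ℕ.* b) ⌝                                                      ≡⟨ sumOver-1 (factorings (a ℕ.* b)) ⟨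
    sumOver (factorings (a ℕ.* b)) (λ _ → 1ℚ)                            ≤⟨ sumOver-inject R 0≤1 (pairs (factorings a) λ _ → factorings b)
                                                                              (AllPairs-∈ (λ x∈ x′∈ x≢x′ {p} r r′ → x≢x′ (factoring-unique {a ℕ.* b} x∈ x′∈ (trans r (sym r′))))
                                                                                (factorings-unique (a ℕ.* b)))
                                                                              (λ x∈ k → let p , p∈ , r = split x∈ in k (p , p∈ , r , ℚ.≤-refl)) ⟩
    sumOver (pairs (factorings a) λ _ → factorings b) (λ _ → 1ℚ)         ≡⟨ sumOver-pairs (factorings a) (λ _ → factorings b) (λ _ → 1ℚ) ⟩
    sumOver (factorings a) (λ _ → sumOver (factorings b) (λ _ → 1ℚ))     ≡⟨ sumOver-const (factorings a) _ ⟩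
    ⌜ τ a ⌝ * sumOver (factorings b) (λ _ → 1ℚ)                          ≡⟨ cong (⌜ τ a ⌝ *_) (sumOver-1 (factorings b)) ⟩
    ⌜ τ a ⌝ * ⌜ τ b ⌝                                                    ≡⟨ ⌜⌝-* (τ a) (τ b) ⟨
    ⌜ τ a ℕ.* τ b ⌝                                                      ∎)
    where
    R : ℕ × ℕ → (ℕ × ℕ) × (ℕ × ℕ) → Set
    R (d , e) ((g , _) , (u , _)) = d ≡ g ℕ.* u

    split : ∀ {x} → x ∈ factorings (a ℕ.* b) → ∃ λ p → p ∈ pairs (factorings a) (λ _ → factorings b) × R x p
    split {d , e} x∈ with ∈-factorings⁻ {a ℕ.* b} x∈
    ... | de≡ab , 1≤d , _ with Reduced.reduced∣ a {d} 1≤d {b} (divides e (trans (sym de≡ab) (ℕ.*-comm d e))) | gcd[m,n]∣n d a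
    ...   | divides v b≡ | divides h a≡ = ((gcd d a , h) , (u , v))
        , ∈-pairs⁺ (∈-factorings⁺ 1≤a (trans (ℕ.*-comm (gcd d a) h) (sym a≡))) (∈-factorings⁺ 1≤b (trans (ℕ.*-comm u v) (sym b≡)))
        , trans (Reduced.b≡ a d) (ℕ.*-comm u (gcd d a))
        where u = Reduced.reduced a d

  -- A factoring x * y of `q` gives the factoring x * (b y) of `n`, and `x` determines it.
  τ-∣ : ∀ {q n b} → 1 ℕ.≤ n → b ℕ.* q ≡ n → τ q ℕ.≤ τ n
  τ-∣ {q} {n} {b} 1≤n bq≡n = ⌜⌝-cancel-≤ (begin
    ⌜ τ q ⌝                            ≡⟨ sumOver-1 (factorings q) ⟨
    sumOver (factorings q) (λ _ → 1ℚ)  ≤⟨ sumOver-inject (λ (x , _) (x′ , _) → x ≡ x′) 0≤1 (factorings n)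
                                            (AllPairs-∈ (λ x∈ x′∈ x≢x′ {p} r r′ → x≢x′ (factoring-unique {q} x∈ x′∈ (trans r (sym r′)))) (factorings-unique q))
                                            (λ {(x , y)} x∈ k → k ((x , b ℕ.* y) , ∈-factorings⁺ 1≤n (eq x y (proj₁ (∈-factorings⁻ {q} x∈))) , refl , ℚ.≤-refl)) ⟩
    sumOver (factorings n) (λ _ → 1ℚ)  ≡⟨ sumOver-1 (factorings n) ⟩
    ⌜ τ n ⌝                            ∎)
    where
    eq : ∀ x y → x ℕ.* y ≡ q → x ℕ.* (b ℕ.* y) ≡ n
    eq x y xy≡q = trans (ℕ-Solver.solve 3 (λ x b y → x ⊗ (b ⊗ y) ℕ-Solver.:= b ⊗ (x ⊗ y)) refl x b y) (trans (cong (b ℕ.*_) xy≡q) bq≡n)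
      where open ℕ-Solver using () renaming (_:*_ to _⊗_)

  τ^-submultiplicative : ∀ s {a b} → 1 ℕ.≤ a → 1 ℕ.≤ b → τ (a ℕ.* b) ℕ.^ s ℕ.≤ τ a ℕ.^ s ℕ.* τ b ℕ.^ s
  τ^-submultiplicative s {a} {b} 1≤a 1≤b = ℕ.≤-trans (ℕ.^-monoˡ-≤ s (τ-submultiplicative 1≤a 1≤b)) (ℕ.≤-reflexive (^-distribʳ-* s (τ a) (τ b)))

  -- The part of `f` beyond `M`. Written this way, a tail is a sum over the full range and can be
  -- compared term by term with other such sums.
  trunc : ℕ → (ℕ → ℚ) → ℕ → ℚ
  trunc M f a with a ℕ.≤? M
  ... | yes _ = 0ℚ
  ... | no  _ = f a

  trunc-≤ : ∀ M f {a} → a ℕ.≤ M → trunc M f a ≡ 0ℚ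
  trunc-≤ M f {a} a≤M with a ℕ.≤? M
  ... | yes _   = refl
  ... | no  a≰M = contradiction a≤M a≰M

  trunc-> : ∀ M f {a} → M ℕ.< a → trunc M f a ≡ f a
  trunc-> M f {a} M<a with a ℕ.≤? M
  ... | yes a≤M = contradiction a≤M (ℕ.<⇒≱ M<a)
  ... | no  _   = refl

  trunc-elim : ∀ M f {P : ℚ → Set} a → (a ℕ.≤ M → P 0ℚ) → (M ℕ.< a → P (f a)) → P (trunc M f a)
  trunc-elim M f a p₀ p₁ with a ℕ.≤? M
  ... | yes a≤M = p₀ a≤M
  ... | no  a≰M = p₁ (ℕ.≰⇒> a≰M)

  sumOver-trunc : ∀ M {f} → (∀ a → 0ℚ ≤ f a) → ∀ Y →
    sumOver (range Y) f ≤ sumOver (range M) f + sumOver (range Y) (trunc M f)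
  sumOver-trunc M {f} 0≤f zero = ℚ.+-mono-≤ (sumOver-nonneg (range M) λ {a} _ → 0≤f a) ℚ.≤-refl
  sumOver-trunc M {f} 0≤f (suc Y) = trunc-elim M f {λ z → f (suc Y) + sumOver (range Y) f ≤ sumOver (range M) f + (z + T)} (suc Y)
    (λ 1+Y≤M → begin
      f (suc Y) + sumOver (range Y) f      ≤⟨ sumOver-range-mono 0≤f 1+Y≤M ⟩
      sumOver (range M) f                  ≤⟨ p≤p+q (ℚ.+-mono-≤ (ℚ.≤-refl {0ℚ}) 0≤T) ⟩
      sumOver (range M) f + (0ℚ + T)       ∎)
    (λ _ → begin
      f (suc Y) + sumOver (range Y) f               ≤⟨ ℚ.+-monoʳ-≤ (f (suc Y)) (sumOver-trunc M 0≤f Y) ⟩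
      f (suc Y) + (sumOver (range M) f + T)         ≡⟨ solve 3 (λ a b c → a :+ (b :+ c) := b :+ (a :+ c)) refl (f (suc Y)) (sumOver (range M) f) T ⟩
      sumOver (range M) f + (f (suc Y) + T)         ∎)
    where
    T = sumOver (range Y) (trunc M f)
    0≤T : 0ℚ ≤ T
    0≤T = sumOver-nonneg (range Y) λ {a} _ → trunc-elim M f {0ℚ ≤_} a (λ _ → ℚ.≤-refl) (λ _ → 0≤f a)

  -- Convergence of ∑ f a for non-negative f, as a bound on the tails.
  Summable : (ℕ → ℚ) → Set
  Summable f = ∀ {ε} → 0ℚ < ε → ∃ λ M → ∀ Y → sumOver (range Y) (trunc M f) ≤ ε

  summable-bounded : ∀ {f} → (∀ a → 0ℚ ≤ f a) → Summable f → ∃ λ B → 0ℚ < B × (∀ Y → sumOver (range Y) f ≤ B)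
  summable-bounded {f} 0≤f summable = let M , tail = summable (ℚ.positive⁻¹ 1ℚ) in
    sumOver (range M) f + 1ℚ
    , ℚ.+-mono-≤-< (sumOver-nonneg (range M) λ {a} _ → 0≤f a) (ℚ.positive⁻¹ 1ℚ)
    , λ Y → ℚ.≤-trans (sumOver-trunc M 0≤f Y) (ℚ.+-monoʳ-≤ (sumOver (range M) f) (tail Y))

  ζ : ℕ → ℕ → ℚ
  ζ s a = ⌜ τ a ℕ.^ s ⌝ * inv (a ℕ.* a)

  0≤ζ : ∀ s a → 0ℚ ≤ ζ s a
  0≤ζ s a = 0≤p*q 0≤⌜ τ a ℕ.^ s ⌝ (0≤inv (a ℕ.* a))

  -- This is 1 / (n + 1) ^ 2 ≤ 1 / (n (n + 1)) = 1 / n - 1 / (n + 1), which telescopes in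
  -- `summable-ζ₀`.
  inv-step : ∀ n → 1 ℕ.≤ n → inv (suc n ℕ.* suc n) + inv (suc n) ≤ inv n
  inv-step n 1≤n = begin
    inv (suc n ℕ.* suc n) + inv (suc n)            ≤⟨ ℚ.+-monoˡ-≤ (inv (suc n)) (inv-antitone (ℕ.*-monoˡ-≤ (suc n) (ℕ.n≤1+n n))) ⟩
    inv (n ℕ.* suc n) + inv (suc n)                ≡⟨ cong (_+ inv (suc n)) (inv-* 1≤n (ℕ.s≤s ℕ.z≤n)) ⟩
    inv n * inv (suc n) + inv (suc n)              ≡⟨ cong (inv n * inv (suc n) +_) (trans (sym (ℚ.*-identityˡ (inv (suc n)))) (cong (_* inv (suc n)) (sym (inv-inverse 1≤n)))) ⟩
    inv n * inv (suc n) + ⌜ n ⌝ * inv n * inv (suc n)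
                                                   ≡⟨ solve 3 (λ i j n → i :* j :+ n :* i :* j := i :* ((n :+ con 1ℚ) :* j)) refl (inv n) (inv (suc n)) ⌜ n ⌝ ⟩
    inv n * ((⌜ n ⌝ + 1ℚ) * inv (suc n))           ≡⟨ cong (λ z → inv n * (z * inv (suc n))) (⌜⌝-suc n) ⟨
    inv n * (⌜ suc n ⌝ * inv (suc n))              ≡⟨ cong (inv n *_) (inv-inverse {suc n} (ℕ.s≤s ℕ.z≤n)) ⟩
    inv n * 1ℚ                                     ≡⟨ ℚ.*-identityʳ (inv n) ⟩
    inv n                                          ∎

  inv-small : ∀ {ε} → 0ℚ < ε → ∃ λ M → 1 ℕ.≤ M × inv M ≤ ε
  inv-small {ε} 0<ε with shrink 0<ε (ℚ.positive⁻¹ 1ℚ)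
  ... | d , _ , εd≡1 with archimedean d
  ...   | M , d≤M = suc M , ℕ.s≤s ℕ.z≤n , (begin
    inv (suc M)                          ≡⟨ ℚ.*-identityˡ _ ⟨
    1ℚ * inv (suc M)                     ≡⟨ cong (_* inv (suc M)) εd≡1 ⟨
    ε * d * inv (suc M)                  ≤⟨ *-monoˡ (0≤inv (suc M)) (*-monoʳ (ℚ.<⇒≤ 0<ε) (ℚ.≤-trans d≤M (⌜⌝-mono (ℕ.n≤1+n M)))) ⟩
    ε * ⌜ suc M ⌝ * inv (suc M)          ≡⟨ ℚ.*-assoc ε ⌜ suc M ⌝ (inv (suc M)) ⟩
    ε * (⌜ suc M ⌝ * inv (suc M))        ≡⟨ cong (ε *_) (inv-inverse {suc M} (ℕ.s≤s ℕ.z≤n)) ⟩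
    ε * 1ℚ                               ≡⟨ ℚ.*-identityʳ ε ⟩
    ε                                    ∎)

  summable-ζ₀ : Summable (ζ 0)
  summable-ζ₀ {ε} 0<ε = let M , 1≤M , inv≤ε = inv-small 0<ε in M , λ Y → ℚ.≤-trans (bound M 1≤M Y) inv≤ε
    where
    module _ (M : ℕ) (1≤M : 1 ℕ.≤ M) where
      tail = λ Y → sumOver (range Y) (trunc M (ζ 0))

      low : ∀ {Y} → Y ℕ.≤ M → tail Y ≡ 0ℚ
      low {zero}  _   = refl
      low {suc Y} Y<M = cong₂ _+_ (trunc-≤ M (ζ 0) Y<M) (low (ℕ.<⇒≤ Y<M))

      high : ∀ k → tail (k ℕ.+ M) + inv (k ℕ.+ M) ≤ inv M
      high zero    = ℚ.≤-reflexive (trans (cong (_+ inv M) (low {M} ℕ.≤-refl)) (ℚ.+-identityˡ (inv M)))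
      high (suc k) = begin
        trunc M (ζ 0) (suc n) + tail n + inv (suc n)       ≡⟨ cong (λ z → z + tail n + inv (suc n)) (trans (trunc-> M (ζ 0) (ℕ.s≤s (ℕ.m≤n+m M k))) (ℚ.*-identityˡ (inv (suc n ℕ.* suc n)))) ⟩
        inv (suc n ℕ.* suc n) + tail n + inv (suc n)       ≡⟨ solve 3 (λ a b c → a :+ b :+ c := b :+ (a :+ c)) refl (inv (suc n ℕ.* suc n)) (tail n) (inv (suc n)) ⟩
        tail n + (inv (suc n ℕ.* suc n) + inv (suc n))     ≤⟨ ℚ.+-monoʳ-≤ (tail n) (inv-step n (ℕ.≤-trans 1≤M (ℕ.m≤n+m M k))) ⟩
        tail n + inv n                                     ≤⟨ high k ⟩
        inv M                                              ∎
        where n = k ℕ.+ M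

      bound : ∀ Y → tail Y ≤ inv M
      bound Y with ℕ.≤-total Y M
      ... | inj₁ Y≤M = ℚ.≤-trans (ℚ.≤-reflexive (low Y≤M)) (0≤inv M)
      ... | inj₂ M≤Y = subst (λ Y → tail Y ≤ inv M) (ℕ.m∸n+n≡m M≤Y) (ℚ.≤-trans (p≤p+q (0≤inv (Y ℕ.∸ M ℕ.+ M))) (high (Y ℕ.∸ M)))

  -- One factor τ(a) counts the factorings b * c of `a`, and over each of them the remaining τ(a) ^
  -- s / a ^ 2 splits submultiplicatively. So `ζ (suc s)` is dominated by the Dirichlet convolution
  -- of `ζ s` with itself.
  ζ-suc : ∀ s {a} → 1 ℕ.≤ a → ζ (suc s) a ≤ sumOver (factorings a) (λ (b , c) → ζ s b * ζ s c)
  ζ-suc s {a} 1≤a = begin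
    ⌜ τ a ℕ.* τ a ℕ.^ s ⌝ * inv (a ℕ.* a)                    ≡⟨ cong (_* inv (a ℕ.* a)) (⌜⌝-* (τ a) (τ a ℕ.^ s)) ⟩
    ⌜ τ a ⌝ * ⌜ τ a ℕ.^ s ⌝ * inv (a ℕ.* a)                  ≡⟨ ℚ.*-assoc ⌜ τ a ⌝ ⌜ τ a ℕ.^ s ⌝ (inv (a ℕ.* a)) ⟩
    ⌜ τ a ⌝ * ζ s a                                          ≡⟨ sumOver-const (factorings a) (ζ s a) ⟨
    sumOver (factorings a) (λ _ → ζ s a)                     ≤⟨ sumOver-mono (factorings a) (λ bc∈ → submult (∈-factorings⁻ {a} bc∈)) ⟩
    sumOver (factorings a) (λ (b , c) → ζ s b * ζ s c)       ∎
    where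
    submult : ∀ {b c} → b ℕ.* c ≡ a × 1 ℕ.≤ b × 1 ℕ.≤ c → ζ s a ≤ ζ s b * ζ s c
    submult {b} {c} (refl , 1≤b , 1≤c) = begin
      ⌜ τ (b ℕ.* c) ℕ.^ s ⌝ * inv (b ℕ.* c ℕ.* (b ℕ.* c))             ≤⟨ *-monoˡ (0≤inv _) (⌜⌝-mono (τ^-submultiplicative s 1≤b 1≤c)) ⟩
      ⌜ τ b ℕ.^ s ℕ.* τ c ℕ.^ s ⌝ * inv (b ℕ.* c ℕ.* (b ℕ.* c))       ≡⟨ cong₂ _*_ (⌜⌝-* (τ b ℕ.^ s) (τ c ℕ.^ s)) (trans (cong inv reorder) (inv-* (ℕ.*-mono-≤ 1≤b 1≤b) (ℕ.*-mono-≤ 1≤c 1≤c))) ⟩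
      ⌜ τ b ℕ.^ s ⌝ * ⌜ τ c ℕ.^ s ⌝ * (inv (b ℕ.* b) * inv (c ℕ.* c)) ≡⟨ solve 4 (λ a b c d → a :* b :* (c :* d) := a :* c :* (b :* d)) refl
                                                                           ⌜ τ b ℕ.^ s ⌝ ⌜ τ c ℕ.^ s ⌝ (inv (b ℕ.* b)) (inv (c ℕ.* c)) ⟩
      ζ s b * ζ s c                                                   ∎
      where
      reorder : b ℕ.* c ℕ.* (b ℕ.* c) ≡ b ℕ.* b ℕ.* (c ℕ.* c)
      reorder = ℕ-Solver.solve 2 (λ b c → b ⊗ c ⊗ (b ⊗ c) ℕ-Solver.:= b ⊗ b ⊗ (c ⊗ c)) refl b c
        where open ℕ-Solver using () renaming (_:*_ to _⊗_)

  -- b * c > M * M forces b > M or c > M, so a tail of ∑ ζ (s + 1) is bounded by twice a tail times a full sum of ∑ ζ s.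
  module _ (s M : ℕ) where
    private
      t = trunc M (ζ s)
      T = λ Y → sumOver (range Y) t
      Z = λ Y → sumOver (range Y) (ζ s)

      0≤Z : ∀ Y → 0ℚ ≤ Z Y
      0≤Z Y = sumOver-nonneg (range Y) λ {a} _ → 0≤ζ s a

      0≤t : ∀ a → 0ℚ ≤ t a
      0≤t a = trunc-elim M (ζ s) {0ℚ ≤_} a (λ _ → ℚ.≤-refl) (λ _ → 0≤ζ s a)

      g : ℕ × ℕ → ℚ
      g (b , c) = t b * ζ s c + ζ s b * t c

      0≤g : ∀ bc → 0ℚ ≤ g bc
      0≤g (b , c) = ℚ.+-mono-≤ (0≤p*q (0≤t b) (0≤ζ s c)) (0≤p*q (0≤ζ s b) (0≤t c))

      ζζ≤g : ∀ b c → M ℕ.* M ℕ.< b ℕ.* c → ζ s b * ζ s c ≤ g (b , c)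
      ζζ≤g b c M²<bc = [ large-b , large-c ]′ (ℕ.<-≤-connex M b)
        where
        large-b : M ℕ.< b → ζ s b * ζ s c ≤ g (b , c)
        large-b M<b = ℚ.≤-trans (ℚ.≤-reflexive (cong (_* ζ s c) (sym (trunc-> M (ζ s) M<b)))) (p≤p+q (0≤p*q (0≤ζ s b) (0≤t c)))

        large-c : b ℕ.≤ M → ζ s b * ζ s c ≤ g (b , c)
        large-c b≤M = ℚ.≤-trans (ℚ.≤-reflexive (cong (ζ s b *_) (sym (trunc-> M (ζ s) M<c)))) (p≤q+p (0≤p*q (0≤t b) (0≤ζ s c)))
          where
          M<c : M ℕ.< c
          M<c = ℕ.≰⇒> λ c≤M → ℕ.<⇒≱ M²<bc (ℕ.*-mono-≤ b≤M c≤M)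

      pointwise : ∀ a → 1 ℕ.≤ a → trunc (M ℕ.* M) (ζ (suc s)) a ≤ sumOver (factorings a) g
      pointwise a 1≤a = trunc-elim (M ℕ.* M) (ζ (suc s)) {_≤ sumOver (factorings a) g} a
        (λ _ → sumOver-nonneg (factorings a) λ {bc} _ → 0≤g bc)
        (λ M²<a → ℚ.≤-trans (ζ-suc s 1≤a) (sumOver-mono (factorings a) λ {(b , c)} bc∈ →
          ζζ≤g b c (subst (M ℕ.* M ℕ.<_) (sym (proj₁ (∈-factorings⁻ {a} bc∈))) M²<a)))

      R : ℕ × ℕ × ℕ → ℕ × ℕ → Set
      R (a , bc) bc′ = bc ≡ bc′

      R-injective : ∀ Y {x x′ p} → x ∈ pairs (range Y) factorings → x′ ∈ pairs (range Y) factorings → x ≢ x′ → R x p → R x′ p → ⊥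
      R-injective Y {a , bc} {a′ , bc′} x∈ x′∈ x≢x′ refl refl = x≢x′ (cong (_, bc)
        (trans (sym (proj₁ (∈-factorings⁻ {a} (proj₂ (∈-pairs⁻ (range Y) factorings x∈))))) (proj₁ (∈-factorings⁻ {a′} (proj₂ (∈-pairs⁻ (range Y) factorings x′∈))))))

      into : ∀ Y {x} → x ∈ pairs (range Y) factorings → ∃ λ p → p ∈ pairs (range Y) (λ _ → range Y) × R x p
      into Y {a , b , c} x∈ = let a∈ , bc∈ = ∈-pairs⁻ (range Y) factorings x∈
                                  bc≡a , 1≤b , 1≤c = ∈-factorings⁻ {a} bc∈
                                  bc≤Y = ℕ.≤-trans (ℕ.≤-reflexive bc≡a) (proj₂ (∈-range⁻ a∈))
        in (b , c) , ∈-pairs⁺ (∈-range⁺ 1≤b (≤-*-trans 1≤c bc≤Y)) (∈-range⁺ 1≤c (≤-*-trans {c} {b} 1≤b (subst (ℕ._≤ Y) (ℕ.*-comm b c) bc≤Y))) , refl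

    ζ-tail : ∀ Y → sumOver (range Y) (trunc (M ℕ.* M) (ζ (suc s))) ≤
      (sumOver (range Y) (ζ s) + sumOver (range Y) (ζ s)) * sumOver (range Y) (trunc M (ζ s))
    ζ-tail Y = begin
      sumOver (range Y) (trunc (M ℕ.* M) (ζ (suc s)))               ≤⟨ sumOver-mono (range Y) (λ {a} a∈ → pointwise a (proj₁ (∈-range⁻ a∈))) ⟩
      sumOver (range Y) (λ a → sumOver (factorings a) g)            ≡⟨ sumOver-pairs (range Y) factorings (λ p → g (proj₂ p)) ⟨
      sumOver (pairs (range Y) factorings) (λ p → g (proj₂ p))      ≤⟨ injected ⟩
      sumOver (pairs (range Y) λ _ → range Y) g                     ≡⟨ sumOver-pairs (range Y) (λ _ → range Y) g ⟩
      sumOver (range Y) (λ b → sumOver (range Y) λ c → t b * ζ s c + ζ s b * t c)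
                                                                    ≡⟨ sumOver-cong (range Y) (λ {b} _ → trans (sumOver-+ (range Y) (λ c → t b * ζ s c) (λ c → ζ s b * t c))
                                                                         (cong₂ _+_ (sumOver-*ˡ (range Y) (t b) (ζ s)) (sumOver-*ˡ (range Y) (ζ s b) t))) ⟩
      sumOver (range Y) (λ b → t b * Z Y + ζ s b * T Y)             ≡⟨ sumOver-+ (range Y) (λ b → t b * Z Y) (λ b → ζ s b * T Y) ⟩
      sumOver (range Y) (λ b → t b * Z Y) + sumOver (range Y) (λ b → ζ s b * T Y)
                                                                    ≡⟨ cong₂ _+_ (sumOver-*ʳ (range Y) (Z Y) t) (sumOver-*ʳ (range Y) (T Y) (ζ s)) ⟩
      T Y * Z Y + Z Y * T Y                                         ≡⟨ factor (T Y) (Z Y) ⟩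
      (Z Y + Z Y) * T Y                                             ∎
      where
      factor : ∀ t z → t * z + z * t ≡ (z + z) * t
      factor = solve 2 (λ t z → t :* z :+ z :* t := (z :+ z) :* t) refl

      -- A factoring determines the number factored, so the factorings of all a ≤ Y are distinct
      -- pairs in the square with side `Y`.
      injected : sumOver (pairs (range Y) factorings) (λ p → g (proj₂ p)) ≤ sumOver (pairs (range Y) λ _ → range Y) g
      injected = sumOver-inject R 0≤g (pairs (range Y) λ _ → range Y)
        (AllPairs-∈ (λ {x} {x′} x∈ x′∈ x≢x′ {p} r r′ → R-injective Y {x} {x′} {p} x∈ x′∈ x≢x′ r r′) (pairs-unique (range-unique Y) factorings-unique))
        (λ {x} x∈ k → let p , p∈ , r = into Y {x} x∈ in k (p , p∈ , r , ℚ.≤-reflexive (cong g r)))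

  summable-ζ : ∀ s → Summable (ζ s)
  summable-ζ zero    = summable-ζ₀
  summable-ζ (suc s) {ε} 0<ε =
    let B , 0<B , bounded = summable-bounded (0≤ζ s) (summable-ζ s)
        δ , 0<δ , 2Bδ≡ε = shrink (ℚ.+-mono-< 0<B 0<B) 0<ε
        M , tail = summable-ζ s 0<δ
        Z = λ Y → sumOver (range Y) (ζ s)
        0≤Z = λ Y → sumOver-nonneg (range Y) {ζ s} λ {a} _ → 0≤ζ s a
    in M ℕ.* M , λ Y → begin
      sumOver (range Y) (trunc (M ℕ.* M) (ζ (suc s)))               ≤⟨ ζ-tail s M Y ⟩
      (Z Y + Z Y) * sumOver (range Y) (trunc M (ζ s))               ≤⟨ *-mono (ℚ.+-mono-≤ (0≤Z Y) (0≤Z Y)) (ℚ.<⇒≤ 0<δ) (ℚ.+-mono-≤ (bounded Y) (bounded Y)) (tail Y) ⟩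
      (B + B) * δ                                                   ≡⟨ 2Bδ≡ε ⟩
      ε                                                             ∎

-- Convergence of P_s(c; y) / (y H_y), by induction on s

module Asymptotics where
  open import Defs using (⌜_⌝; ⌜⌝-suc; IsCauchy; recip; module Rational; module Log; module Cauchy)
  open import Data.List.Base as List using (List; []; _∷_)
  open import Data.List.Membership.Propositional using (_∈_)
  open import Data.List.Relation.Unary.Any using (here; there)
  open import Data.Nat.Base as ℕ using (ℕ; zero; suc)
  open import Data.Nat.GCD using (gcd; gcd-zeroʳ)
  import Data.Nat.DivMod as ℕ
  import Data.Nat.Properties as ℕ
  open import Data.Product.Base using (∃; _×_; _,_; proj₁; proj₂)
  open import Data.Rational.Base hiding (_÷_)
  import Data.Rational.Properties as ℚ
  open import Data.Rational.Solver using (module +-*-Solver)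
  open import Data.Sum.Base using (_⊎_; inj₁; inj₂)
  open import Function.Base using (_∘_)
  open import Relation.Binary.PropositionalEquality hiding ([_])
  open FiniteSums
  open Codes
  open Divisors
  open DivisorSeries
  open ℚ.≤-Reasoning
  open +-*-Solver using (solve; _:=_; _:+_; _:*_; :-_; _:-_; con)
  open Rational

  growth : ℕ → ℚ
  growth y = ⌜ y ⌝ * harmonic y

  0≤growth : ∀ y → 0ℚ ≤ growth y
  0≤growth y = 0≤p*q 0≤⌜ y ⌝ (0≤harmonic y)

  1≤growth : ∀ {y} → 1 ℕ.≤ y → 1ℚ ≤ growth y
  1≤growth {y} 1≤y = *-mono {1ℚ} {⌜ y ⌝} {1ℚ} Log.0≤1 (0≤harmonic y) (⌜⌝-mono 1≤y) (1≤harmonic 1≤y)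

  opaque
    ρ : ℕ → ℚ
    ρ y = recip (growth y)

    0≤ρ : ∀ y → 0ℚ ≤ ρ y
    0≤ρ y = Log.0≤recip (growth y)

    growth*ρ : ∀ {y} → 1 ℕ.≤ y → growth y * ρ y ≡ 1ℚ
    growth*ρ 1≤y = recip-inverse (1≤growth 1≤y)

  -- The n terms added after H_n are each at least 1 / (2n).
  harmonic-double : ∀ {n} → 1 ℕ.≤ n → ½ + harmonic n ≤ harmonic (n ℕ.+ n)
  harmonic-double {n} 1≤n = begin
    ½ + harmonic n                                                ≡⟨ cong (_+ harmonic n) half≡ ⟨
    ⌜ n ⌝ * inv (n ℕ.+ n) + harmonic n                            ≡⟨ cong (_+ harmonic n) (trans (sumOver-const (range n) (inv (n ℕ.+ n))) (cong (λ k → ⌜ k ⌝ * inv (n ℕ.+ n)) (length-range n))) ⟨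
    sumOver (range n) (λ _ → inv (n ℕ.+ n)) + harmonic n          ≤⟨ ℚ.+-monoˡ-≤ (harmonic n) (sumOver-mono (range n) λ j∈ → inv-antitone (ℕ.+-monoˡ-≤ n (proj₂ (∈-range⁻ j∈)))) ⟩
    sumOver (range n) (λ j → inv (j ℕ.+ n)) + harmonic n          ≡⟨ sumOver-range-+ n n inv ⟨
    harmonic (n ℕ.+ n)                                            ∎
    where
    h = ⌜ n ⌝ * inv (n ℕ.+ n)
    h+h≡1 : h + h ≡ 1ℚ
    h+h≡1 = trans (sym (ℚ.*-distribʳ-+ (inv (n ℕ.+ n)) ⌜ n ⌝ ⌜ n ⌝))
      (trans (cong (_* inv (n ℕ.+ n)) (sym (⌜⌝-+ n n))) (inv-inverse {n ℕ.+ n} (ℕ.≤-trans 1≤n (ℕ.m≤m+n n n))))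
    half≡ : h ≡ ½
    half≡ = trans (solve 1 (λ h → h := con ½ :* (h :+ h)) refl h) (cong (½ *_) h+h≡1)

  harmonic-unbounded : ∀ M → ∃ λ N → 1 ℕ.≤ N × ⌜ M ⌝ ≤ harmonic N
  harmonic-unbounded zero    = 1 , ℕ.s≤s ℕ.z≤n , 0≤harmonic 1
  harmonic-unbounded (suc M) =
    let N , 1≤N , M≤H = harmonic-unbounded M
        1≤2N = ℕ.≤-trans 1≤N (ℕ.m≤m+n N N)
    in N ℕ.+ N ℕ.+ (N ℕ.+ N) , ℕ.≤-trans 1≤2N (ℕ.m≤m+n (N ℕ.+ N) (N ℕ.+ N)) , (begin
      ⌜ suc M ⌝                                        ≡⟨ ⌜⌝-suc M ⟩
      ⌜ M ⌝ + 1ℚ                                       ≤⟨ ℚ.+-monoˡ-≤ 1ℚ M≤H ⟩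
      harmonic N + 1ℚ                                  ≡⟨ solve 1 (λ h → h :+ con 1ℚ := con ½ :+ (con ½ :+ h)) refl (harmonic N) ⟩
      ½ + (½ + harmonic N)                             ≤⟨ ℚ.+-monoʳ-≤ ½ (harmonic-double 1≤N) ⟩
      ½ + harmonic (N ℕ.+ N)                           ≤⟨ harmonic-double 1≤2N ⟩
      harmonic (N ℕ.+ N ℕ.+ (N ℕ.+ N))                 ∎)

  -- As H_y is unbounded, every error O(y) vanishes after division by y H_y.
  linear-negligible : ∀ {ε} → 0ℚ < ε → ∃ λ N → 1 ℕ.≤ N × (∀ {y} → N ℕ.≤ y → ⌜ y ⌝ ≤ ε * growth y)
  linear-negligible {ε} 0<ε =
    let d , _ , εd≡1 = shrink 0<ε (ℚ.positive⁻¹ 1ℚ)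
        M , d≤M = archimedean d
        N , 1≤N , M≤H = harmonic-unbounded M
    in N , 1≤N , λ {y} N≤y → begin
      ⌜ y ⌝                        ≡⟨ ℚ.*-identityʳ ⌜ y ⌝ ⟨
      ⌜ y ⌝ * 1ℚ                   ≡⟨ cong (⌜ y ⌝ *_) εd≡1 ⟨
      ⌜ y ⌝ * (ε * d)              ≤⟨ *-monoʳ 0≤⌜ y ⌝ (*-monoʳ (ℚ.<⇒≤ 0<ε) (ℚ.≤-trans d≤M (ℚ.≤-trans M≤H (harmonic-mono N≤y)))) ⟩
      ⌜ y ⌝ * (ε * harmonic y)     ≡⟨ solve 3 (λ y e h → y :* (e :* h) := e :* (y :* h)) refl ⌜ y ⌝ ε (harmonic y) ⟩
      ε * growth y                 ∎

  -- The approximating sequence `v` may change with ε, as it does in the Tannery argument, where no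
  -- limit is known beforehand. The error splits into ε/4 at each end and ε/2 for `v`.
  cauchy-approx : ∀ {u} → (∀ {ε} → 0ℚ < ε → ∃ λ v → IsCauchy v × ∃ λ N → ∀ {y} → N ℕ.≤ y → ∣ u y - v y ∣ ≤ ε) → IsCauchy u
  cauchy-approx {u} approx {ε} 0<ε =
    let v , cv , N , close = approx (half (half 0<ε))
        N′ , close′ = cv (half 0<ε)
    in N ℕ.⊔ N′ , λ {m} {n} ≤m ≤n → begin
      ∣ u m - u n ∣
        ≡⟨ cong ∣_∣ (solve 4 (λ a b c d → a :- d := (a :- b) :+ ((b :- c) :+ (c :- d))) refl (u m) (v m) (v n) (u n)) ⟩
      ∣ (u m - v m) + ((v m - v n) + (v n - u n)) ∣
        ≤⟨ ℚ.≤-trans (ℚ.∣p+q∣≤∣p∣+∣q∣ (u m - v m) _) (ℚ.+-monoʳ-≤ ∣ u m - v m ∣ (ℚ.∣p+q∣≤∣p∣+∣q∣ (v m - v n) (v n - u n))) ⟩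
      ∣ u m - v m ∣ + (∣ v m - v n ∣ + ∣ v n - u n ∣)
        ≤⟨ ℚ.+-mono-≤ (close (Cauchy.⊔-≤ˡ ≤m)) (ℚ.+-mono-≤ (close′ (Cauchy.⊔-≤ʳ {N} ≤m) (Cauchy.⊔-≤ʳ {N} ≤n))
             (subst (_≤ ½ * (½ * ε)) (∣p-q∣≡∣q-p∣ (u n) (v n)) (close (Cauchy.⊔-≤ˡ ≤n)))) ⟩
      ½ * (½ * ε) + (½ * ε + ½ * (½ * ε))
        ≡⟨ solve 1 (λ e → con ½ :* (con ½ :* e) :+ (con ½ :* e :+ con ½ :* (con ½ :* e)) := e) refl ε ⟩
      ε ∎

  cauchy-eventually : ∀ {u v} N → IsCauchy v → (∀ {y} → N ℕ.≤ y → u y ≡ v y) → IsCauchy u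
  cauchy-eventually {u} {v} N cv u≡v = cauchy-approx {u} λ 0<ε → v , cv , N , λ {y} N≤y →
    ℚ.≤-trans (ℚ.≤-reflexive (cong ∣_∣ (trans (cong (_- v y) (u≡v N≤y)) (ℚ.+-inverseʳ (v y))))) (ℚ.<⇒≤ 0<ε)

  cauchy-∘ : ∀ {s} (φ : ℕ → ℕ) → IsCauchy s → (∀ M → ∃ λ N → ∀ {n} → N ℕ.≤ n → M ℕ.≤ φ n) → IsCauchy (s ∘ φ)
  cauchy-∘ φ cs φ→∞ 0<ε = let M , close = cs 0<ε ; N , M≤φ = φ→∞ M in N , λ ≤m ≤n → close (M≤φ ≤m) (M≤φ ≤n)

  cauchy-sumOver : ∀ {A : Set} (xs : List A) {s : A → ℕ → ℚ} → (∀ {x} → x ∈ xs → IsCauchy (s x)) → IsCauchy (λ n → sumOver xs λ x → s x n)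
  cauchy-sumOver []       cs = Cauchy.const 0ℚ
  cauchy-sumOver (x ∷ xs) {s} cs = Cauchy.plus {s x} {λ n → sumOver xs λ x → s x n} (cs (here refl)) (cauchy-sumOver xs λ {z} z∈ → cs {z} (there z∈))

  growth-cauchy : ∀ {f : ℕ → ℚ} {κ K} → 0ℚ < K → (∀ {y} → 1 ℕ.≤ y → f y ≤ κ * growth y + K * ⌜ y ⌝) →
    (∀ {y} → 1 ℕ.≤ y → κ * growth y ≤ f y + K * ⌜ y ⌝) → IsCauchy (λ y → f y * ρ y)
  growth-cauchy {f} {κ} {K} 0<K upper lower = cauchy-approx {λ y → f y * ρ y} λ {ε} 0<ε →
    let δ , 0<δ , Kδ≡ε = shrink 0<K 0<ε
        N , 1≤N , small = linear-negligible 0<δ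
        error : ∀ {y} → N ℕ.≤ y → K * ⌜ y ⌝ * ρ y ≤ ε
        error {y} N≤y = begin
          K * ⌜ y ⌝ * ρ y                ≤⟨ *-monoˡ (0≤ρ y) (*-monoʳ (ℚ.<⇒≤ 0<K) (small N≤y)) ⟩
          K * (δ * growth y) * ρ y       ≡⟨ solve 4 (λ k d g r → k :* (d :* g) :* r := k :* d :* (g :* r)) refl K δ (growth y) (ρ y) ⟩
          K * δ * (growth y * ρ y)       ≡⟨ cong₂ _*_ Kδ≡ε (growth*ρ (ℕ.≤-trans 1≤N N≤y)) ⟩
          ε * 1ℚ                         ≡⟨ ℚ.*-identityʳ ε ⟩
          ε                              ∎
        κ≡ : ∀ {y} → N ℕ.≤ y → κ ≡ κ * growth y * ρ y
        κ≡ {y} N≤y = sym (trans (ℚ.*-assoc κ (growth y) (ρ y)) (trans (cong (κ *_) (growth*ρ (ℕ.≤-trans 1≤N N≤y))) (ℚ.*-identityʳ κ)))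
    in (λ _ → κ) , Cauchy.const κ , N , λ {y} N≤y → ∣p-q∣≤
      (begin
        f y * ρ y                                    ≤⟨ *-monoˡ (0≤ρ y) (upper (ℕ.≤-trans 1≤N N≤y)) ⟩
        (κ * growth y + K * ⌜ y ⌝) * ρ y             ≡⟨ ℚ.*-distribʳ-+ (ρ y) (κ * growth y) (K * ⌜ y ⌝) ⟩
        κ * growth y * ρ y + K * ⌜ y ⌝ * ρ y         ≤⟨ ℚ.+-mono-≤ (ℚ.≤-reflexive (sym (κ≡ N≤y))) (error N≤y) ⟩
        κ + ε                                        ∎)
      (begin
        κ                                            ≡⟨ κ≡ N≤y ⟩
        κ * growth y * ρ y                           ≤⟨ *-monoˡ (0≤ρ y) (lower (ℕ.≤-trans 1≤N N≤y)) ⟩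
        (f y + K * ⌜ y ⌝) * ρ y                      ≡⟨ ℚ.*-distribʳ-+ (ρ y) (f y) (K * ⌜ y ⌝) ⟩
        f y * ρ y + K * ⌜ y ⌝ * ρ y                  ≤⟨ ℚ.+-monoʳ-≤ (f y * ρ y) (error N≤y) ⟩
        f y * ρ y + ε                                ∎)

  ÷≤ : ∀ y k → y ÷ k ℕ.≤ y
  ÷≤ y zero    = ℕ.z≤n
  ÷≤ y (suc k) = ℕ.m/n≤m y (suc k)

  growth-÷-upper : ∀ y {k} → 1 ℕ.≤ k → growth (y ÷ k) ≤ inv k * growth y
  growth-÷-upper y {k} 1≤k = begin
    ⌜ y ÷ k ⌝ * harmonic (y ÷ k)        ≤⟨ *-mono 0≤⌜ y ÷ k ⌝ (0≤harmonic y) (⌜÷⌝-upper y 1≤k) (harmonic-mono (÷≤ y k)) ⟩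
    ⌜ y ⌝ * inv k * harmonic y          ≡⟨ solve 3 (λ y i h → y :* i :* h := i :* (y :* h)) refl ⌜ y ⌝ (inv k) (harmonic y) ⟩
    inv k * growth y                    ∎

  -- With z = y ÷ k one has y / k ≤ z + 1 and H_y ≤ k + 1 + H_z. The product of the two bounds
  -- exceeds z H_z by H_z + (z + 1) (k + 1); here H_z ≤ z ≤ y and 1 ≤ y, which gives the constant 1
  -- + 2 (k + 1).
  growth-÷-lower : ∀ {y k} → 1 ℕ.≤ k → 1 ℕ.≤ y →
    inv k * growth y ≤ growth (y ÷ k) + (1ℚ + ((⌜ k ⌝ + 1ℚ) + (⌜ k ⌝ + 1ℚ))) * ⌜ y ⌝
  growth-÷-lower {y} {k} 1≤k 1≤y = begin
    inv k * (⌜ y ⌝ * harmonic y)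
      ≡⟨ solve 3 (λ y i h → i :* (y :* h) := y :* i :* h) refl ⌜ y ⌝ (inv k) (harmonic y) ⟩
    ⌜ y ⌝ * inv k * harmonic y
      ≤⟨ *-mono (0≤p*q 0≤⌜ y ⌝ (0≤inv k)) (ℚ.+-mono-≤ 0≤⌜ k ⌝ (ℚ.+-mono-≤ Log.0≤1 (0≤harmonic z))) (⌜÷⌝-lower y 1≤k) harmonic≤′ ⟩
    (Z + 1ℚ) * (K + (1ℚ + h))
      ≡⟨ solve 3 (λ z k h → (z :+ con 1ℚ) :* (k :+ (con 1ℚ :+ h)) := z :* h :+ (h :+ (z :* (k :+ con 1ℚ) :+ con 1ℚ :* (k :+ con 1ℚ)))) refl Z K h ⟩
    Z * h + (h + (Z * (K + 1ℚ) + 1ℚ * (K + 1ℚ)))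
      ≤⟨ ℚ.+-monoʳ-≤ (Z * h) (ℚ.+-mono-≤ (ℚ.≤-trans (harmonic≤ z) Z≤Y) (ℚ.+-mono-≤ (*-monoˡ 0≤K+1 Z≤Y) (*-monoˡ 0≤K+1 (⌜⌝-mono 1≤y)))) ⟩
    Z * h + (Y + (Y * (K + 1ℚ) + Y * (K + 1ℚ)))
      ≡⟨ solve 3 (λ y k g → g :+ (y :+ (y :* (k :+ con 1ℚ) :+ y :* (k :+ con 1ℚ))) := g :+ (con 1ℚ :+ ((k :+ con 1ℚ) :+ (k :+ con 1ℚ))) :* y) refl Y K (Z * h) ⟩
    Z * h + (1ℚ + ((K + 1ℚ) + (K + 1ℚ))) * Y ∎
    where
    z = y ÷ k
    Z = ⌜ z ⌝
    Y = ⌜ y ⌝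
    K = ⌜ k ⌝
    h = harmonic z
    Z≤Y : Z ≤ Y
    Z≤Y = ⌜⌝-mono (÷≤ y k)
    0≤K+1 : 0ℚ ≤ K + 1ℚ
    0≤K+1 = ℚ.+-mono-≤ 0≤⌜ k ⌝ Log.0≤1
    harmonic≤′ : harmonic y ≤ K + (1ℚ + h)
    harmonic≤′ = begin
      harmonic y                       ≤⟨ harmonic-mono (≤[1+÷]* y 1≤k) ⟩
      harmonic (suc z ℕ.* k)           ≤⟨ harmonic-* 1≤k (suc z) ⟩
      K + (inv (suc z) + h)            ≤⟨ ℚ.+-monoʳ-≤ K (ℚ.+-monoˡ-≤ h (inv≤1 (suc z))) ⟩
      K + (1ℚ + h)                     ∎

  growth-÷-cauchy : ∀ {k} → 1 ℕ.≤ k → IsCauchy (λ y → growth (y ÷ k) * ρ y)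
  growth-÷-cauchy {k} 1≤k = growth-cauchy {λ y → growth (y ÷ k)} {inv k} {C} 0<C
    (λ {y} _ → ℚ.≤-trans (growth-÷-upper y 1≤k) (p≤p+q (0≤p*q (ℚ.<⇒≤ 0<C) 0≤⌜ y ⌝)))
    (growth-÷-lower 1≤k)
    where
    C = 1ℚ + ((⌜ k ⌝ + 1ℚ) + (⌜ k ⌝ + 1ℚ))
    0<C : 0ℚ < C
    0<C = ℚ.+-mono-<-≤ (ℚ.positive⁻¹ 1ℚ) (ℚ.+-mono-≤ (ℚ.+-mono-≤ 0≤⌜ k ⌝ Log.0≤1) (ℚ.+-mono-≤ 0≤⌜ k ⌝ Log.0≤1))

  0≤count : ∀ s c y → 0ℚ ≤ count s c y
  0≤count zero    c y = Log.0≤1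
  0≤count (suc s) c y = sumOver-nonneg (range y) λ {a} _ → sumOver-nonneg (factorings (c ℕ.* a)) λ {bq} _ → 0≤count s (proj₂ bq) (y ÷ a ℕ.^ suc s)

  -- The induction hypothesis on P_s. The bound is uniform in `c` up to τ(c) ^ s, because the next
  -- level sums over divisors of c a for all `a`; convergence is asked for each `c` on its own.
  record Regular (s : ℕ) : Set where
    field
      bound   : ℚ
      0<bound : 0ℚ < bound
      bounded : ∀ {c} y → 1 ℕ.≤ c → count s c y ≤ bound * ⌜ τ c ℕ.^ s ⌝ * growth y
      cauchy  : ∀ {c} → 1 ℕ.≤ c → IsCauchy (λ y → count s c y * ρ y)

  count-1-1≤growth : ∀ y → count 1 1 y ≤ growth y
  count-1-1≤growth y = ℚ.≤-trans (Reduced.count-1-upper 1 (ℕ.s≤s ℕ.z≤n) y) (ℚ.≤-reflexive (cong (⌜ y ⌝ *_)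
    (trans (cong (λ n → sumOver (range n) (λ b → ⌜ gcd b 1 ⌝ * inv b)) (ℕ.*-identityʳ y))
      (sumOver-cong (range y) λ {b} _ → trans (cong (λ g → ⌜ g ⌝ * inv b) (gcd-zeroʳ b)) (ℚ.*-identityˡ (inv b))))))

  -- Since τ(c a) ≤ τ(c) τ(a), the bound reduces to c = 1. Convergence comes from the two estimates
  -- with W / c, the rounding error and the extra `W` of the first block being O(y).
  regular-1 : Regular 1
  regular-1 = record
    { bound = 1ℚ
    ; 0<bound = ℚ.positive⁻¹ 1ℚ
    ; bounded = λ {c} y 1≤c → begin
        count 1 c y                                                   ≤⟨ sumOver-mono (range y) (λ {a} a∈ → term≤ {c} {a} 1≤c (proj₁ (∈-range⁻ a∈))) ⟩
        sumOver (range y) (λ a → ⌜ τ c ⌝ * sumOver (factorings (1 ℕ.* a)) λ _ → 1ℚ)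
                                                                      ≡⟨ sumOver-*ˡ (range y) ⌜ τ c ⌝ (λ a → sumOver (factorings (1 ℕ.* a)) λ _ → 1ℚ) ⟩
        ⌜ τ c ⌝ * count 1 1 y                                         ≤⟨ *-monoʳ 0≤⌜ τ c ⌝ (count-1-1≤growth y) ⟩
        ⌜ τ c ⌝ * growth y                                            ≡⟨ cong (_* growth y) (trans (cong ⌜_⌝ (sym (ℕ.^-identityʳ (τ c)))) (sym (ℚ.*-identityˡ ⌜ τ c ℕ.^ 1 ⌝))) ⟩
        1ℚ * ⌜ τ c ℕ.^ 1 ⌝ * growth y                                 ∎
    ; cauchy = λ {c} 1≤c → growth-cauchy {count 1 c} {W c 1≤c * inv c} {K c 1≤c} (0<K c 1≤c)
        (λ {y} 1≤y → upper c 1≤c y) (λ {y} 1≤y → lower c 1≤c y)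
    }
    where
    term≤ : ∀ {c a} → 1 ℕ.≤ c → 1 ℕ.≤ a → sumOver (factorings (c ℕ.* a)) (λ _ → 1ℚ) ≤ ⌜ τ c ⌝ * sumOver (factorings (1 ℕ.* a)) (λ _ → 1ℚ)
    term≤ {c} {a} 1≤c 1≤a = begin
      sumOver (factorings (c ℕ.* a)) (λ _ → 1ℚ)               ≡⟨ sumOver-1 (factorings (c ℕ.* a)) ⟩
      ⌜ τ (c ℕ.* a) ⌝                                         ≤⟨ ⌜⌝-mono (τ-submultiplicative 1≤c 1≤a) ⟩
      ⌜ τ c ℕ.* τ a ⌝                                         ≡⟨ ⌜⌝-* (τ c) (τ a) ⟩
      ⌜ τ c ⌝ * ⌜ τ a ⌝                                       ≡⟨ cong (λ n → ⌜ τ c ⌝ * ⌜ τ n ⌝) (ℕ.*-identityˡ a) ⟨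
      ⌜ τ c ⌝ * ⌜ τ (1 ℕ.* a) ⌝                               ≡⟨ cong (⌜ τ c ⌝ *_) (sumOver-1 (factorings (1 ℕ.* a))) ⟨
      ⌜ τ c ⌝ * sumOver (factorings (1 ℕ.* a)) (λ _ → 1ℚ)     ∎

    module _ (c : ℕ) (1≤c : 1 ℕ.≤ c) where
      W = Reduced.W c 1≤c 0

      0≤W : 0ℚ ≤ W
      0≤W = sumOver-nonneg (range c) λ {b} _ → 0≤⌜ gcd b c ⌝

      K = 1ℚ + (W + ⌜ c ⌝)

      0<K : 0ℚ < K
      0<K = ℚ.+-mono-<-≤ (ℚ.positive⁻¹ 1ℚ) (ℚ.+-mono-≤ 0≤W 0≤⌜ c ⌝)

      upper : ∀ y → count 1 c y ≤ W * inv c * growth y + K * ⌜ y ⌝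
      upper y = begin
        count 1 c y                                             ≤⟨ Reduced.count-1-upper c 1≤c y ⟩
        ⌜ y ⌝ * _                                               ≤⟨ *-monoʳ 0≤⌜ y ⌝ (Reduced.S-upper c 1≤c y) ⟩
        ⌜ y ⌝ * (W + W * inv c * harmonic y)                    ≡⟨ solve 4 (λ y w i h → y :* (w :+ w :* i :* h) := w :* i :* (y :* h) :+ w :* y) refl ⌜ y ⌝ W (inv c) (harmonic y) ⟩
        W * inv c * growth y + W * ⌜ y ⌝                        ≤⟨ ℚ.+-monoʳ-≤ (W * inv c * growth y) (*-monoˡ 0≤⌜ y ⌝ (ℚ.≤-trans (p≤p+q {W} 0≤⌜ c ⌝) (p≤q+p {W + ⌜ c ⌝} Log.0≤1))) ⟩
        W * inv c * growth y + K * ⌜ y ⌝                        ∎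

      lower : ∀ y → W * inv c * growth y ≤ count 1 c y + K * ⌜ y ⌝
      lower y = begin
        W * inv c * growth y                                    ≡⟨ solve 3 (λ y w h → w :* (y :* h) := y :* (w :* h)) refl ⌜ y ⌝ (W * inv c) (harmonic y) ⟩
        ⌜ y ⌝ * (W * inv c * harmonic y)                        ≤⟨ *-monoʳ 0≤⌜ y ⌝ (Reduced.S-lower c 1≤c y) ⟩
        ⌜ y ⌝ * _                                               ≤⟨ Reduced.count-1-lower c 1≤c y ⟩
        count 1 c y + ⌜ c ⌝ * ⌜ y ⌝                             ≤⟨ ℚ.+-monoʳ-≤ (count 1 c y) (*-monoˡ 0≤⌜ y ⌝ (ℚ.≤-trans (p≤q+p {⌜ c ⌝} 0≤W) (p≤q+p {W + ⌜ c ⌝} Log.0≤1))) ⟩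
        count 1 c y + K * ⌜ y ⌝                                 ∎

  module _ (s : ℕ) (1≤s : 1 ℕ.≤ s) (regular : Regular s) where
    open Regular regular renaming (bound to K; 0<bound to 0<K)

    private
      term : ℕ → ℕ → ℕ → ℚ
      term c y a = sumOver (factorings (c ℕ.* a)) λ (b , q) → count s q (y ÷ a ℕ.^ suc s)

      0≤term : ∀ c y a → 0ℚ ≤ term c y a
      0≤term c y a = sumOver-nonneg (factorings (c ℕ.* a)) λ {bq} _ → 0≤count s (proj₂ bq) (y ÷ a ℕ.^ suc s)

      C : ℕ → ℚ
      C c = K * ⌜ τ c ℕ.^ suc s ⌝

      0≤C : ∀ c → 0ℚ ≤ C c
      0≤C c = 0≤p*q (ℚ.<⇒≤ 0<K) 0≤⌜ τ c ℕ.^ suc s ⌝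

      -- As s ≥ 1, the divisor a ^ (s + 1) is at least a ^ 2; this is the source of the convergent
      -- factor.
      summand≤ : ∀ {n a q} y → 1 ℕ.≤ a → 1 ℕ.≤ q → τ q ℕ.≤ τ n →
        count s q (y ÷ a ℕ.^ suc s) ≤ K * ⌜ τ n ℕ.^ s ⌝ * (inv (a ℕ.* a) * growth y)
      summand≤ {n} {a} {q} y 1≤a 1≤q τq≤τn = begin
        count s q (y ÷ a ℕ.^ suc s)                                  ≤⟨ bounded (y ÷ a ℕ.^ suc s) 1≤q ⟩
        K * ⌜ τ q ℕ.^ s ⌝ * growth (y ÷ a ℕ.^ suc s)                 ≤⟨ *-mono (0≤p*q (ℚ.<⇒≤ 0<K) 0≤⌜ τ q ℕ.^ s ⌝) (0≤p*q (0≤inv (a ℕ.* a)) (0≤growth y))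
                                                                          (*-monoʳ (ℚ.<⇒≤ 0<K) (⌜⌝-mono (ℕ.^-monoˡ-≤ s τq≤τn))) shrunk ⟩
        K * ⌜ τ n ℕ.^ s ⌝ * (inv (a ℕ.* a) * growth y)               ∎
        where
        a≤a^s : a ℕ.≤ a ℕ.^ s
        a≤a^s = ℕ.≤-trans (ℕ.≤-reflexive (sym (ℕ.^-identityʳ a))) (ℕ.^-monoʳ-≤ a {{ℕ.>-nonZero 1≤a}} 1≤s)

        shrunk : growth (y ÷ a ℕ.^ suc s) ≤ inv (a ℕ.* a) * growth y
        shrunk = ℚ.≤-trans (growth-÷-upper y (1≤^ (suc s) 1≤a)) (*-monoˡ (0≤growth y) (inv-antitone (ℕ.*-monoʳ-≤ a a≤a^s)))

      -- There are τ(c a) summands, each at most τ(c a) ^ s times a common factor. The resulting τ(c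
      -- a) ^ (s + 1) splits into a power of τ(c), which goes into `C c`, and one of τ(a), which
      -- goes into `ζ (suc s) a`.
      term≤ : ∀ {c a} y → 1 ℕ.≤ c → 1 ℕ.≤ a → term c y a ≤ C c * growth y * ζ (suc s) a
      term≤ {c} {a} y 1≤c 1≤a = begin
        term c y a
          ≤⟨ sumOver-mono (factorings n) (λ {(b , q)} bq∈ → let eq , _ , 1≤q = ∈-factorings⁻ {n} bq∈ in summand≤ {n} {a} {q} y 1≤a 1≤q (τ-∣ {q} {n} {b} 1≤n eq)) ⟩
        sumOver (factorings n) (λ _ → K * ⌜ τ n ℕ.^ s ⌝ * (inv (a ℕ.* a) * growth y))
          ≡⟨ sumOver-const (factorings n) (K * ⌜ τ n ℕ.^ s ⌝ * (inv (a ℕ.* a) * growth y)) ⟩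
        ⌜ τ n ⌝ * (K * ⌜ τ n ℕ.^ s ⌝ * (inv (a ℕ.* a) * growth y))
          ≡⟨ solve 5 (λ t k p i g → t :* (k :* p :* (i :* g)) := k :* g :* i :* (t :* p)) refl ⌜ τ n ⌝ K ⌜ τ n ℕ.^ s ⌝ (inv (a ℕ.* a)) (growth y) ⟩
        K * growth y * inv (a ℕ.* a) * (⌜ τ n ⌝ * ⌜ τ n ℕ.^ s ⌝)
          ≡⟨ cong (K * growth y * inv (a ℕ.* a) *_) (⌜⌝-* (τ n) (τ n ℕ.^ s)) ⟨
        K * growth y * inv (a ℕ.* a) * ⌜ τ n ℕ.^ suc s ⌝
          ≤⟨ *-monoʳ (0≤p*q (0≤p*q (ℚ.<⇒≤ 0<K) (0≤growth y)) (0≤inv (a ℕ.* a))) (⌜⌝-mono (τ^-submultiplicative (suc s) 1≤c 1≤a)) ⟩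
        K * growth y * inv (a ℕ.* a) * ⌜ τ c ℕ.^ suc s ℕ.* τ a ℕ.^ suc s ⌝
          ≡⟨ cong (K * growth y * inv (a ℕ.* a) *_) (⌜⌝-* (τ c ℕ.^ suc s) (τ a ℕ.^ suc s)) ⟩
        K * growth y * inv (a ℕ.* a) * (⌜ τ c ℕ.^ suc s ⌝ * ⌜ τ a ℕ.^ suc s ⌝)
          ≡⟨ solve 5 (λ k g i p r → k :* g :* i :* (p :* r) := k :* p :* g :* (r :* i)) refl K (growth y) (inv (a ℕ.* a)) ⌜ τ c ℕ.^ suc s ⌝ ⌜ τ a ℕ.^ suc s ⌝ ⟩
        C c * growth y * ζ (suc s) a ∎
        where
        n = c ℕ.* a
        1≤n = ℕ.*-mono-≤ 1≤c 1≤a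

      bounded-suc : ∀ {B} → (∀ Y → sumOver (range Y) (ζ (suc s)) ≤ B) → ∀ {c} y → 1 ℕ.≤ c →
        count (suc s) c y ≤ K * B * ⌜ τ c ℕ.^ suc s ⌝ * growth y
      bounded-suc {B} Z≤B {c} y 1≤c = begin
        sumOver (range y) (term c y)                                   ≤⟨ sumOver-mono (range y) (λ {a} a∈ → term≤ {c} {a} y 1≤c (proj₁ (∈-range⁻ a∈))) ⟩
        sumOver (range y) (λ a → C c * growth y * ζ (suc s) a)         ≡⟨ sumOver-*ˡ (range y) (C c * growth y) (ζ (suc s)) ⟩
        C c * growth y * sumOver (range y) (ζ (suc s))                 ≤⟨ *-monoʳ (0≤p*q (0≤C c) (0≤growth y)) (Z≤B y) ⟩
        K * ⌜ τ c ℕ.^ suc s ⌝ * growth y * B                           ≡⟨ solve 4 (λ k t g b → k :* t :* g :* b := k :* b :* t :* g) refl K ⌜ τ c ℕ.^ suc s ⌝ (growth y) B ⟩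
        K * B * ⌜ τ c ℕ.^ suc s ⌝ * growth y                           ∎

      ÷→∞ : ∀ {k} → 1 ℕ.≤ k → ∀ M → ∃ λ N → ∀ {n} → N ℕ.≤ n → M ℕ.≤ n ÷ k
      ÷→∞ {k} 1≤k M = k ℕ.* M , *≤⇒≤÷ 1≤k

      -- The sequence is the product of P_s / growth taken at y ÷ k and of growth (y ÷ k) / growth
      -- y, both convergent. The factorisation holds from y = k on, where y ÷ k ≥ 1.
      summand-cauchy : ∀ {q k} → 1 ℕ.≤ q → 1 ℕ.≤ k → IsCauchy (λ y → count s q (y ÷ k) * ρ y)
      summand-cauchy {q} {k} 1≤q 1≤k = cauchy-eventually {λ y → count s q (y ÷ k) * ρ y} {λ y → count s q (y ÷ k) * ρ (y ÷ k) * (growth (y ÷ k) * ρ y)} k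
        (Cauchy.product {λ y → count s q (y ÷ k) * ρ (y ÷ k)} {λ y → growth (y ÷ k) * ρ y}
          (cauchy-∘ {λ y → count s q y * ρ y} (_÷ k) (cauchy 1≤q) (÷→∞ 1≤k)) (growth-÷-cauchy 1≤k))
        λ {y} k≤y → insert (count s q (y ÷ k)) (ρ y) {growth (y ÷ k)} {ρ (y ÷ k)} (growth*ρ (*≤⇒≤÷ 1≤k (ℕ.≤-trans (ℕ.≤-reflexive (ℕ.*-identityʳ k)) k≤y)))
        where
        insert : ∀ x r {g h} → g * h ≡ 1ℚ → x * r ≡ x * h * (g * r)
        insert x r {g} {h} gh≡1 = begin-equality
          x * r                ≡⟨ ℚ.*-identityʳ _ ⟨
          x * r * 1ℚ           ≡⟨ cong (x * r *_) gh≡1 ⟨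
          x * r * (g * h)      ≡⟨ solve 4 (λ x r g h → x :* r :* (g :* h) := x :* h :* (g :* r)) refl x r g h ⟩
          x * h * (g * r)      ∎

      term-cauchy : ∀ c {a} → 1 ℕ.≤ a → IsCauchy (λ y → term c y a * ρ y)
      term-cauchy c {a} 1≤a = cauchy-eventually {u = λ y → term c y a * ρ y} 0
        (cauchy-sumOver (factorings (c ℕ.* a)) {λ (b , q) y → count s q (y ÷ a ℕ.^ suc s) * ρ y}
          λ bq∈ → summand-cauchy (proj₂ (proj₂ (∈-factorings⁻ {c ℕ.* a} bq∈))) (1≤^ (suc s) 1≤a))
        λ {y} _ → sym (sumOver-*ʳ (factorings (c ℕ.* a)) (ρ y) (λ (b , q) → count s q (y ÷ a ℕ.^ suc s)))

      partial-cauchy : ∀ c M → IsCauchy (λ y → sumOver (range M) (term c y) * ρ y)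
      partial-cauchy c M = cauchy-eventually {u = λ y → sumOver (range M) (term c y) * ρ y} 0
        (cauchy-sumOver (range M) {λ a y → term c y a * ρ y} λ a∈ → term-cauchy c (proj₁ (∈-range⁻ a∈)))
        λ {y} _ → sym (sumOver-*ʳ (range M) (ρ y) (term c y))

      tail≤ : ∀ {c M y δ} → 1 ℕ.≤ c → sumOver (range y) (trunc M (ζ (suc s))) ≤ δ → sumOver (range y) (trunc M (term c y)) ≤ C c * growth y * δ
      tail≤ {c} {M} {y} {δ} 1≤c tail = begin
        sumOver (range y) (trunc M (term c y))                              ≤⟨ sumOver-mono (range y) (λ {a} a∈ → pointwise a (proj₁ (∈-range⁻ a∈)) (ℕ.≤-<-connex a M)) ⟩
        sumOver (range y) (λ a → C c * growth y * trunc M (ζ (suc s)) a)    ≡⟨ sumOver-*ˡ (range y) (C c * growth y) (trunc M (ζ (suc s))) ⟩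
        C c * growth y * sumOver (range y) (trunc M (ζ (suc s)))            ≤⟨ *-monoʳ (0≤p*q (0≤C c) (0≤growth y)) tail ⟩
        C c * growth y * δ                                                  ∎
        where
        pointwise : ∀ a → 1 ℕ.≤ a → a ℕ.≤ M ⊎ M ℕ.< a → trunc M (term c y) a ≤ C c * growth y * trunc M (ζ (suc s)) a
        pointwise a 1≤a (inj₁ a≤M) = ℚ.≤-reflexive (trans (trunc-≤ M (term c y) a≤M)
          (sym (trans (cong (C c * growth y *_) (trunc-≤ M (ζ (suc s)) a≤M)) (ℚ.*-zeroʳ (C c * growth y)))))
        pointwise a 1≤a (inj₂ M<a) = ℚ.≤-trans (ℚ.≤-reflexive (trunc-> M (term c y) M<a))
          (ℚ.≤-trans (term≤ {c} {a} y 1≤c 1≤a) (ℚ.≤-reflexive (cong (C c * growth y *_) (sym (trunc-> M (ζ (suc s)) M<a)))))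

      -- Tannery: the sum over a ≤ M converges term by term, and the tail is uniformly small.
      cauchy-suc : ∀ {c} → 1 ℕ.≤ c → IsCauchy (λ y → count (suc s) c y * ρ y)
      cauchy-suc {c} 1≤c = cauchy-approx {λ y → count (suc s) c y * ρ y} λ {ε} 0<ε →
        -- The summand 1 makes the divisor positive, given only `0≤C`.
        let δ , 0<δ , δ≡ = shrink {1ℚ + C c} (ℚ.+-mono-<-≤ (ℚ.positive⁻¹ 1ℚ) (0≤C c)) 0<ε
            M , tail = summable-ζ (suc s) 0<δ
        in (λ y → sumOver (range M) (term c y) * ρ y) , partial-cauchy c M , suc M , λ {y} M<y → close {M} {y} {δ} 0<δ δ≡ (tail y) M<y
        where
        close : ∀ {M y δ ε} → 0ℚ < δ → (1ℚ + C c) * δ ≡ ε → sumOver (range y) (trunc M (ζ (suc s))) ≤ δ → M ℕ.< y →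
          ∣ count (suc s) c y * ρ y - sumOver (range M) (term c y) * ρ y ∣ ≤ ε
        close {M} {y} {δ} {ε} 0<δ δ≡ tail M<y = ∣p-q∣≤
          (begin
            S * ρ y                                        ≤⟨ *-monoˡ (0≤ρ y) (ℚ.≤-trans (sumOver-trunc M {term c y} (0≤term c y) y) (ℚ.+-monoʳ-≤ P (tail≤ {c} {M} {y} {δ} 1≤c tail))) ⟩
            (P + C c * growth y * δ) * ρ y                 ≡⟨ solve 5 (λ p c g d r → (p :+ c :* g :* d) :* r := p :* r :+ c :* d :* (g :* r)) refl P (C c) (growth y) δ (ρ y) ⟩
            P * ρ y + C c * δ * (growth y * ρ y)           ≡⟨ cong (λ z → P * ρ y + C c * δ * z) (growth*ρ (ℕ.≤-trans (ℕ.s≤s ℕ.z≤n) M<y)) ⟩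
            P * ρ y + C c * δ * 1ℚ                         ≤⟨ ℚ.+-monoʳ-≤ (P * ρ y) (begin
                                                                C c * δ * 1ℚ      ≡⟨ ℚ.*-identityʳ _ ⟩
                                                                C c * δ           ≤⟨ *-monoˡ (ℚ.<⇒≤ 0<δ) (p≤q+p {C c} Log.0≤1) ⟩
                                                                (1ℚ + C c) * δ    ≡⟨ δ≡ ⟩
                                                                ε                 ∎) ⟩
            P * ρ y + ε                                    ∎)
          (begin
            P * ρ y                                        ≤⟨ *-monoˡ (0≤ρ y) (sumOver-range-mono {f = term c y} (0≤term c y) (ℕ.<⇒≤ M<y)) ⟩
            S * ρ y                                        ≤⟨ p≤p+q {S * ρ y} 0≤ε ⟩
            S * ρ y + ε                                    ∎)
          where
          S = sumOver (range y) (term c y)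
          P = sumOver (range M) (term c y)
          0≤ε : 0ℚ ≤ ε
          0≤ε = subst (0ℚ ≤_) δ≡ (0≤p*q (ℚ.+-mono-≤ Log.0≤1 (0≤C c)) (ℚ.<⇒≤ 0<δ))

    regular-suc : Regular (suc s)
    regular-suc = let B , 0<B , Z≤B = summable-bounded (0≤ζ (suc s)) (summable-ζ (suc s)) in record
      { bound = K * B ; 0<bound = 0<p*q 0<K 0<B ; bounded = bounded-suc Z≤B ; cauchy = cauchy-suc }

  regular : ∀ s → Regular (suc s)
  regular zero    = regular-1
  regular (suc s) = regular-suc (suc s) (ℕ.s≤s ℕ.z≤n) (regular s)

  -- The left side is the single term with a = 1, b = 1 and q = c.
  count-suc-≥ : ∀ s {c} y → 1 ℕ.≤ s → 1 ℕ.≤ c → 1 ℕ.≤ y → count s c y ≤ count (suc s) c y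
  count-suc-≥ s {c} y 1≤s 1≤c 1≤y = begin
    count s c y
      ≡⟨ cong (count s c) (trans (cong (y ÷_) (ℕ.^-zeroˡ (suc s))) (ℕ.n/1≡n y)) ⟨
    count s c (y ÷ 1 ℕ.^ suc s)
      ≤⟨ sumOver-member {f = λ (b , q) → count s q (y ÷ 1 ℕ.^ suc s)} (λ {bq} _ → 0≤count s (proj₂ bq) (y ÷ 1 ℕ.^ suc s))
           (∈-factorings⁺ {c ℕ.* 1} {1} {c} (ℕ.*-mono-≤ 1≤c (ℕ.s≤s ℕ.z≤n)) (ℕ.*-comm 1 c)) ⟩
    sumOver (factorings (c ℕ.* 1)) (λ (b , q) → count s q (y ÷ 1 ℕ.^ suc s))
      ≤⟨ sumOver-member {f = λ a → sumOver (factorings (c ℕ.* a)) λ (b , q) → count s q (y ÷ a ℕ.^ suc s)}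
           (λ {a} _ → sumOver-nonneg (factorings (c ℕ.* a)) λ {bq} _ → 0≤count s (proj₂ bq) (y ÷ a ℕ.^ suc s)) (∈-range⁺ (ℕ.s≤s ℕ.z≤n) 1≤y) ⟩
    count (suc s) c y ∎

  -- This keeps the limit of the quotients away from zero, as the relative error in the final
  -- estimate demands. At length one the constant W / c is 1 for c = 1.
  growth≤count : ∀ s {y} → 1 ℕ.≤ y → growth y ≤ count (suc s) 1 y + ⌜ y ⌝
  growth≤count zero {y} 1≤y = begin
    ⌜ y ⌝ * harmonic y                                  ≡⟨ cong (⌜ y ⌝ *_) (trans (cong (_* harmonic y) W≡1) (ℚ.*-identityˡ (harmonic y))) ⟨
    ⌜ y ⌝ * (W * inv 1 * harmonic y)                    ≤⟨ *-monoʳ 0≤⌜ y ⌝ (Reduced.S-lower 1 (ℕ.s≤s ℕ.z≤n) y) ⟩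
    _                                                   ≤⟨ Reduced.count-1-lower 1 (ℕ.s≤s ℕ.z≤n) y ⟩
    count 1 1 y + ⌜ 1 ⌝ * ⌜ y ⌝                         ≡⟨ cong (count 1 1 y +_) (ℚ.*-identityˡ ⌜ y ⌝) ⟩
    count 1 1 y + ⌜ y ⌝                                 ∎
    where
    W = Reduced.W 1 (ℕ.s≤s ℕ.z≤n) y
    W≡1 : W * inv 1 ≡ 1ℚ
    W≡1 = trans (cong (_* inv 1) (ℚ.+-identityʳ 1ℚ)) (trans (ℚ.*-identityˡ (inv 1)) inv-1)
  growth≤count (suc s) {y} 1≤y = ℚ.≤-trans (growth≤count s 1≤y) (ℚ.+-monoˡ-≤ ⌜ y ⌝ (count-suc-≥ (suc s) {1} y (ℕ.s≤s ℕ.z≤n) (ℕ.s≤s ℕ.z≤n) 1≤y))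

-- Harmonic numbers against the logarithm, and the final estimate

module Logarithm where
  open import Defs using (⌜_⌝; ⌜⌝-suc; recip; riemann; step; logApprox; A; summatory; module Rational; module Log; module Cauchy; ℝ; mkℝ; seq; fromℕ; [1,∞⟩; point; ⌊point⌋)
  import Defs as ℝ
  open import Data.Nat.Base as ℕ using (ℕ; zero; suc)
  import Data.Nat.Properties as ℕ
  open import Data.Product.Base using (∃; _,_; proj₁; proj₂)
  open import Data.Rational.Base hiding (_÷_)
  import Data.Rational.Properties as ℚ
  open import Data.Rational.Solver using (module +-*-Solver)
  open import Data.Sum.Base using ([_,_]′)
  open import Relation.Binary.PropositionalEquality hiding ([_])
  open FiniteSums
  open Codes
  open Divisors
  open Asymptotics
  open Counting using (summatory≡count)
  open ℚ.≤-Reasoning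
  open +-*-Solver using (solve; _:=_; _:+_; _:*_; :-_; _:-_; con)
  open Rational

  -- After cross-multiplication the two sides are v + i v v′ and v′ + i v v′.
  secant-mono : ∀ {v v′ i} → 0ℚ ≤ v → v ≤ v′ → 0ℚ ≤ i → v * recip (1ℚ + i * v) ≤ v′ * recip (1ℚ + i * v′)
  secant-mono {v} {v′} {i} 0≤v v≤v′ 0≤i = begin
    v * R                          ≡⟨ ℚ.*-identityʳ _ ⟨
    v * R * 1ℚ                     ≡⟨ cong (v * R *_) (recip-inverse {T′} (1≤ (ℚ.≤-trans 0≤v v≤v′))) ⟨
    v * R * (T′ * R′)              ≡⟨ solve 5 (λ v i v′ r r′ → v :* r :* ((con 1ℚ :+ i :* v′) :* r′) := (v :+ i :* v :* v′) :* (r :* r′)) refl v i v′ R R′ ⟩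
    (v + i * v * v′) * (R * R′)    ≤⟨ *-monoˡ (0≤p*q (Log.0≤recip T) (Log.0≤recip T′)) (ℚ.+-monoˡ-≤ (i * v * v′) v≤v′) ⟩
    (v′ + i * v * v′) * (R * R′)   ≡⟨ solve 5 (λ v i v′ r r′ → (v′ :+ i :* v :* v′) :* (r :* r′) := v′ :* r′ :* ((con 1ℚ :+ i :* v) :* r)) refl v i v′ R R′ ⟩
    v′ * R′ * (T * R)              ≡⟨ cong (v′ * R′ *_) (recip-inverse {T} (1≤ 0≤v)) ⟩
    v′ * R′ * 1ℚ                   ≡⟨ ℚ.*-identityʳ _ ⟩
    v′ * R′                        ∎
    where
    T = 1ℚ + i * v
    T′ = 1ℚ + i * v′
    R = recip T
    R′ = recip T′
    1≤ : ∀ {v} → 0ℚ ≤ v → 1ℚ ≤ 1ℚ + i * v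
    1≤ 0≤v = p≤p+q {1ℚ} (0≤p*q 0≤i 0≤v)

  equiRiemann-mono : ∀ {h h′} → 0ℚ ≤ h → h ≤ h′ → ∀ k → Log.equiRiemann h k ≤ Log.equiRiemann h′ k
  equiRiemann-mono {h} {h′} 0≤h h≤h′ k = Log.∑-mono (suc k) λ i _ →
    secant-mono {step h k} {step h′ k} {⌜ suc i ⌝} (Log.0≤step 0≤h k) (*-monoˡ (Log.0≤unit k) h≤h′) 0≤⌜ suc i ⌝

  -- With step 1 the right endpoints are the integers from 2 to k + 1, so only the first harmonic
  -- term is missing.
  riemann-1 : ∀ k → riemann 1ℚ k + 1ℚ ≡ harmonic (suc k)
  riemann-1 zero    = trans (ℚ.+-comm 0ℚ 1ℚ) (cong (_+ 0ℚ) (sym inv-1))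
  riemann-1 (suc k) = begin-equality
    riemann 1ℚ k + 1ℚ * recip (1ℚ + ⌜ suc k ⌝ * 1ℚ) + 1ℚ    ≡⟨ cong (λ z → riemann 1ℚ k + z + 1ℚ) term ⟩
    riemann 1ℚ k + inv (suc (suc k)) + 1ℚ                   ≡⟨ solve 3 (λ a b c → a :+ b :+ c := b :+ (a :+ c)) refl (riemann 1ℚ k) (inv (suc (suc k))) 1ℚ ⟩
    inv (suc (suc k)) + (riemann 1ℚ k + 1ℚ)                 ≡⟨ cong (inv (suc (suc k)) +_) (riemann-1 k) ⟩
    harmonic (suc (suc k))                                  ∎
    where
    term : 1ℚ * recip (1ℚ + ⌜ suc k ⌝ * 1ℚ) ≡ inv (suc (suc k))
    term = trans (ℚ.*-identityˡ _) (trans (cong recip (trans (cong (1ℚ +_) (ℚ.*-identityʳ ⌜ suc k ⌝))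
      (trans (ℚ.+-comm 1ℚ ⌜ suc k ⌝) (sym (⌜⌝-suc (suc k)))))) (sym (inv≡recip (suc (suc k)))))

  step-1 : ∀ m → step ⌜ suc m ⌝ m ≡ 1ℚ
  step-1 m = Log.⌜⌝*unit m

  equiRiemann-integer : ∀ m → Log.equiRiemann ⌜ suc m ⌝ m + 1ℚ ≡ harmonic (suc (suc m))
  equiRiemann-integer m = trans (cong (λ v → riemann v (suc m) + 1ℚ) (step-1 m)) (riemann-1 (suc m))

  -- The interval is enlarged to the integer length m + 1, and the subdivision is changed to m + 1
  -- parts of length 1, where the sum is harmonic. The change costs one step, that is 1, which
  -- restores the missing first term; the last term of H is then bounded by 1.
  logApprox-upper : ∀ {m q} n → q ≤ ⌜ suc m ⌝ + 1ℚ → logApprox q n ≤ harmonic (suc m) + 1ℚ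
  logApprox-upper {m} {q} n q≤ = begin
    Log.equiRiemann (0ℚ ⊔ (q - 1ℚ)) n                       ≤⟨ equiRiemann-mono (ℚ.p≤p⊔q 0ℚ (q - 1ℚ)) h≤ n ⟩
    Log.equiRiemann ⌜ suc m ⌝ n                             ≤⟨ Log.equiRiemann-close 0≤⌜ suc m ⌝ n m ⟩
    Log.equiRiemann ⌜ suc m ⌝ m + step ⌜ suc m ⌝ m          ≡⟨ cong (Log.equiRiemann ⌜ suc m ⌝ m +_) (step-1 m) ⟩
    Log.equiRiemann ⌜ suc m ⌝ m + 1ℚ                        ≡⟨ equiRiemann-integer m ⟩
    inv (suc (suc m)) + harmonic (suc m)                    ≤⟨ ℚ.+-monoˡ-≤ (harmonic (suc m)) (inv≤1 (suc (suc m))) ⟩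
    1ℚ + harmonic (suc m)                                   ≡⟨ ℚ.+-comm 1ℚ (harmonic (suc m)) ⟩
    harmonic (suc m) + 1ℚ                                   ∎
    where
    h≤ : 0ℚ ⊔ (q - 1ℚ) ≤ ⌜ suc m ⌝
    h≤ = ℚ.⊔-lub 0≤⌜ suc m ⌝ (p≤q+r⇒p-q≤r 1ℚ (ℚ.≤-trans q≤ (ℚ.≤-reflexive (ℚ.+-comm ⌜ suc m ⌝ 1ℚ))))

  -- The 3 consists of one unit for the last harmonic term, one for the first, and one for the
  -- change of subdivision, whose step is at most 1 as m ≤ n.
  logApprox-lower : ∀ {m q} n → m ℕ.≤ n → ⌜ suc m ⌝ ≤ q - 1ℚ → harmonic (suc (suc (suc m))) ≤ logApprox q n + ⌜ 3 ⌝
  logApprox-lower {m} {q} n m≤n ≤q-1 = begin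
    inv (suc (suc (suc m))) + harmonic (suc (suc m))                  ≤⟨ ℚ.+-monoˡ-≤ (harmonic (suc (suc m))) (inv≤1 (suc (suc (suc m)))) ⟩
    1ℚ + harmonic (suc (suc m))                                       ≡⟨ cong (1ℚ +_) (equiRiemann-integer m) ⟨
    1ℚ + (Log.equiRiemann ⌜ suc m ⌝ m + 1ℚ)                           ≤⟨ ℚ.+-monoʳ-≤ 1ℚ (ℚ.+-monoˡ-≤ 1ℚ (Log.equiRiemann-close 0≤⌜ suc m ⌝ m n)) ⟩
    1ℚ + (Log.equiRiemann ⌜ suc m ⌝ n + step ⌜ suc m ⌝ n + 1ℚ)        ≤⟨ ℚ.+-monoʳ-≤ 1ℚ (ℚ.+-monoˡ-≤ 1ℚ (ℚ.+-mono-≤ (equiRiemann-mono 0≤⌜ suc m ⌝ (ℚ.≤-trans ≤q-1 (ℚ.p≤q⊔p 0ℚ (q - 1ℚ))) n) step≤1)) ⟩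
    1ℚ + (logApprox q n + 1ℚ + 1ℚ)                                    ≡⟨ solve 1 (λ l → con 1ℚ :+ (l :+ con 1ℚ :+ con 1ℚ) := l :+ con ⌜ 3 ⌝) refl (logApprox q n) ⟩
    logApprox q n + ⌜ 3 ⌝                                             ∎
    where
    step≤1 : step ⌜ suc m ⌝ n ≤ 1ℚ
    step≤1 = ℚ.≤-trans (*-monoˡ (Log.0≤unit n) (⌜⌝-mono (ℕ.s≤s m≤n))) (ℚ.≤-reflexive (step-1 n))

  module _ {uN un g ℓ H N q δ ε : ℚ}
    (close : ∣ uN - un ∣ ≤ δ) (½≤un : ½ ≤ un) (q≤ : q ≤ N + 1ℚ) (≤q : N ≤ q + 1ℚ) (ℓ≤ : ℓ ≤ H + ⌜ 3 ⌝) (≤ℓ : H ≤ ℓ + ⌜ 3 ⌝)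
    (0≤H : 0ℚ ≤ H) (H≤N : H ≤ N) (1≤N : 1ℚ ≤ N) (g≡ : g ≡ N * H) (7N≤ : ⌜ 7 ⌝ * N ≤ δ * g) (0≤δ : 0ℚ ≤ δ) (δ≤½ : δ ≤ ½) (6δ≤ε : ⌜ 6 ⌝ * δ ≤ ε) where
    private
      0≤N = ℚ.≤-trans Log.0≤1 1≤N
      0≤un = ℚ.≤-trans (ℚ.nonNegative⁻¹ ½) ½≤un

      0≤g : 0ℚ ≤ g
      0≤g = subst (0ℚ ≤_) (sym g≡) (0≤p*q 0≤N 0≤H)

      0≤q : 0ℚ ≤ q
      0≤q = ℚ.≤-trans (p≤q+r⇒p-q≤r {1ℚ} 1ℚ (ℚ.≤-reflexive refl)) (ℚ.≤-trans (ℚ.+-monoˡ-≤ (- 1ℚ) 1≤N) (p≤q+r⇒p-q≤r 1ℚ (ℚ.≤-trans ≤q (ℚ.≤-reflexive (ℚ.+-comm q 1ℚ)))))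

      qℓ-close : ∣ g - q * ℓ ∣ ≤ δ * g
      qℓ-close = begin
        ∣ g - q * ℓ ∣                                   ≡⟨ ∣p-q∣≡∣q-p∣ g (q * ℓ) ⟩
        ∣ q * ℓ - g ∣                                   ≡⟨ cong (λ g → ∣ q * ℓ - g ∣) g≡ ⟩
        ∣ q * ℓ - N * H ∣                               ≤⟨ ∣*∣-lip q ℓ N H ⟩
        ∣ q ∣ * ∣ ℓ - H ∣ + ∣ H ∣ * ∣ q - N ∣           ≤⟨ ℚ.+-mono-≤ (*-mono (ℚ.0≤∣p∣ q) (ℚ.nonNegative⁻¹ ⌜ 3 ⌝) ∣q∣≤ (∣p-q∣≤ ℓ≤ ≤ℓ))
                                                                      (*-mono (ℚ.0≤∣p∣ H) Log.0≤1 ∣H∣≤ (∣p-q∣≤ q≤ ≤q)) ⟩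
        (N + N) * ⌜ 3 ⌝ + N * 1ℚ                        ≡⟨ solve 1 (λ n → (n :+ n) :* con ⌜ 3 ⌝ :+ n :* con 1ℚ := con ⌜ 7 ⌝ :* n) refl N ⟩
        ⌜ 7 ⌝ * N                                       ≤⟨ 7N≤ ⟩
        δ * g                                           ∎
        where
        ∣q∣≤ : ∣ q ∣ ≤ N + N
        ∣q∣≤ = ℚ.≤-trans (ℚ.≤-reflexive (ℚ.0≤p⇒∣p∣≡p 0≤q)) (ℚ.≤-trans q≤ (ℚ.+-monoʳ-≤ N 1≤N))
        ∣H∣≤ : ∣ H ∣ ≤ N
        ∣H∣≤ = ℚ.≤-trans (ℚ.≤-reflexive (ℚ.0≤p⇒∣p∣≡p 0≤H)) H≤N

      g≤2qℓ : g ≤ ⌜ 2 ⌝ * (q * ℓ)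
      g≤2qℓ = begin
        g                              ≡⟨ solve 1 (λ g → g := (g :+ g) :- g) refl g ⟩
        g + g - g                      ≤⟨ ℚ.+-monoˡ-≤ (- g) (ℚ.+-mono-≤ g≤ g≤) ⟩
        (q * ℓ + ½ * g) + (q * ℓ + ½ * g) - g
                                       ≡⟨ solve 2 (λ x g → (x :+ con ½ :* g) :+ (x :+ con ½ :* g) :- g := con ⌜ 2 ⌝ :* x) refl (q * ℓ) g ⟩
        ⌜ 2 ⌝ * (q * ℓ)                ∎
        where
        g≤ : g ≤ q * ℓ + ½ * g
        g≤ = ℚ.≤-trans (p≤q+∣p-q∣ g (q * ℓ)) (ℚ.+-monoʳ-≤ (q * ℓ) (ℚ.≤-trans qℓ-close (*-monoˡ 0≤g δ≤½)))

    -- Here N, H, q and ℓ stand for ⌊x⌋, its harmonic number, and approximations to x and log x,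
    -- while `uN` and `un` approximate the constant. The bound 7 N in `qℓ-close` is 2 N times 3 plus
    -- N times 1. The total error is at most δ g + un δ g, hence at most 3 un δ g because un ≥ ½;
    -- with g ≤ 2 q ℓ, which uses δ ≤ ½, this gives the factor 6.
    relative-error : ∣ uN * g - un * (q * ℓ) ∣ ≤ ε * ∣ un * (q * ℓ) ∣
    relative-error = begin
      ∣ uN * g - un * (q * ℓ) ∣
        ≡⟨ cong ∣_∣ (solve 4 (λ a b g x → a :* g :- b :* x := (a :- b) :* g :+ b :* (g :- x)) refl uN un g (q * ℓ)) ⟩
      ∣ (uN - un) * g + un * (g - q * ℓ) ∣
        ≤⟨ ℚ.∣p+q∣≤∣p∣+∣q∣ ((uN - un) * g) (un * (g - q * ℓ)) ⟩
      ∣ (uN - un) * g ∣ + ∣ un * (g - q * ℓ) ∣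
        ≡⟨ cong₂ _+_ (trans (ℚ.∣p*q∣≡∣p∣*∣q∣ (uN - un) g) (cong (∣ uN - un ∣ *_) (ℚ.0≤p⇒∣p∣≡p 0≤g)))
             (trans (ℚ.∣p*q∣≡∣p∣*∣q∣ un (g - q * ℓ)) (cong (_* ∣ g - q * ℓ ∣) (ℚ.0≤p⇒∣p∣≡p 0≤un))) ⟩
      ∣ uN - un ∣ * g + un * ∣ g - q * ℓ ∣
        ≤⟨ ℚ.+-mono-≤ (*-monoˡ 0≤g close) (*-monoʳ 0≤un qℓ-close) ⟩
      δ * g + un * (δ * g)
        ≡⟨ cong (_+ un * (δ * g)) (solve 1 (λ x → x := con ⌜ 2 ⌝ :* con ½ :* x) refl (δ * g)) ⟩
      ⌜ 2 ⌝ * ½ * (δ * g) + un * (δ * g)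
        ≤⟨ ℚ.+-monoˡ-≤ (un * (δ * g)) (*-monoˡ (0≤p*q 0≤δ 0≤g) (*-monoʳ (ℚ.nonNegative⁻¹ ⌜ 2 ⌝) ½≤un)) ⟩
      ⌜ 2 ⌝ * un * (δ * g) + un * (δ * g)
        ≡⟨ solve 3 (λ u d g → con ⌜ 2 ⌝ :* u :* (d :* g) :+ u :* (d :* g) := con ⌜ 3 ⌝ :* u :* d :* g) refl un δ g ⟩
      ⌜ 3 ⌝ * un * δ * g
        ≤⟨ *-monoʳ (0≤p*q (0≤p*q (ℚ.nonNegative⁻¹ ⌜ 3 ⌝) 0≤un) 0≤δ) g≤2qℓ ⟩
      ⌜ 3 ⌝ * un * δ * (⌜ 2 ⌝ * (q * ℓ))
        ≡⟨ solve 3 (λ u d x → con ⌜ 3 ⌝ :* u :* d :* (con ⌜ 2 ⌝ :* x) := con ⌜ 6 ⌝ :* d :* (u :* x)) refl un δ (q * ℓ) ⟩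
      ⌜ 6 ⌝ * δ * (un * (q * ℓ))
        ≤⟨ ℚ.≤-trans (*-monoʳ (0≤p*q (ℚ.nonNegative⁻¹ ⌜ 6 ⌝) 0≤δ) (p≤∣p∣ (un * (q * ℓ)))) (*-monoˡ (ℚ.0≤∣p∣ (un * (q * ℓ))) 6δ≤ε) ⟩
      ε * ∣ un * (q * ℓ) ∣ ∎

  module _ (s : ℕ) where
    open Regular (regular s) using (cauchy)

    u : ℕ → ℚ
    u y = count (suc s) 1 y * ρ y

    leading : ℝ
    leading = mkℝ u (cauchy {1} (ℕ.s≤s ℕ.z≤n))

    count≡u*growth : ∀ {y} → 1 ℕ.≤ y → count (suc s) 1 y ≡ u y * growth y
    count≡u*growth {y} 1≤y = sym (trans (ℚ.*-assoc (count (suc s) 1 y) (ρ y) (growth y))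
      (trans (cong (count (suc s) 1 y *_) (trans (ℚ.*-comm (ρ y) (growth y)) (growth*ρ 1≤y))) (ℚ.*-identityʳ _)))

    ½≤u : ∀ {y} → 1 ℕ.≤ y → ⌜ y ⌝ ≤ ½ * growth y → ½ ≤ u y
    ½≤u {y} 1≤y y≤ = begin
      ½                                           ≡⟨ ℚ.*-identityʳ ½ ⟨
      ½ * 1ℚ                                      ≡⟨ cong (½ *_) (growth*ρ 1≤y) ⟨
      ½ * (growth y * ρ y)                        ≡⟨ solve 2 (λ g r → con ½ :* (g :* r) := (g :- con ½ :* g) :* r) refl (growth y) (ρ y) ⟩
      (growth y - ½ * growth y) * ρ y             ≤⟨ *-monoˡ (0≤ρ y) (p≤q+r⇒p-q≤r (½ * growth y) (begin
                                                       growth y                              ≤⟨ growth≤count s 1≤y ⟩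
                                                       count (suc s) 1 y + ⌜ y ⌝             ≤⟨ ℚ.+-monoʳ-≤ (count (suc s) 1 y) y≤ ⟩
                                                       count (suc s) 1 y + ½ * growth y      ≡⟨ ℚ.+-comm (count (suc s) 1 y) (½ * growth y) ⟩
                                                       ½ * growth y + count (suc s) 1 y      ∎)) ⟩
      u y                                         ∎

    -- Let η be the gap witnessing x < ⌊x⌋ + 1. If ⌊x⌋ < X, then ⌊x⌋ + 1 ≤ X ≤ x + η / 2, which
    -- contradicts x + η ≤ ⌊x⌋ + 1.
    floor≥ : ∀ {X} x → fromℕ X ℝ.≤ point x → X ℕ.≤ ⌊point⌋ x
    floor≥ {X} x X≤x with [1,∞⟩.<1+⌊point⌋ x
    ... | η , N₁ , 0<η , below with X≤x (½ * η) (half 0<η)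
    ...   | N₂ , above = ℕ.≮⇒≥ λ N<X → ℚ.<-irrefl refl (begin-strict
      ⌜ suc (⌊point⌋ x) ⌝            ≤⟨ ⌜⌝-mono N<X ⟩
      ⌜ X ⌝                          ≤⟨ above n (ℕ.m≤n⊔m N₁ N₂) ⟩
      p + ½ * η                      <⟨ ℚ.+-monoʳ-< p (subst (½ * η <_) (½+½ η) (subst (_< ½ * η + ½ * η) (ℚ.+-identityʳ (½ * η)) (ℚ.+-monoʳ-< (½ * η) (half 0<η)))) ⟩
      p + η                          ≤⟨ below n (ℕ.m≤m⊔n N₁ N₂) ⟩
      ⌜ suc (⌊point⌋ x) ⌝            ∎)
      where
      n = N₁ ℕ.⊔ N₂
      p = seq (point x) n

    module _ {ε : ℚ} (0<ε : 0ℚ < ε) where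
      private
        -- The cap at 3 makes δ = ε′ / 6 at most ½.
        ε′ = ε ⊓ ⌜ 3 ⌝
        0<ε′ : 0ℚ < ε′
        0<ε′ = [ (λ eq → subst (0ℚ <_) (sym eq) 0<ε) , (λ eq → subst (0ℚ <_) (sym eq) (ℚ.positive⁻¹ ⌜ 3 ⌝)) ]′ (ℚ.⊓-sel ε ⌜ 3 ⌝)

        δ-data = shrink {⌜ 6 ⌝} (ℚ.positive⁻¹ ⌜ 6 ⌝) 0<ε′
        δ = proj₁ δ-data
        0<δ = proj₁ (proj₂ δ-data)

        6δ≤ε : ⌜ 6 ⌝ * δ ≤ ε
        6δ≤ε = ℚ.≤-trans (ℚ.≤-reflexive (proj₂ (proj₂ δ-data))) (ℚ.p⊓q≤p ε ⌜ 3 ⌝)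

        δ≤½ : δ ≤ ½
        δ≤½ = ℚ.*-cancelˡ-≤-pos ⌜ 6 ⌝ (ℚ.≤-trans (ℚ.≤-reflexive (proj₂ (proj₂ δ-data))) (ℚ.p⊓q≤q ε ⌜ 3 ⌝))

        η-data = shrink {⌜ 7 ⌝} (ℚ.positive⁻¹ ⌜ 7 ⌝) 0<δ
        η = proj₁ η-data
        negligible = linear-negligible (proj₁ (proj₂ η-data))
        halfway = linear-negligible (ℚ.positive⁻¹ ½)
        near = cauchy {1} (ℕ.s≤s ℕ.z≤n) 0<δ

        N₁ = proj₁ negligible
        N₂ = proj₁ halfway
        N₃ = proj₁ near

      threshold : ℕ
      -- Beyond `N₁` the error 7 N is at most δ growth N, and beyond `N₃` the value u N is within δ
      -- of every later u n. The 3 lets N be written as m + 3, the form used by `logApprox-lower`.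
      threshold = (N₁ ℕ.⊔ N₂) ℕ.⊔ (N₃ ℕ.⊔ 3)

      eventually : ∀ x → fromℕ threshold ℝ.≤ point x → ∃ λ n₀ → ∀ n → n₀ ℕ.≤ n →
        ∣ ⌜ summatory (A (suc s)) (⌊point⌋ x) ⌝ - u n * (seq (point x) n * logApprox (seq (point x) n) n) ∣ ≤
        ε * ∣ u n * (seq (point x) n * logApprox (seq (point x) n) n) ∣
      eventually x X≤x = go (⌊point⌋ x) refl
        (ℕ.≤-trans (Cauchy.⊔-≤ʳ {N₃} (Cauchy.⊔-≤ʳ {N₁ ℕ.⊔ N₂} (ℕ.≤-refl {threshold}))) (floor≥ x X≤x))
        (ℕ.≤-trans (Cauchy.⊔-≤ˡ (Cauchy.⊔-≤ˡ (ℕ.≤-refl {threshold}))) (floor≥ x X≤x))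
        (ℕ.≤-trans (Cauchy.⊔-≤ˡ (Cauchy.⊔-≤ʳ {N₁ ℕ.⊔ N₂} (ℕ.≤-refl {threshold}))) (floor≥ x X≤x))
        where
        module _ (N : ℕ) (⌊x⌋≡N : ⌊point⌋ x ≡ N) where
          -- A slack of 1 is affordable: approximations to x then stay within 1 of N on both sides,
          -- and q - 1 is still at least N - 2 = m + 1.
          lower = [1,∞⟩.⌊point⌋≤ x 1ℚ (ℚ.positive⁻¹ 1ℚ)
          upper = [1,∞⟩.<1+⌊point⌋ x

          -- Besides respecting the two bounds on the floor, `n` has to pass `N₂` for u n ≥ ½, `N₃`
          -- for u n close to u N, and `N` for the step in `logApprox-lower` to be at most 1.
          n₀ : ℕ
          n₀ = (proj₁ lower ℕ.⊔ proj₁ (proj₂ upper)) ℕ.⊔ ((N₂ ℕ.⊔ N₃) ℕ.⊔ N)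

          module _ {n} (n₀≤n : n₀ ℕ.≤ n) where
            q = seq (point x) n

            ≤q+1 : ⌜ N ⌝ ≤ q + 1ℚ
            ≤q+1 = subst (λ N → ⌜ N ⌝ ≤ q + 1ℚ) ⌊x⌋≡N (proj₂ lower n (Cauchy.⊔-≤ˡ (Cauchy.⊔-≤ˡ n₀≤n)))

            q≤N+1 : q ≤ ⌜ N ⌝ + 1ℚ
            q≤N+1 = begin
              q                            ≤⟨ p≤p+q {q} (ℚ.<⇒≤ (proj₁ (proj₂ (proj₂ upper)))) ⟩
              q + proj₁ upper              ≤⟨ proj₂ (proj₂ (proj₂ upper)) n (Cauchy.⊔-≤ʳ {proj₁ lower} (Cauchy.⊔-≤ˡ n₀≤n)) ⟩
              ⌜ suc (⌊point⌋ x) ⌝          ≡⟨ cong (λ N → ⌜ suc N ⌝) ⌊x⌋≡N ⟩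
              ⌜ suc N ⌝                    ≡⟨ ⌜⌝-suc N ⟩
              ⌜ N ⌝ + 1ℚ                   ∎

            N₂≤n : N₂ ℕ.≤ n
            N₂≤n = Cauchy.⊔-≤ˡ {N₂} {N₃} (Cauchy.⊔-≤ˡ {N₂ ℕ.⊔ N₃} (Cauchy.⊔-≤ʳ {proj₁ lower ℕ.⊔ proj₁ (proj₂ upper)} n₀≤n))

            N₃≤n : N₃ ℕ.≤ n
            N₃≤n = Cauchy.⊔-≤ʳ {N₂} (Cauchy.⊔-≤ˡ {N₂ ℕ.⊔ N₃} (Cauchy.⊔-≤ʳ {proj₁ lower ℕ.⊔ proj₁ (proj₂ upper)} n₀≤n))

            N≤n : N ℕ.≤ n
            N≤n = Cauchy.⊔-≤ʳ {N₂ ℕ.⊔ N₃} (Cauchy.⊔-≤ʳ {proj₁ lower ℕ.⊔ proj₁ (proj₂ upper)} n₀≤n)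

        go : ∀ N → ⌊point⌋ x ≡ N → 3 ℕ.≤ N → N₁ ℕ.≤ ⌊point⌋ x → N₃ ℕ.≤ ⌊point⌋ x → ∃ λ n₀ → ∀ n → n₀ ℕ.≤ n →
          ∣ ⌜ summatory (A (suc s)) (⌊point⌋ x) ⌝ - u n * (seq (point x) n * logApprox (seq (point x) n) n) ∣ ≤
          ε * ∣ u n * (seq (point x) n * logApprox (seq (point x) n) n) ∣
        go N@(suc (suc (suc m))) eq (ℕ.s≤s (ℕ.s≤s (ℕ.s≤s ℕ.z≤n))) N₁≤ N₃≤ = n₀ N eq , λ n n₀≤n →
          subst (λ S → ∣ S - u n * (q N eq n₀≤n * logApprox (q N eq n₀≤n) n) ∣ ≤ ε * ∣ u n * (q N eq n₀≤n * logApprox (q N eq n₀≤n) n) ∣) (sym S≡)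
            (relative-error {u N} {u n} {growth N} {logApprox (q N eq n₀≤n) n} {harmonic N} {⌜ N ⌝} {q N eq n₀≤n} {δ} {ε}
              (proj₂ near (subst (N₃ ℕ.≤_) eq N₃≤) (N₃≤n N eq n₀≤n))
              (½≤u (ℕ.≤-trans (proj₁ (proj₂ halfway)) (N₂≤n N eq n₀≤n)) (proj₂ (proj₂ halfway) (N₂≤n N eq n₀≤n)))
              (q≤N+1 N eq n₀≤n) (≤q+1 N eq n₀≤n)
              (ℚ.≤-trans (logApprox-upper {suc (suc m)} {q N eq n₀≤n} n (q≤N+1 N eq n₀≤n)) (ℚ.+-monoʳ-≤ (harmonic N) (⌜⌝-mono {1} {3} (ℕ.s≤s ℕ.z≤n))))
              (logApprox-lower {m} {q N eq n₀≤n} n (ℕ.≤-trans (ℕ.m≤n+m m 3) (N≤n N eq n₀≤n)) (below n₀≤n))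
              (0≤harmonic N) (harmonic≤ N) (⌜⌝-mono {1} {N} (ℕ.s≤s ℕ.z≤n)) refl 7N≤ (ℚ.<⇒≤ 0<δ) δ≤½ 6δ≤ε)
          where
          S≡ : ⌜ summatory (A (suc s)) (⌊point⌋ x) ⌝ ≡ u N * growth N
          S≡ = trans (cong (λ N → ⌜ summatory (A (suc s)) N ⌝) eq) (trans (summatory≡count (suc s) (ℕ.s≤s ℕ.z≤n) N) (count≡u*growth {N} (ℕ.s≤s ℕ.z≤n)))

          7N≤ : ⌜ 7 ⌝ * ⌜ N ⌝ ≤ δ * growth N
          7N≤ = begin
            ⌜ 7 ⌝ * ⌜ N ⌝              ≤⟨ *-monoʳ (ℚ.nonNegative⁻¹ ⌜ 7 ⌝) (proj₂ (proj₂ negligible) (subst (N₁ ℕ.≤_) eq N₁≤)) ⟩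
            ⌜ 7 ⌝ * (η * growth N)     ≡⟨ ℚ.*-assoc ⌜ 7 ⌝ η (growth N) ⟨
            ⌜ 7 ⌝ * η * growth N       ≡⟨ cong (_* growth N) (proj₂ (proj₂ η-data)) ⟩
            δ * growth N               ∎

          below : ∀ {n} (n₀≤n : n₀ N eq ℕ.≤ n) → ⌜ suc m ⌝ ≤ q N eq n₀≤n - 1ℚ
          below n₀≤n = begin
            ⌜ suc m ⌝                                ≡⟨ solve 1 (λ a → a := (a :+ con 1ℚ :+ con 1ℚ) :- con 1ℚ :- con 1ℚ) refl ⌜ suc m ⌝ ⟩
            ⌜ suc m ⌝ + 1ℚ + 1ℚ - 1ℚ - 1ℚ            ≡⟨ cong (λ z → z - 1ℚ - 1ℚ) (trans (cong (_+ 1ℚ) (sym (⌜⌝-suc (suc m)))) (sym (⌜⌝-suc (suc (suc m))))) ⟩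
            ⌜ N ⌝ - 1ℚ - 1ℚ                          ≤⟨ ℚ.+-monoˡ-≤ (- 1ℚ) (p≤q+r⇒p-q≤r 1ℚ {q N eq n₀≤n} (ℚ.≤-trans (≤q+1 N eq n₀≤n) (ℚ.≤-reflexive (ℚ.+-comm (q N eq n₀≤n) 1ℚ)))) ⟩
            q N eq n₀≤n - 1ℚ                         ∎

open import Defs
open import Data.Nat.Base as ℕ using (ℕ; suc)
open import Data.Product.Base using (∃; _,_)
import Data.Rational.Properties as ℚ
open Divisors using (p≤p+q)
open Logarithm using (leading; threshold; eventually)

corollary3 : ∀ (r : ℕ) → 1 ℕ.≤ r →
    ∃ λ (C : ℝ) →
    (λ x → fromℕ (summatory (A r) (⌊point⌋ x)))
    ∼ (λ x → C * (point x * log (point x) (1≤point x)))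
corollary3 (suc s) _ = leading s , λ ε 0<ε → threshold s 0<ε , λ x X≤x η 0<η →
  -- The approximations satisfy the inequality without slack from `n₀` on, so the η allowed by the
  -- order on ℝ is simply added.
  let n₀ , bound = eventually s 0<ε x X≤x in n₀ , λ n n₀≤n → ℚ.≤-trans (bound n n₀≤n) (p≤p+q (ℚ.<⇒≤ 0<η))
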